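{- For every $\mathcal L_{\mathsf{ID}}$-formula $\psi$: if $\Pi^1_1\text{ - }\mathsf{CA}_0^-+\{\operatorname{LF}_\varphi(Y_\varphi)\mid\varphi\text{ an operator form}\}\vdash\psi^\star$, then $\mathsf{ID}_1\vdash\psi$.
   Context: Formulas are in negation normal form (built from literals by $\land,\lor,\forall,\exists$; $\neg$ and $\to$ are abbreviations via de Morgan laws). $\mathcal L_{\mathsf{PA}}^X$ is the language of first order arithmetic with an extra unary predicate $X$. An operator form is an $\mathcal L^X_{\mathsf{PA}}$-formula $\varphi(x,X)$ with a single free number variable $x$ and no subformula of the form $\neg Xt$. $\mathcal L_{\mathsf{ID}}$ extends $\mathcal L_{\mathsf{PA}}$ by a unary predicate $I_\varphi$ for each operator form $\varphi$; $\varphi(x,\psi)$ denotes the result of replacing each $Xt$ in $\varphi$ by $\psi(t)$, and $\varphi(x,I_\varphi)$ that of replacing $Xt$ by $I_\varphi t$. $\mathsf{ID}_1$ is the $\mathcal L_{\mathsf{ID}}$-theory consisting of Peano arithmetic with equality and induction axioms for all $\mathcal L_{\mathsf{ID}}$-formulas, plus the schemata (F) $\forall x(\varphi(x,I_\varphi)\to I_\varphi x)$ and (L) $\forall x(\varphi(x,\psi)\to\psi(x))\to\forall x(I_\varphi x\to\psi(x))$ for operator forms $\varphi$ and $\mathcal L_{\mathsf{ID}}$-formulas $\psi$. $\Pi^1_1\text{ - }\mathsf{CA}_0^-$ is $\mathsf{ACA}_0$ plus comprehension for all $\Pi^1_1$-formulas without free set variables (number parameters allowed). Viewing $X$ as a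 set variable, operator forms are $\mathcal L_2$-formulas; $\operatorname{Cl}_\varphi(X):=\forall x\in\mathbb N(\varphi(x,X)\to x\in X)$ and $\operatorname{LF}_\varphi(Y):=\forall x\in\mathbb N\,(x\in Y\leftrightarrow\forall X\subseteq\mathbb N(\operatorname{Cl}_\varphi(X)\to x\in X))$. To each operator form $\varphi$ a fixed set variable $Y_\varphi$ is associated, and $\psi^\star$ is obtained from an $\mathcal L_{\mathsf{ID}}$-formula $\psi$ by replacing each $I_\varphi t$ by $t\in Y_\varphi$. -}

module Defs where

open import Data.Nat using (ℕ; zero; suc; _+_; _<_)
open import Data.Unit using (⊤; tt)
open import Data.Empty using (⊥; ⊥-elim)
open import Data.Product using (_×_)
open import Data.List using (List; []; _∷_; map)
open import Data.List.Membership.Propositional using (_∈_)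
open import Data.List.Relation.Binary.Subset.Propositional using (_⊆_)

-- Terms of L_PA (number variables as de Bruijn indices)

data Tm : Set where
  var : ℕ → Tm
  𝟎   : Tm
  S   : Tm → Tm
  _⊕_ : Tm → Tm → Tm
  _⊗_ : Tm → Tm → Tm

Sub : Set
Sub = ℕ → Tm

substT : Sub → Tm → Tm
substT σ (var i) = σ i
substT σ 𝟎 = 𝟎
substT σ (S t) = S (substT σ t)
substT σ (t ⊕ u) = substT σ t ⊕ substT σ u
substT σ (t ⊗ u) = substT σ t ⊗ substT σ u

_∷ₛ_ : Tm → Sub → Sub
(t ∷ₛ σ) zero = t
(t ∷ₛ σ) (suc i) = σ i

wk : ℕ → Tm
wk i = var (suc i)

liftN : Sub → Sub
liftN σ = var zero ∷ₛ (λ i → substT wk (σ i))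

BoundT : ℕ → Tm → Set
BoundT k (var i) = i < k
BoundT k 𝟎 = ⊤
BoundT k (S t) = BoundT k t
BoundT k (t ⊕ u) = BoundT k t × BoundT k u
BoundT k (t ⊗ u) = BoundT k t × BoundT k u

-- First-order formulas in negation normal form, over the language of PA
-- extended by unary predicate symbols from P.
--   Fm ⊥        : L_PA
--   Fm ⊤        : L_PA^X  (the unique predicate is X)
--   Fm OpForm   : L_ID    (predicates I_φ)

data Fm (P : Set) : Set where
  _≐_ : Tm → Tm → Fm P
  _≠_ : Tm → Tm → Fm P
  pos : P → Tm → Fm P
  neg : P → Tm → Fm P
  _∧_ : Fm P → Fm P → Fm P
  _∨_ : Fm P → Fm P → Fm P
  ∀'  : Fm P → Fm P
  ∃'  : Fm P → Fm P

infixr 6 _∧_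
infixr 5 _∨_

sub : {P : Set} → Sub → Fm P → Fm P
sub σ (t ≐ u) = substT σ t ≐ substT σ u
sub σ (t ≠ u) = substT σ t ≠ substT σ u
sub σ (pos p t) = pos p (substT σ t)
sub σ (neg p t) = neg p (substT σ t)
sub σ (A ∧ B) = sub σ A ∧ sub σ B
sub σ (A ∨ B) = sub σ A ∨ sub σ B
sub σ (∀' A) = ∀' (sub (liftN σ) A)
sub σ (∃' A) = ∃' (sub (liftN σ) A)

shift : {P : Set} → Fm P → Fm P
shift = sub wk

¬' : {P : Set} → Fm P → Fm P
¬' (t ≐ u) = t ≠ u
¬' (t ≠ u) = t ≐ u
¬' (pos p t) = neg p t
¬' (neg p t) = pos p t
¬' (A ∧ B) = ¬' A ∨ ¬' B
¬' (A ∨ B) = ¬' A ∧ ¬' B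
¬' (∀' A) = ∃' (¬' A)
¬' (∃' A) = ∀' (¬' A)

_⇒_ : {P : Set} → Fm P → Fm P → Fm P
A ⇒ B = ¬' A ∨ B
infixr 4 _⇒_

mapP : {P Q : Set} → (P → Q) → Fm P → Fm Q
mapP f (t ≐ u) = t ≐ u
mapP f (t ≠ u) = t ≠ u
mapP f (pos p t) = pos (f p) t
mapP f (neg p t) = neg (f p) t
mapP f (A ∧ B) = mapP f A ∧ mapP f B
mapP f (A ∨ B) = mapP f A ∨ mapP f B
mapP f (∀' A) = ∀' (mapP f A)
mapP f (∃' A) = ∃' (mapP f A)

BoundF : {P : Set} → ℕ → Fm P → Set
BoundF k (t ≐ u) = BoundT k t × BoundT k u
BoundF k (t ≠ u) = BoundT k t × BoundT k u
BoundF k (pos p t) = BoundT k t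
BoundF k (neg p t) = BoundT k t
BoundF k (A ∧ B) = BoundF k A × BoundF k B
BoundF k (A ∨ B) = BoundF k A × BoundF k B
BoundF k (∀' A) = BoundF (suc k) A
BoundF k (∃' A) = BoundF (suc k) A

NoNeg : Fm ⊤ → Set
NoNeg (t ≐ u) = ⊤
NoNeg (t ≠ u) = ⊤
NoNeg (pos _ t) = ⊤
NoNeg (neg _ t) = ⊥
NoNeg (A ∧ B) = NoNeg A × NoNeg B
NoNeg (A ∨ B) = NoNeg A × NoNeg B
NoNeg (∀' A) = NoNeg A
NoNeg (∃' A) = NoNeg A

record OpForm : Set where
  constructor opform
  field
    form     : Fm ⊤
    positive : NoNeg form
    onlyX    : BoundF 1 form
open OpForm public

-- φ(x,ψ): replace each X t in φ by ψ(t). ψ is a formula whose variable 0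
-- is x and whose variables i+1 are its parameters; the result lives in the
-- same context as ψ (variable 0 = x).
plug : {Q : Set} → ℕ → Fm Q → Fm ⊤ → Fm Q
plug k ψ (t ≐ u) = t ≐ u
plug k ψ (t ≠ u) = t ≠ u
plug k ψ (pos _ t) = sub (t ∷ₛ (λ i → var (suc (i + k)))) ψ
plug k ψ (neg _ t) = ¬' (sub (t ∷ₛ (λ i → var (suc (i + k)))) ψ)
plug k ψ (A ∧ B) = plug k ψ A ∧ plug k ψ B
plug k ψ (A ∨ B) = plug k ψ A ∨ plug k ψ B
plug k ψ (∀' A) = ∀' (plug (suc k) ψ A)
plug k ψ (∃' A) = ∃' (plug (suc k) ψ A)

_[_] : {Q : Set} → OpForm → Fm Q → Fm Q
φ [ ψ ] = plug 0 ψ (form φ)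

_[I] : OpForm → Fm OpForm
φ [I] = mapP (λ _ → φ) (form φ)

-- Tait-style sequent calculus for first-order logic over an axiom set.
-- Axioms are schemata with free variables: every substitution instance
-- may be used. Equality is an ordinary binary relation; its properties
-- are given by the equality axioms of the theory.

data _⊢_ {P : Set} (Ax : Fm P → Set) : List (Fm P) → Set where
  idR   : ∀ {Δ} (A : Fm P) → A ∈ Δ → ¬' A ∈ Δ → Ax ⊢ Δ
  ∧R    : ∀ {Δ A B} → (A ∧ B) ∈ Δ → Ax ⊢ (A ∷ Δ) → Ax ⊢ (B ∷ Δ) → Ax ⊢ Δ
  ∨R    : ∀ {Δ A B} → (A ∨ B) ∈ Δ → Ax ⊢ (A ∷ B ∷ Δ) → Ax ⊢ Δ
  ∀R    : ∀ {Δ A} → ∀' A ∈ Δ → Ax ⊢ (A ∷ map shift Δ) → Ax ⊢ Δ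
  ∃R    : ∀ {Δ A} → ∃' A ∈ Δ → (t : Tm) → Ax ⊢ (sub (t ∷ₛ var) A ∷ Δ) → Ax ⊢ Δ
  cut   : ∀ {Δ} (A : Fm P) → Ax ⊢ (A ∷ Δ) → Ax ⊢ (¬' A ∷ Δ) → Ax ⊢ Δ
  axR   : ∀ {Δ A} → Ax A → (σ : Sub) → sub σ A ∈ Δ → Ax ⊢ Δ
  weak  : ∀ {Δ Γ} → Δ ⊆ Γ → Ax ⊢ Δ → Ax ⊢ Γ

x y z : Tm
x = var 0
y = var 1
z = var 2

data PABasic : Fm ⊥ → Set where
  ax-S0   : PABasic (S x ≠ 𝟎)
  ax-SS   : PABasic (S x ≐ S y ⇒ x ≐ y)
  ax-+0   : PABasic ((x ⊕ 𝟎) ≐ x)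
  ax-+S   : PABasic ((x ⊕ S y) ≐ S (x ⊕ y))
  ax-*0   : PABasic ((x ⊗ 𝟎) ≐ 𝟎)
  ax-*S   : PABasic ((x ⊗ S y) ≐ ((x ⊗ y) ⊕ x))
  eq-refl : PABasic (x ≐ x)
  eq-tr   : PABasic (x ≐ y ⇒ x ≐ z ⇒ y ≐ z)
  eq-S    : PABasic (x ≐ y ⇒ S x ≐ S y)
  eq-+l   : PABasic (x ≐ y ⇒ (x ⊕ z) ≐ (y ⊕ z))
  eq-+r   : PABasic (x ≐ y ⇒ (z ⊕ x) ≐ (z ⊕ y))
  eq-*l   : PABasic (x ≐ y ⇒ (x ⊗ z) ≐ (y ⊗ z))
  eq-*r   : PABasic (x ≐ y ⇒ (z ⊗ x) ≐ (z ⊗ y))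

Ind : {P : Set} → Fm P → Fm P
Ind A = (sub (𝟎 ∷ₛ var) A ∧ ∀' (A ⇒ sub (S (var 0) ∷ₛ wk) A)) ⇒ ∀' A

data ID₁ : Fm OpForm → Set where
  pa    : ∀ {A} → PABasic A → ID₁ (mapP ⊥-elim A)
  eq-I  : (φ : OpForm) → ID₁ (x ≐ y ⇒ pos φ x ⇒ pos φ y)
  ind   : (A : Fm OpForm) → ID₁ (Ind A)
  ax-F  : (φ : OpForm) → ID₁ (∀' (φ [I] ⇒ pos φ (var 0)))
  ax-L  : (φ : OpForm) (ψ : Fm OpForm) →
          ID₁ (∀' (φ [ ψ ] ⇒ ψ) ⇒ ∀' (pos φ (var 0) ⇒ ψ))

-- Second-order language L_2 with set constants from C
-- (number and set variables as separate de Bruijn indices).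

data STm (C : Set) : Set where
  sv : ℕ → STm C
  sc : C → STm C

data Fm2 (C : Set) : Set where
  eq² : Tm → Tm → Fm2 C
  ne² : Tm → Tm → Fm2 C
  ∈²  : Tm → STm C → Fm2 C
  ∉²  : Tm → STm C → Fm2 C
  ∧²  : Fm2 C → Fm2 C → Fm2 C
  ∨²  : Fm2 C → Fm2 C → Fm2 C
  ∀ⁿ  : Fm2 C → Fm2 C
  ∃ⁿ  : Fm2 C → Fm2 C
  ∀ˢ  : Fm2 C → Fm2 C
  ∃ˢ  : Fm2 C → Fm2 C

SSub : Set → Set
SSub C = ℕ → STm C

renS : {C : Set} → (ℕ → ℕ) → STm C → STm C
renS f (sv i) = sv (f i)
renS f (sc c) = sc c

_∷ˢ_ : {C : Set} → STm C → SSub C → SSub C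
(s ∷ˢ τ) zero = s
(s ∷ˢ τ) (suc i) = τ i

liftS : {C : Set} → SSub C → SSub C
liftS τ = sv zero ∷ˢ (λ i → renS suc (τ i))

sub2 : {C : Set} → Sub → SSub C → Fm2 C → Fm2 C
sub2 σ τ (eq² t u) = eq² (substT σ t) (substT σ u)
sub2 σ τ (ne² t u) = ne² (substT σ t) (substT σ u)
sub2 σ τ (∈² t s) = ∈² (substT σ t) (τ' s)
  where τ' : _ → _
        τ' (sv i) = τ i
        τ' (sc c) = sc c
sub2 σ τ (∉² t s) = ∉² (substT σ t) (τ' s)
  where τ' : _ → _
        τ' (sv i) = τ i
        τ' (sc c) = sc c
sub2 σ τ (∧² A B) = ∧² (sub2 σ τ A) (sub2 σ τ B)
sub2 σ τ (∨² A B) = ∨² (sub2 σ τ A) (sub2 σ τ B)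
sub2 σ τ (∀ⁿ A) = ∀ⁿ (sub2 (liftN σ) τ A)
sub2 σ τ (∃ⁿ A) = ∃ⁿ (sub2 (liftN σ) τ A)
sub2 σ τ (∀ˢ A) = ∀ˢ (sub2 σ (liftS τ) A)
sub2 σ τ (∃ˢ A) = ∃ˢ (sub2 σ (liftS τ) A)

shiftN : {C : Set} → Fm2 C → Fm2 C
shiftN = sub2 wk sv

shiftS : {C : Set} → Fm2 C → Fm2 C
shiftS = sub2 var (λ i → sv (suc i))

¬² : {C : Set} → Fm2 C → Fm2 C
¬² (eq² t u) = ne² t u
¬² (ne² t u) = eq² t u
¬² (∈² t s) = ∉² t s
¬² (∉² t s) = ∈² t s
¬² (∧² A B) = ∨² (¬² A) (¬² B)
¬² (∨² A B) = ∧² (¬² A) (¬² B)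
¬² (∀ⁿ A) = ∃ⁿ (¬² A)
¬² (∃ⁿ A) = ∀ⁿ (¬² A)
¬² (∀ˢ A) = ∃ˢ (¬² A)
¬² (∃ˢ A) = ∀ˢ (¬² A)

_⇒²_ : {C : Set} → Fm2 C → Fm2 C → Fm2 C
A ⇒² B = ∨² (¬² A) B

_⇔²_ : {C : Set} → Fm2 C → Fm2 C → Fm2 C
A ⇔² B = ∧² (A ⇒² B) (B ⇒² A)

emb : {P C : Set} → (P → STm C) → Fm P → Fm2 C
emb f (t ≐ u) = eq² t u
emb f (t ≠ u) = ne² t u
emb f (pos p t) = ∈² t (f p)
emb f (neg p t) = ∉² t (f p)
emb f (A ∧ B) = ∧² (emb f A) (emb f B)
emb f (A ∨ B) = ∨² (emb f A) (emb f B)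
emb f (∀' A) = ∀ⁿ (emb f A)
emb f (∃' A) = ∃ⁿ (emb f A)

-- ψ⋆ : replace I_φ t by t ∈ Y_φ (Y_φ is the set constant sc φ)
_⋆ : Fm OpForm → Fm2 OpForm
ψ ⋆ = emb sc ψ

data _⊢²_ {C : Set} (Ax : Fm2 C → Set) : List (Fm2 C) → Set where
  idR   : ∀ {Δ} (A : Fm2 C) → A ∈ Δ → ¬² A ∈ Δ → Ax ⊢² Δ
  ∧R    : ∀ {Δ A B} → ∧² A B ∈ Δ → Ax ⊢² (A ∷ Δ) → Ax ⊢² (B ∷ Δ) → Ax ⊢² Δ
  ∨R    : ∀ {Δ A B} → ∨² A B ∈ Δ → Ax ⊢² (A ∷ B ∷ Δ) → Ax ⊢² Δ
  ∀ⁿR   : ∀ {Δ A} → ∀ⁿ A ∈ Δ → Ax ⊢² (A ∷ map shiftN Δ) → Ax ⊢² Δ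
  ∃ⁿR   : ∀ {Δ A} → ∃ⁿ A ∈ Δ → (t : Tm) → Ax ⊢² (sub2 (t ∷ₛ var) sv A ∷ Δ) → Ax ⊢² Δ
  ∀ˢR   : ∀ {Δ A} → ∀ˢ A ∈ Δ → Ax ⊢² (A ∷ map shiftS Δ) → Ax ⊢² Δ
  ∃ˢR   : ∀ {Δ A} → ∃ˢ A ∈ Δ → (s : STm C) → Ax ⊢² (sub2 var (s ∷ˢ sv) A ∷ Δ) → Ax ⊢² Δ
  cut   : ∀ {Δ} (A : Fm2 C) → Ax ⊢² (A ∷ Δ) → Ax ⊢² (¬² A ∷ Δ) → Ax ⊢² Δ
  axR   : ∀ {Δ A} → Ax A → (σ : Sub) (τ : SSub C) → sub2 σ τ A ∈ Δ → Ax ⊢² Δ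
  weak  : ∀ {Δ Γ} → Δ ⊆ Γ → Ax ⊢² Δ → Ax ⊢² Γ

Arith : {C : Set} → Fm2 C → Set
Arith (eq² _ _) = ⊤
Arith (ne² _ _) = ⊤
Arith (∈² _ _) = ⊤
Arith (∉² _ _) = ⊤
Arith (∧² A B) = Arith A × Arith B
Arith (∨² A B) = Arith A × Arith B
Arith (∀ⁿ A) = Arith A
Arith (∃ⁿ A) = Arith A
Arith (∀ˢ A) = ⊥
Arith (∃ˢ A) = ⊥

Π¹₁ : {C : Set} → Fm2 C → Set
Π¹₁ (∀ˢ A) = Arith A
Π¹₁ _ = ⊥

NoFreeSetT : {C : Set} → ℕ → STm C → Set
NoFreeSetT k (sv i) = i < k
NoFreeSetT k (sc _) = ⊥

NoFreeSet : {C : Set} → ℕ → Fm2 C → Set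
NoFreeSet k (eq² _ _) = ⊤
NoFreeSet k (ne² _ _) = ⊤
NoFreeSet k (∈² _ s) = NoFreeSetT k s
NoFreeSet k (∉² _ s) = NoFreeSetT k s
NoFreeSet k (∧² A B) = NoFreeSet k A × NoFreeSet k B
NoFreeSet k (∨² A B) = NoFreeSet k A × NoFreeSet k B
NoFreeSet k (∀ⁿ A) = NoFreeSet k A
NoFreeSet k (∃ⁿ A) = NoFreeSet k A
NoFreeSet k (∀ˢ A) = NoFreeSet (suc k) A
NoFreeSet k (∃ˢ A) = NoFreeSet (suc k) A

Comp : {C : Set} → Fm2 C → Fm2 C
Comp A = ∃ˢ (∀ⁿ (∈² (var 0) (sv 0) ⇔² shiftS A))

X₀ : {C : Set} → STm C
X₀ = sv 0

Cl : {C : Set} → OpForm → Fm2 C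
Cl φ = ∀ⁿ (emb (λ _ → X₀) (form φ) ⇒² ∈² (var 0) X₀)

LF : OpForm → Fm2 OpForm
LF φ = ∀ⁿ (∈² (var 0) (sc φ) ⇔² ∀ˢ (Cl φ ⇒² ∈² (var 0) X₀))

data Π¹₁-CA₀⁻+LF : Fm2 OpForm → Set where
  pa      : ∀ {A} → PABasic A → Π¹₁-CA₀⁻+LF (emb ⊥-elim A)
  eq-∈    : Π¹₁-CA₀⁻+LF (eq² x y ⇒² (∈² x X₀ ⇒² ∈² y X₀))
  set-ind : Π¹₁-CA₀⁻+LF (∧² (∈² 𝟎 X₀) (∀ⁿ (∈² (var 0) X₀ ⇒² ∈² (S (var 0)) X₀))
                          ⇒² ∀ⁿ (∈² (var 0) X₀))
  aca     : (A : Fm2 OpForm) → Arith A → Π¹₁-CA₀⁻+LF (Comp A)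
  π11ca   : (A : Fm2 OpForm) → Π¹₁ A → NoFreeSet 0 A → Π¹₁-CA₀⁻+LF (Comp A)
  lf      : (φ : OpForm) → Π¹₁-CA₀⁻+LF (LF φ)

{-# OPTIONS --safe #-}
module Submission where

-- The theory ID₁ is extended to a classical Kripke model of the second-order theory: worlds are
-- sequents, falsity is derivability in ID₁, numbers are terms and sets are L_ID-formulas with a
-- distinguished variable. Arithmetical formulas are evaluated by L_ID-formulas, so arithmetical
-- comprehension and set induction hold, and (F) and (L) give LF. What remains is that
-- ∀X B(x, X) with B arithmetical is equivalent to an L_ID-formula.
--
-- Bring ¬B into Skolem form: it holds for some X iff some function f satisfies an arithmetical
-- condition on all triples of its values. The well-founded part of the tree of finite attempts at f
-- is inductively defined. If the root belongs to it, (L) shows that no definable f exists. If not,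
-- the leftmost branch is definable and yields a definable X with ¬B(x, X). Sequences are iterated
-- pairs for the pairing polynomial (a + b)² + a, with the suffix relation defined by the same
-- induction, so that no arithmetical coding of sequences is needed.

open import Defs
open import Data.Nat using (ℕ; zero; suc; _+_; _<_; _≤_; _⊔_; z≤n; s≤s; _<?_)
open import Data.Nat.Properties using (≤-refl; ≤-trans; <-irrefl; m≤m⊔n; m≤n⊔m; n≤1+n; +-suc; +-identityʳ)
open import Data.Unit using (⊤; tt)
open import Data.Empty using (⊥; ⊥-elim)
open import Data.Product using (_×_; _,_; ∃; proj₁; proj₂)
open import Data.List using (List; []; _∷_; map)
open import Data.List.Properties using (map-∘; map-cong)
open import Data.List.Membership.Propositional using (_∈_)
open import Data.List.Membership.Propositional.Properties using (∈-map⁺)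
open import Data.List.Relation.Unary.Any using (here; there)
open import Data.List.Relation.Unary.All using (All; []; _∷_)
import Data.List.Relation.Unary.All as All
import Data.List.Relation.Unary.All.Properties as All
open import Data.List.Relation.Binary.Subset.Propositional using (_⊆_)
open import Data.List.Relation.Binary.Subset.Propositional.Properties using (map⁺)
open import Relation.Binary.PropositionalEquality using (_≡_; refl; sym; trans; cong; cong₂; subst)
open import Relation.Binary.Bundles using (Setoid)
open import Relation.Nullary using (yes; no)
open import Algebra.Bundles using (CommutativeSemiring)
import Algebra.Solver.Ring.NaturalCoefficients.Default as Solver
open import Level using (0ℓ)

-- The absence of free set variables is what makes the last step possible: the Skolem matrix is then
-- a formula of PA, so the tree is given by an operator form, which cannot mention any `I_φ`. Number
-- parameters are packed into one number and carried inside the argument of the fixed point, because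
-- an operator form has a single free variable.
--
-- Set quantifiers of the model range over L_ID-definable sets only, so both directions must stay
-- within definable objects. A definable `X` yields a definable `f` because Skolem values can be
-- chosen as least witnesses, and (L) is available for it. Conversely the leftmost branch exists by
-- induction on numbers, relative to the fixed point.
--
-- Triples suffice: one value supplies a bit of `X`, and two more are compared, which forces a
-- choice to be the same at all arguments. Hence the Skolem form is a recursion on the formula, and
-- no prenex form is taken.
--
-- Falsity is interpreted as derivability so that truth at the empty sequent is an actual derivation
-- in ID₁; no completeness theorem is involved.

private variable
  P : Set
  σ τ : Sub
  k : ℕ

-- Substitution calculus for terms and formulas

substT-ext : (∀ i → σ i ≡ τ i) → ∀ t → substT σ t ≡ substT τ t
substT-ext e (var i) = e i
substT-ext e 𝟎 = refl
substT-ext e (S t) = cong S (substT-ext e t)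
substT-ext e (t ⊕ u) = cong₂ _⊕_ (substT-ext e t) (substT-ext e u)
substT-ext e (t ⊗ u) = cong₂ _⊗_ (substT-ext e t) (substT-ext e u)

substT-comp : ∀ σ τ t → substT σ (substT τ t) ≡ substT (λ i → substT σ (τ i)) t
substT-comp σ τ (var i) = refl
substT-comp σ τ 𝟎 = refl
substT-comp σ τ (S t) = cong S (substT-comp σ τ t)
substT-comp σ τ (t ⊕ u) = cong₂ _⊕_ (substT-comp σ τ t) (substT-comp σ τ u)
substT-comp σ τ (t ⊗ u) = cong₂ _⊗_ (substT-comp σ τ t) (substT-comp σ τ u)

substT-var : ∀ t → substT var t ≡ t
substT-var (var i) = refl
substT-var 𝟎 = refl
substT-var (S t) = cong S (substT-var t)
substT-var (t ⊕ u) = cong₂ _⊕_ (substT-var t) (substT-var u)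
substT-var (t ⊗ u) = cong₂ _⊗_ (substT-var t) (substT-var u)

substT-wk : ∀ t u σ → substT (t ∷ₛ σ) (substT wk u) ≡ substT σ u
substT-wk t u σ = substT-comp (t ∷ₛ σ) wk u

liftN-ext : (∀ i → σ i ≡ τ i) → ∀ i → liftN σ i ≡ liftN τ i
liftN-ext e zero = refl
liftN-ext e (suc i) = cong (substT wk) (e i)

liftN-comp : ∀ σ τ i → substT (liftN σ) (liftN τ i) ≡ liftN (λ i → substT σ (τ i)) i
liftN-comp σ τ zero = refl
liftN-comp σ τ (suc i) =
  trans (substT-comp (liftN σ) wk (τ i)) (sym (substT-comp wk σ (τ i)))

liftN-var : ∀ i → liftN var i ≡ var i
liftN-var zero = refl
liftN-var (suc i) = refl

sub-ext : (∀ i → σ i ≡ τ i) → (A : Fm P) → sub σ A ≡ sub τ A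
sub-ext e (t ≐ u) = cong₂ _≐_ (substT-ext e t) (substT-ext e u)
sub-ext e (t ≠ u) = cong₂ _≠_ (substT-ext e t) (substT-ext e u)
sub-ext e (pos p t) = cong (pos p) (substT-ext e t)
sub-ext e (neg p t) = cong (neg p) (substT-ext e t)
sub-ext e (A ∧ B) = cong₂ _∧_ (sub-ext e A) (sub-ext e B)
sub-ext e (A ∨ B) = cong₂ _∨_ (sub-ext e A) (sub-ext e B)
sub-ext e (∀' A) = cong ∀' (sub-ext (liftN-ext e) A)
sub-ext e (∃' A) = cong ∃' (sub-ext (liftN-ext e) A)

sub-comp : ∀ σ τ (A : Fm P) → sub σ (sub τ A) ≡ sub (λ i → substT σ (τ i)) A
sub-comp σ τ (t ≐ u) = cong₂ _≐_ (substT-comp σ τ t) (substT-comp σ τ u)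
sub-comp σ τ (t ≠ u) = cong₂ _≠_ (substT-comp σ τ t) (substT-comp σ τ u)
sub-comp σ τ (pos p t) = cong (pos p) (substT-comp σ τ t)
sub-comp σ τ (neg p t) = cong (neg p) (substT-comp σ τ t)
sub-comp σ τ (A ∧ B) = cong₂ _∧_ (sub-comp σ τ A) (sub-comp σ τ B)
sub-comp σ τ (A ∨ B) = cong₂ _∨_ (sub-comp σ τ A) (sub-comp σ τ B)
sub-comp σ τ (∀' A) =
  cong ∀' (trans (sub-comp (liftN σ) (liftN τ) A) (sub-ext (liftN-comp σ τ) A))
sub-comp σ τ (∃' A) =
  cong ∃' (trans (sub-comp (liftN σ) (liftN τ) A) (sub-ext (liftN-comp σ τ) A))

sub-var : (A : Fm P) → sub var A ≡ A
sub-var (t ≐ u) = cong₂ _≐_ (substT-var t) (substT-var u)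
sub-var (t ≠ u) = cong₂ _≠_ (substT-var t) (substT-var u)
sub-var (pos p t) = cong (pos p) (substT-var t)
sub-var (neg p t) = cong (neg p) (substT-var t)
sub-var (A ∧ B) = cong₂ _∧_ (sub-var A) (sub-var B)
sub-var (A ∨ B) = cong₂ _∨_ (sub-var A) (sub-var B)
sub-var (∀' A) = cong ∀' (trans (sub-ext liftN-var A) (sub-var A))
sub-var (∃' A) = cong ∃' (trans (sub-ext liftN-var A) (sub-var A))

¬'-sub : ∀ σ (A : Fm P) → sub σ (¬' A) ≡ ¬' (sub σ A)
¬'-sub σ (t ≐ u) = refl
¬'-sub σ (t ≠ u) = refl
¬'-sub σ (pos p t) = refl
¬'-sub σ (neg p t) = refl
¬'-sub σ (A ∧ B) = cong₂ _∨_ (¬'-sub σ A) (¬'-sub σ B)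
¬'-sub σ (A ∨ B) = cong₂ _∧_ (¬'-sub σ A) (¬'-sub σ B)
¬'-sub σ (∀' A) = cong ∃' (¬'-sub _ A)
¬'-sub σ (∃' A) = cong ∀' (¬'-sub _ A)

¬'-invol : (A : Fm P) → ¬' (¬' A) ≡ A
¬'-invol (t ≐ u) = refl
¬'-invol (t ≠ u) = refl
¬'-invol (pos p t) = refl
¬'-invol (neg p t) = refl
¬'-invol (A ∧ B) = cong₂ _∧_ (¬'-invol A) (¬'-invol B)
¬'-invol (A ∨ B) = cong₂ _∨_ (¬'-invol A) (¬'-invol B)
¬'-invol (∀' A) = cong ∀' (¬'-invol A)
¬'-invol (∃' A) = cong ∃' (¬'-invol A)

-- Bounds on free variables

substT-agree : ∀ t → BoundT k t → (∀ i → i < k → σ i ≡ τ i) → substT σ t ≡ substT τ t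
substT-agree (var i) b e = e i b
substT-agree 𝟎 b e = refl
substT-agree (S t) b e = cong S (substT-agree t b e)
substT-agree (t ⊕ u) (b , c) e = cong₂ _⊕_ (substT-agree t b e) (substT-agree u c e)
substT-agree (t ⊗ u) (b , c) e = cong₂ _⊗_ (substT-agree t b e) (substT-agree u c e)

agree-liftN : (∀ i → i < k → σ i ≡ τ i) → ∀ i → i < suc k → liftN σ i ≡ liftN τ i
agree-liftN e zero _ = refl
agree-liftN e (suc i) (s≤s i<k) = cong (substT wk) (e i i<k)

sub-agree : (A : Fm P) → BoundF k A → (∀ i → i < k → σ i ≡ τ i) → sub σ A ≡ sub τ A
sub-agree (t ≐ u) (b , c) e = cong₂ _≐_ (substT-agree t b e) (substT-agree u c e)
sub-agree (t ≠ u) (b , c) e = cong₂ _≠_ (substT-agree t b e) (substT-agree u c e)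
sub-agree (pos p t) b e = cong (pos p) (substT-agree t b e)
sub-agree (neg p t) b e = cong (neg p) (substT-agree t b e)
sub-agree (A ∧ B) (b , c) e = cong₂ _∧_ (sub-agree A b e) (sub-agree B c e)
sub-agree (A ∨ B) (b , c) e = cong₂ _∨_ (sub-agree A b e) (sub-agree B c e)
sub-agree (∀' A) b e = cong ∀' (sub-agree A b (agree-liftN e))
sub-agree (∃' A) b e = cong ∃' (sub-agree A b (agree-liftN e))

BoundT-mono : ∀ {k m} t → k ≤ m → BoundT k t → BoundT m t
BoundT-mono (var i) k≤m b = ≤-trans b k≤m
BoundT-mono 𝟎 k≤m b = tt
BoundT-mono (S t) k≤m b = BoundT-mono t k≤m b
BoundT-mono (t ⊕ u) k≤m (b , c) = BoundT-mono t k≤m b , BoundT-mono u k≤m c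
BoundT-mono (t ⊗ u) k≤m (b , c) = BoundT-mono t k≤m b , BoundT-mono u k≤m c

BoundF-mono : ∀ {k m} (A : Fm P) → k ≤ m → BoundF k A → BoundF m A
BoundF-mono (t ≐ u) k≤m (b , c) = BoundT-mono t k≤m b , BoundT-mono u k≤m c
BoundF-mono (t ≠ u) k≤m (b , c) = BoundT-mono t k≤m b , BoundT-mono u k≤m c
BoundF-mono (pos p t) k≤m b = BoundT-mono t k≤m b
BoundF-mono (neg p t) k≤m b = BoundT-mono t k≤m b
BoundF-mono (A ∧ B) k≤m (b , c) = BoundF-mono A k≤m b , BoundF-mono B k≤m c
BoundF-mono (A ∨ B) k≤m (b , c) = BoundF-mono A k≤m b , BoundF-mono B k≤m c
BoundF-mono (∀' A) k≤m b = BoundF-mono A (s≤s k≤m) b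
BoundF-mono (∃' A) k≤m b = BoundF-mono A (s≤s k≤m) b

join : {Q R : ℕ → Set} → (∀ {k m} → k ≤ m → Q k → Q m) → (∀ {k m} → k ≤ m → R k → R m) →
       ∃ Q → ∃ R → ∃ λ k → Q k × R k
join mq mr (k , q) (m , r) = k ⊔ m , mq (m≤m⊔n k m) q , mr (m≤n⊔m k m) r

boundT : ∀ t → ∃ λ k → BoundT k t
boundT (var i) = suc i , ≤-refl
boundT 𝟎 = 0 , tt
boundT (S t) = boundT t
boundT (t ⊕ u) = join (BoundT-mono t) (BoundT-mono u) (boundT t) (boundT u)
boundT (t ⊗ u) = join (BoundT-mono t) (BoundT-mono u) (boundT t) (boundT u)

boundF : (A : Fm P) → ∃ λ k → BoundF k A
boundF (t ≐ u) = join (BoundT-mono t) (BoundT-mono u) (boundT t) (boundT u)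
boundF (t ≠ u) = join (BoundT-mono t) (BoundT-mono u) (boundT t) (boundT u)
boundF (pos p t) = boundT t
boundF (neg p t) = boundT t
boundF (A ∧ B) = join (BoundF-mono A) (BoundF-mono B) (boundF A) (boundF B)
boundF (A ∨ B) = join (BoundF-mono A) (BoundF-mono B) (boundF A) (boundF B)
boundF (∀' A) = let (k , b) = boundF A in k , BoundF-mono A (n≤1+n k) b
boundF (∃' A) = let (k , b) = boundF A in k , BoundF-mono A (n≤1+n k) b

boundL-mono : ∀ {k m} (Γ : List (Fm P)) → k ≤ m → All (BoundF k) Γ → All (BoundF m) Γ
boundL-mono [] k≤m [] = []
boundL-mono (A ∷ Γ) k≤m (b ∷ bs) = BoundF-mono A k≤m b ∷ boundL-mono Γ k≤m bs

boundL : (Γ : List (Fm P)) → ∃ λ k → All (BoundF k) Γ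
boundL [] = 0 , []
boundL (A ∷ Γ) =
  let (k , b , bs) = join (BoundF-mono A) (boundL-mono Γ) (boundF A) (boundL Γ) in k , b ∷ bs

-- Substitution in derivations and eigenvariables

map-shift : ∀ σ (Γ : List (Fm P)) → map (sub (liftN σ)) (map shift Γ) ≡ map shift (map (sub σ) Γ)
map-shift σ Γ = trans (sym (map-∘ Γ)) (trans (map-cong e Γ) (map-∘ Γ))
  where e : ∀ A → sub (liftN σ) (shift A) ≡ shift (sub σ A)
        e A = trans (sub-comp (liftN σ) wk A) (sym (sub-comp wk σ A))

sub-inst : ∀ σ t (A : Fm P) → sub σ (sub (t ∷ₛ var) A) ≡ sub (substT σ t ∷ₛ var) (sub (liftN σ) A)
sub-inst σ t A = trans (sub-comp σ (t ∷ₛ var) A)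
  (trans (sub-ext e A) (sym (sub-comp (substT σ t ∷ₛ var) (liftN σ) A)))
  where e : ∀ i → substT σ ((t ∷ₛ var) i) ≡ substT (substT σ t ∷ₛ var) (liftN σ i)
        e zero = refl
        e (suc i) = sym (trans (substT-wk _ (σ i) var) (substT-var (σ i)))

⊢-sub : {Ax : Fm P → Set} {Γ : List (Fm P)} (σ : Sub) → Ax ⊢ Γ → Ax ⊢ map (sub σ) Γ
⊢-sub {Γ = Γ} σ (idR A p q) =
  idR (sub σ A) (∈-map⁺ (sub σ) p) (subst (_∈ map (sub σ) Γ) (¬'-sub σ A) (∈-map⁺ (sub σ) q))
⊢-sub σ (∧R p d e) = ∧R (∈-map⁺ (sub σ) p) (⊢-sub σ d) (⊢-sub σ e)
⊢-sub σ (∨R p d) = ∨R (∈-map⁺ (sub σ) p) (⊢-sub σ d)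
⊢-sub {Ax = Ax} {Γ} σ (∀R {A = A} p d) =
  ∀R (∈-map⁺ (sub σ) p)
     (subst (λ Δ → Ax ⊢ (sub (liftN σ) A ∷ Δ)) (map-shift σ Γ) (⊢-sub (liftN σ) d))
⊢-sub {Ax = Ax} {Γ} σ (∃R {A = A} p t d) =
  ∃R (∈-map⁺ (sub σ) p) (substT σ t)
     (subst (λ B → Ax ⊢ (B ∷ map (sub σ) Γ)) (sub-inst σ t A) (⊢-sub σ d))
⊢-sub {Ax = Ax} {Γ} σ (cut A d e) =
  cut (sub σ A) (⊢-sub σ d) (subst (λ B → Ax ⊢ (B ∷ map (sub σ) Γ)) (¬'-sub σ A) (⊢-sub σ e))
⊢-sub {Γ = Γ} σ (axR {A = A} a τ p) =
  axR a (λ i → substT σ (τ i)) (subst (_∈ map (sub σ) Γ) (sub-comp σ τ A) (∈-map⁺ (sub σ) p))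
⊢-sub σ (weak s d) = weak (map⁺ (sub σ) s) (⊢-sub σ d)

-- Undoes the instantiation by `var k`, turning it into the bound variable 0 while all smaller
-- variables are shifted. Indices above `k` also go to 0, a default that is harmless for formulas
-- bounded by `k`.
capture : ℕ → Sub
capture k i with i <? k
... | yes _ = var (suc i)
... | no _ = var 0

capture-< : ∀ i → i < k → capture k i ≡ wk i
capture-< {k} i i<k with i <? k
... | yes _ = refl
... | no i≮k = ⊥-elim (i≮k i<k)

capture-self : ∀ k → capture k k ≡ var 0
capture-self k with k <? k
... | yes k<k = ⊥-elim (<-irrefl refl k<k)
... | no _ = refl

map-agree : (Γ : List (Fm P)) → All (BoundF k) Γ → (∀ i → i < k → σ i ≡ τ i) →
            map (sub σ) Γ ≡ map (sub τ) Γ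
map-agree [] [] e = refl
map-agree (A ∷ Γ) (b ∷ bs) e = cong₂ _∷_ (sub-agree A b e) (map-agree Γ bs e)

-- The instance at a variable beyond all those of Γ and A is as good as an eigenvariable.
∀-fresh : {Ax : Fm P → Set} (Γ : List (Fm P)) (A : Fm P) →
          (∀ t → Ax ⊢ (sub (t ∷ₛ var) A ∷ Γ)) → Ax ⊢ (∀' A ∷ Γ)
∀-fresh {Ax = Ax} Γ A d with boundL (A ∷ Γ)
... | k , b ∷ bs =
  ∀R (here refl) (weak skip (subst (Ax ⊢_) (cong₂ _∷_ eA (map-agree Γ bs capture-<))
                                   (⊢-sub (capture k) (d (var k)))))
  where
    skip : (A ∷ map shift Γ) ⊆ (A ∷ shift (∀' A) ∷ map shift Γ)
    skip (here e) = here e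
    skip (there p) = there (there p)
    e : ∀ i → i < k → substT (capture k) ((var k ∷ₛ var) i) ≡ var i
    e zero _ = capture-self k
    e (suc i) i<k = capture-< i (≤-trans (n≤1+n _) i<k)
    eA : sub (capture k) (sub (var k ∷ₛ var) A) ≡ A
    eA = trans (sub-comp (capture k) (var k ∷ₛ var) A) (trans (sub-agree A b e) (sub-var A))

private variable
  ρ ρ' : Sub
  t u : Tm

-- Forcing over sequents

Ctx : Set
Ctx = List (Fm OpForm)

private variable
  Γ Δ Θ : Ctx

infix 4 _≼_
record _≼_ (Γ Δ : Ctx) : Set where
  constructor incl
  field mem : ∀ {A} → A ∈ Γ → A ∈ Δ
open _≼_

≼-refl : Γ ≼ Γ
≼-refl = incl λ p → p

_⊙_ : Γ ≼ Δ → Δ ≼ Θ → Γ ≼ Θ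
i ⊙ j = incl λ p → mem j (mem i p)

-- Codes of truth values instead of predicates on sequents: monotonicity and stability are then
-- proved once by recursion and need not be carried along.
data Ω : Set where
  at    : Fm OpForm → Ω
  ⊥ᵒ    : Ω
  _∧ᵒ_ _∨ᵒ_ _⇒ᵒ_ : Ω → Ω → Ω
  Λ Σᵒ  : (Tm → Ω) → Ω
  Λˢ Σˢ : (Fm OpForm → Ω) → Ω

infixr 6 _∧ᵒ_
infixr 5 _∨ᵒ_
infixr 4 _⇒ᵒ_

¬ᵒ : Ω → Ω
¬ᵒ Q = Q ⇒ᵒ ⊥ᵒ

infix 9 _∋_
-- Only variable 0 of `θ` is instantiated. Its other variables are parameters, read as free
-- variables of the ambient sequent.
_∋_ : Fm OpForm → Tm → Ω
θ ∋ t = at (sub (t ∷ₛ var) θ)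

-- A world is a sequent, and falsity at a world is its derivability. Disjunctions and existential
-- quantifiers are read as negations of their refutations, which makes all truth values ¬¬-stable.
Refutes : (Ctx → Set) → Ctx → Set
Refutes V Γ = ∀ {Δ} → Γ ≼ Δ → V Δ → ID₁ ⊢ Δ

Force : Ω → Ctx → Set
Force (at A) Γ = ID₁ ⊢ (A ∷ Γ)
Force ⊥ᵒ Γ = ID₁ ⊢ Γ
Force (P ∧ᵒ Q) Γ = Force P Γ × Force Q Γ
Force (P ∨ᵒ Q) Γ = ∀ {Δ} → Γ ≼ Δ → Refutes (Force P) Δ → Refutes (Force Q) Δ → ID₁ ⊢ Δ
Force (P ⇒ᵒ Q) Γ = ∀ {Δ} → Γ ≼ Δ → Force P Δ → Force Q Δ
Force (Λ P) Γ = ∀ t → Force (P t) Γ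
Force (Σᵒ P) Γ = ∀ {Δ} → Γ ≼ Δ → (∀ t → Refutes (Force (P t)) Δ) → ID₁ ⊢ Δ
Force (Λˢ P) Γ = ∀ θ → Force (P θ) Γ
Force (Σˢ P) Γ = ∀ {Δ} → Γ ≼ Δ → (∀ θ → Refutes (Force (P θ)) Δ) → ID₁ ⊢ Δ

⊢-mono : Γ ≼ Δ → ID₁ ⊢ Γ → ID₁ ⊢ Δ
⊢-mono i = weak (mem i)

keep : ∀ {A} → Γ ≼ Δ → (A ∷ Γ) ≼ (A ∷ Δ)
keep i = incl λ { (here e) → here e ; (there p) → there (mem i p) }

drop1 : ∀ {A} → Γ ≼ (A ∷ Γ)
drop1 = incl there

Force-mono : ∀ Q → Γ ≼ Δ → Force Q Γ → Force Q Δ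
Force-mono (at A) i d = ⊢-mono (keep i) d
Force-mono ⊥ᵒ i d = ⊢-mono i d
Force-mono (P ∧ᵒ Q) i (p , q) = Force-mono P i p , Force-mono Q i q
Force-mono (P ∨ᵒ Q) i f j = f (i ⊙ j)
Force-mono (P ⇒ᵒ Q) i f j = f (i ⊙ j)
Force-mono (Λ P) i f t = Force-mono (P t) i (f t)
Force-mono (Σᵒ P) i f j = f (i ⊙ j)
Force-mono (Λˢ P) i f t = Force-mono (P t) i (f t)
Force-mono (Σˢ P) i f j = f (i ⊙ j)

Force-stable : ∀ Q → (∀ {Δ} → Γ ≼ Δ → Refutes (Force Q) Δ → ID₁ ⊢ Δ) → Force Q Γ
-- The hypothesis is applied in the world `A ∷ Γ`. There `at A` is refuted, since a second copy of
-- `A` can be contracted.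
Force-stable (at A) n = n drop1 λ i d → ⊢-mono (absorb i) d
  where
    absorb : ∀ {A} → (A ∷ Γ) ≼ Δ → (A ∷ Δ) ≼ Δ
    absorb i = incl λ { (here refl) → mem i (here refl) ; (there p) → p }
Force-stable ⊥ᵒ n = n ≼-refl λ _ d → d
Force-stable (P ∧ᵒ Q) n =
  Force-stable P (λ i r → n i λ j q → r j (proj₁ q)) , Force-stable Q (λ i r → n i λ j q → r j (proj₂ q))
Force-stable (P ∨ᵒ Q) n i r r' =
  n i λ j f → f ≼-refl (λ k → r (j ⊙ k)) (λ k → r' (j ⊙ k))
Force-stable (P ⇒ᵒ Q) n i p =
  Force-stable Q λ j r → n (i ⊙ j) λ k f → r k (f ≼-refl (Force-mono P (j ⊙ k) p))
Force-stable (Λ P) n t = Force-stable (P t) λ i r → n i λ j f → r j (f t)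
Force-stable (Σᵒ P) n i r = n i λ j f → f ≼-refl λ t k → r t (j ⊙ k)
Force-stable (Λˢ P) n t = Force-stable (P t) λ i r → n i λ j f → r j (f t)
Force-stable (Σˢ P) n i r = n i λ j f → f ≼-refl λ t k → r t (j ⊙ k)

infix 3 _⊩_
-- The record keeps `Q` visible to unification, which cannot recover it from the computed type
-- `Force Q Γ`.
record _⊩_ (Γ : Ctx) (Q : Ω) : Set where
  constructor forced
  field force : Force Q Γ
open _⊩_

private variable
  Q Q₁ Q₂ Q₃ Q₄ : Ω
  V V₁ : Tm → Ω
  Vˢ V₁ˢ : Fm OpForm → Ω

infixl 9 _↑_
_↑_ : Γ ⊩ Q → Γ ≼ Δ → Δ ⊩ Q
_↑_ {Q = Q} (forced p) i = forced (Force-mono Q i p)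

⇒I : (∀ {Δ} → Γ ≼ Δ → Δ ⊩ Q → Δ ⊩ Q₁) → Γ ⊩ Q ⇒ᵒ Q₁
⇒I f = forced λ i p → force (f i (forced p))

infixl 8 _·_
_·_ : Γ ⊩ Q ⇒ᵒ Q₁ → Γ ⊩ Q → Γ ⊩ Q₁
forced f · forced p = forced (f ≼-refl p)

infixr 7 _,ᵒ_
_,ᵒ_ : Γ ⊩ Q → Γ ⊩ Q₁ → Γ ⊩ Q ∧ᵒ Q₁
forced p ,ᵒ forced q = forced (p , q)

π₁ : Γ ⊩ Q ∧ᵒ Q₁ → Γ ⊩ Q
π₁ (forced p) = forced (proj₁ p)

π₂ : Γ ⊩ Q ∧ᵒ Q₁ → Γ ⊩ Q₁
π₂ (forced p) = forced (proj₂ p)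

raa : (∀ {Δ} → Γ ≼ Δ → Δ ⊩ ¬ᵒ Q → Δ ⊩ ⊥ᵒ) → Γ ⊩ Q
raa {Q = Q} f = forced (Force-stable Q λ i r → force (f i (forced r)))

⊥E : Γ ⊩ ⊥ᵒ → Γ ⊩ Q
⊥E b = raa λ i _ → b ↑ i

inl : Γ ⊩ Q → Γ ⊩ Q ∨ᵒ Q₁
inl {Q = Q} (forced p) = forced λ i r _ → r ≼-refl (Force-mono Q i p)

inr : Γ ⊩ Q₁ → Γ ⊩ Q ∨ᵒ Q₁
inr {Q₁ = Q₁} (forced p) = forced λ i _ r → r ≼-refl (Force-mono Q₁ i p)

∨E : Γ ⊩ Q ∨ᵒ Q₁ → (∀ {Δ} → Γ ≼ Δ → Δ ⊩ Q → Δ ⊩ Q₂) → (∀ {Δ} → Γ ≼ Δ → Δ ⊩ Q₁ → Δ ⊩ Q₂) → Γ ⊩ Q₂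
∨E (forced d) f g = raa λ i n → forced (d i
  (λ j q → force ((n ↑ j) · f (i ⊙ j) (forced q))) (λ j q → force ((n ↑ j) · g (i ⊙ j) (forced q))))

ΛI : (∀ t → Γ ⊩ V t) → Γ ⊩ Λ V
ΛI f = forced λ t → force (f t)

ΛE : Γ ⊩ Λ V → ∀ t → Γ ⊩ V t
ΛE (forced f) t = forced (f t)

ΣI : ∀ t → Γ ⊩ V t → Γ ⊩ Σᵒ V
ΣI {V = V} t (forced p) = forced λ i r → r t ≼-refl (Force-mono (V t) i p)

ΣE : Γ ⊩ Σᵒ V → (∀ {Δ} → Γ ≼ Δ → ∀ t → Δ ⊩ V t → Δ ⊩ Q₂) → Γ ⊩ Q₂
ΣE (forced d) f = raa λ i n → forced (d i λ t j q → force ((n ↑ j) · f (i ⊙ j) t (forced q)))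

ΛˢI : (∀ θ → Γ ⊩ Vˢ θ) → Γ ⊩ Λˢ Vˢ
ΛˢI f = forced λ t → force (f t)

ΛˢE : Γ ⊩ Λˢ Vˢ → ∀ θ → Γ ⊩ Vˢ θ
ΛˢE (forced f) t = forced (f t)

ΣˢI : ∀ θ → Γ ⊩ Vˢ θ → Γ ⊩ Σˢ Vˢ
ΣˢI {Vˢ = Vˢ} t (forced p) = forced λ i r → r t ≼-refl (Force-mono (Vˢ t) i p)

ΣˢE : Γ ⊩ Σˢ Vˢ → (∀ {Δ} → Γ ≼ Δ → ∀ θ → Δ ⊩ Vˢ θ → Δ ⊩ Q₂) → Γ ⊩ Q₂
ΣˢE (forced d) f = raa λ i n → forced (d i λ t j q → force ((n ↑ j) · f (i ⊙ j) t (forced q)))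

em : ∀ Q → Γ ⊩ Q ∨ᵒ ¬ᵒ Q
em Q = raa λ _ n → n · inr (⇒I λ i q → (n ↑ i) · inl q)

⇒∨ : (∀ {Δ} → Γ ≼ Δ → Δ ⊩ Q → Δ ⊩ Q₁) → Γ ⊩ ¬ᵒ Q ∨ᵒ Q₁
⇒∨ {Q = Q} f = ∨E (em Q) (λ i q → inr (f i q)) (λ _ n → inl n)

∨⇒ : Γ ⊩ ¬ᵒ Q ∨ᵒ Q₁ → Γ ⊩ Q → Γ ⊩ Q₁
∨⇒ d q = ∨E d (λ i n → ⊥E (n · (q ↑ i))) (λ _ r → r)

infix 3 _⟺_
record _⟺_ (Q Q₁ : Ω) : Set where
  constructor equiv
  field
    to   : ∀ {Γ} → Γ ⊩ Q → Γ ⊩ Q₁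
    from : ∀ {Γ} → Γ ⊩ Q₁ → Γ ⊩ Q
open _⟺_ public

⟺-refl : Q ⟺ Q
⟺-refl = equiv (λ p → p) (λ p → p)

⟺-sym : Q ⟺ Q₁ → Q₁ ⟺ Q
⟺-sym e = equiv (from e) (to e)

⟺-trans : Q ⟺ Q₁ → Q₁ ⟺ Q₂ → Q ⟺ Q₂
⟺-trans e f = equiv (λ p → to f (to e p)) (λ p → from e (from f p))

⟺-≡ : Q ≡ Q₁ → Q ⟺ Q₁
⟺-≡ refl = ⟺-refl

∧-cong : Q ⟺ Q₃ → Q₁ ⟺ Q₄ → Q ∧ᵒ Q₁ ⟺ Q₃ ∧ᵒ Q₄
∧-cong e f = equiv (λ p → to e (π₁ p) ,ᵒ to f (π₂ p)) (λ p → from e (π₁ p) ,ᵒ from f (π₂ p))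

∨-cong : Q ⟺ Q₃ → Q₁ ⟺ Q₄ → Q ∨ᵒ Q₁ ⟺ Q₃ ∨ᵒ Q₄
∨-cong e f = equiv (λ p → ∨E p (λ _ q → inl (to e q)) (λ _ q → inr (to f q)))
                   (λ p → ∨E p (λ _ q → inl (from e q)) (λ _ q → inr (from f q)))

⇒-cong : Q ⟺ Q₃ → Q₁ ⟺ Q₄ → Q ⇒ᵒ Q₁ ⟺ Q₃ ⇒ᵒ Q₄
⇒-cong e f = equiv (λ p → ⇒I λ i q → to f ((p ↑ i) · from e q))
  (λ p → ⇒I λ i q → from f ((p ↑ i) · to e q))

¬-cong : Q ⟺ Q₃ → ¬ᵒ Q ⟺ ¬ᵒ Q₃
¬-cong e = ⇒-cong e ⟺-refl

Λ-cong : (∀ t → V t ⟺ V₁ t) → Λ V ⟺ Λ V₁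
Λ-cong e = equiv (λ p → ΛI λ t → to (e t) (ΛE p t)) (λ p → ΛI λ t → from (e t) (ΛE p t))

Σ-cong : (∀ t → V t ⟺ V₁ t) → Σᵒ V ⟺ Σᵒ V₁
Σ-cong e = equiv (λ p → ΣE p λ _ t q → ΣI t (to (e t) q)) (λ p → ΣE p λ _ t q → ΣI t (from (e t) q))

Λˢ-cong : (∀ θ → Vˢ θ ⟺ V₁ˢ θ) → Λˢ Vˢ ⟺ Λˢ V₁ˢ
Λˢ-cong e = equiv (λ p → ΛˢI λ t → to (e t) (ΛˢE p t)) (λ p → ΛˢI λ t → from (e t) (ΛˢE p t))

Σˢ-cong : (∀ θ → Vˢ θ ⟺ V₁ˢ θ) → Σˢ Vˢ ⟺ Σˢ V₁ˢ
Σˢ-cong e = equiv (λ p → ΣˢE p λ _ t q → ΣˢI t (to (e t) q)) (λ p → ΣˢE p λ _ t q → ΣˢI t (from (e t) q))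

¬∧ : ¬ᵒ (Q ∧ᵒ Q₁) ⟺ ¬ᵒ Q ∨ᵒ ¬ᵒ Q₁
¬∧ = equiv (λ n → ⇒∨ λ i q → ⇒I λ j r → (n ↑ i ↑ j) · (q ↑ j ,ᵒ r))
           (λ d → ⇒I λ i p → ∨E (d ↑ i) (λ j n → n · π₁ (p ↑ j)) (λ j n → n · π₂ (p ↑ j)))

¬∨ : ¬ᵒ (Q ∨ᵒ Q₁) ⟺ ¬ᵒ Q ∧ᵒ ¬ᵒ Q₁
¬∨ = equiv (λ n → (⇒I λ i q → (n ↑ i) · inl q) ,ᵒ (⇒I λ i q → (n ↑ i) · inr q))
           (λ p → ⇒I λ i d → ∨E d (λ j q → π₁ (p ↑ i ↑ j) · q) (λ j q → π₂ (p ↑ i ↑ j) · q))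

¬Λ : ¬ᵒ (Λ V) ⟺ Σᵒ λ t → ¬ᵒ (V t)
¬Λ = equiv (λ n → raa λ i m → (n ↑ i) · ΛI λ t → raa λ j k → (m ↑ j) · ΣI t k)
           (λ s → ⇒I λ i p → ΣE (s ↑ i) λ j t n → n · ΛE (p ↑ j) t)

¬Σ : ¬ᵒ (Σᵒ V) ⟺ Λ λ t → ¬ᵒ (V t)
¬Σ = equiv (λ n → ΛI λ t → ⇒I λ i p → (n ↑ i) · ΣI t p)
           (λ p → ⇒I λ i s → ΣE s λ j t q → ΛE (p ↑ i ↑ j) t · q)

¬Λˢ : ¬ᵒ (Λˢ Vˢ) ⟺ Σˢ λ t → ¬ᵒ (Vˢ t)
¬Λˢ = equiv (λ n → raa λ i m → (n ↑ i) · ΛˢI λ t → raa λ j k → (m ↑ j) · ΣˢI t k)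
           (λ s → ⇒I λ i p → ΣˢE (s ↑ i) λ j t n → n · ΛˢE (p ↑ j) t)

¬Σˢ : ¬ᵒ (Σˢ Vˢ) ⟺ Λˢ λ t → ¬ᵒ (Vˢ t)
¬Σˢ = equiv (λ n → ΛˢI λ t → ⇒I λ i p → (n ↑ i) · ΣˢI t p)
           (λ p → ⇒I λ i s → ΣˢE s λ j t q → ΛˢE (p ↑ i ↑ j) t · q)

¬¬ : ¬ᵒ (¬ᵒ Q) ⟺ Q
¬¬ = equiv (λ n → raa λ i m → (n ↑ i) · m) (λ q → ⇒I λ i n → n · (q ↑ i))

-- Evaluation of formulas

Pred : Set
Pred = Tm → Ω

ev : (P → Pred) → Sub → Fm P → Ω
ev I ρ (t ≐ u) = at (substT ρ t ≐ substT ρ u)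
ev I ρ (t ≠ u) = ¬ᵒ (at (substT ρ t ≐ substT ρ u))
ev I ρ (pos p t) = I p (substT ρ t)
ev I ρ (neg p t) = ¬ᵒ (I p (substT ρ t))
ev I ρ (A ∧ B) = ev I ρ A ∧ᵒ ev I ρ B
ev I ρ (A ∨ B) = ev I ρ A ∨ᵒ ev I ρ B
ev I ρ (∀' A) = Λ λ t → ev I (t ∷ₛ ρ) A
ev I ρ (∃' A) = Σᵒ λ t → ev I (t ∷ₛ ρ) A

∷ₛ-agree : (∀ i → i < k → σ i ≡ τ i) → ∀ t i → i < suc k → (t ∷ₛ σ) i ≡ (t ∷ₛ τ) i
∷ₛ-agree e t zero _ = refl
∷ₛ-agree e t (suc i) (s≤s i<k) = e i i<k

∷ₛ-ext : (∀ i → σ i ≡ τ i) → ∀ t i → (t ∷ₛ σ) i ≡ (t ∷ₛ τ) i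
∷ₛ-ext e t zero = refl
∷ₛ-ext e t (suc i) = e i

private variable
  I J : P → Pred

ev-agree : (A : Fm P) → BoundF k A → (∀ i → i < k → ρ i ≡ ρ' i) → ev I ρ A ⟺ ev I ρ' A
ev-agree (t ≐ u) (b , c) e = ⟺-≡ (cong₂ (λ t u → at (t ≐ u)) (substT-agree t b e) (substT-agree u c e))
ev-agree (t ≠ u) (b , c) e = ⟺-≡ (cong₂ (λ t u → ¬ᵒ (at (t ≐ u))) (substT-agree t b e)
  (substT-agree u c e))
ev-agree {I = I} (pos p t) b e = ⟺-≡ (cong (I p) (substT-agree t b e))
ev-agree {I = I} (neg p t) b e = ⟺-≡ (cong (λ t → ¬ᵒ (I p t)) (substT-agree t b e))
ev-agree (A ∧ B) (b , c) e = ∧-cong (ev-agree A b e) (ev-agree B c e)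
ev-agree (A ∨ B) (b , c) e = ∨-cong (ev-agree A b e) (ev-agree B c e)
ev-agree (∀' A) b e = Λ-cong λ t → ev-agree A b (∷ₛ-agree e t)
ev-agree (∃' A) b e = Σ-cong λ t → ev-agree A b (∷ₛ-agree e t)

ev-ext : (∀ p t → I p t ⟺ J p t) → (A : Fm P) → (∀ i → ρ i ≡ ρ' i) → ev I ρ A ⟺ ev J ρ' A
ev-ext f (t ≐ u) e = ⟺-≡ (cong₂ (λ t u → at (t ≐ u)) (substT-ext e t) (substT-ext e u))
ev-ext f (t ≠ u) e = ⟺-≡ (cong₂ (λ t u → ¬ᵒ (at (t ≐ u))) (substT-ext e t) (substT-ext e u))
ev-ext {I = I} f (pos p t) e = ⟺-trans (⟺-≡ (cong (I p) (substT-ext e t))) (f p _)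
ev-ext {I = I} f (neg p t) e = ¬-cong (⟺-trans (⟺-≡ (cong (I p) (substT-ext e t))) (f p _))
ev-ext f (A ∧ B) e = ∧-cong (ev-ext f A e) (ev-ext f B e)
ev-ext f (A ∨ B) e = ∨-cong (ev-ext f A e) (ev-ext f B e)
ev-ext f (∀' A) e = Λ-cong λ t → ev-ext f A (∷ₛ-ext e t)
ev-ext f (∃' A) e = Σ-cong λ t → ev-ext f A (∷ₛ-ext e t)

≡-env : (A : Fm P) → (∀ i → ρ i ≡ ρ' i) → ev I ρ A ⟺ ev I ρ' A
≡-env = ev-ext λ _ _ → ⟺-refl

liftN-env : (∀ i → substT ρ (σ i) ≡ ρ' i) → ∀ t i → substT (t ∷ₛ ρ) (liftN σ i) ≡ (t ∷ₛ ρ') i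
liftN-env e t zero = refl
liftN-env {ρ} {σ} e t (suc i) = trans (substT-wk t (σ i) ρ) (e i)

substT-env : (∀ i → substT ρ (σ i) ≡ ρ' i) → ∀ t → substT ρ (substT σ t) ≡ substT ρ' t
substT-env e t = trans (substT-comp _ _ t) (substT-ext e t)

infixr 5 _∷ᵉ_
_∷ᵉ_ : substT ρ t ≡ u → (∀ i → substT ρ (σ i) ≡ ρ' i) → ∀ i → substT ρ ((t ∷ₛ σ) i) ≡ (u ∷ₛ ρ') i
(p ∷ᵉ e) zero = p
(p ∷ᵉ e) (suc i) = e i

ev-sub : (A : Fm P) → (∀ i → substT ρ (σ i) ≡ ρ' i) → ev I ρ (sub σ A) ⟺ ev I ρ' A
ev-sub (t ≐ u) e = ⟺-≡ (cong₂ (λ t u → at (t ≐ u)) (substT-env e t) (substT-env e u))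
ev-sub (t ≠ u) e = ⟺-≡ (cong₂ (λ t u → ¬ᵒ (at (t ≐ u))) (substT-env e t) (substT-env e u))
ev-sub {I = I} (pos p t) e = ⟺-≡ (cong (I p) (substT-env e t))
ev-sub {I = I} (neg p t) e = ⟺-≡ (cong (λ t → ¬ᵒ (I p t)) (substT-env e t))
ev-sub (A ∧ B) e = ∧-cong (ev-sub A e) (ev-sub B e)
ev-sub (A ∨ B) e = ∨-cong (ev-sub A e) (ev-sub B e)
ev-sub {σ = σ} (∀' A) e = Λ-cong λ t → ev-sub A (liftN-env {σ = σ} e t)
ev-sub {σ = σ} (∃' A) e = Σ-cong λ t → ev-sub A (liftN-env {σ = σ} e t)

ev-¬ : (A : Fm P) → ev I ρ (¬' A) ⟺ ¬ᵒ (ev I ρ A)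
ev-¬ (t ≐ u) = ⟺-refl
ev-¬ (t ≠ u) = ⟺-sym ¬¬
ev-¬ (pos p t) = ⟺-refl
ev-¬ (neg p t) = ⟺-sym ¬¬
ev-¬ (A ∧ B) = ⟺-trans (∨-cong (ev-¬ A) (ev-¬ B)) (⟺-sym ¬∧)
ev-¬ (A ∨ B) = ⟺-trans (∧-cong (ev-¬ A) (ev-¬ B)) (⟺-sym ¬∨)
ev-¬ (∀' A) = ⟺-trans (Σ-cong λ t → ev-¬ A) (⟺-sym ¬Λ)
ev-¬ (∃' A) = ⟺-trans (Λ-cong λ t → ev-¬ A) (⟺-sym ¬Σ)

ev-mapP : {P P' : Set} {I : P' → Pred} (f : P → P') (A : Fm P) →
          ev I ρ (mapP f A) ⟺ ev (λ p → I (f p)) ρ A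
ev-mapP f (t ≐ u) = ⟺-refl
ev-mapP f (t ≠ u) = ⟺-refl
ev-mapP f (pos p t) = ⟺-refl
ev-mapP f (neg p t) = ⟺-refl
ev-mapP f (A ∧ B) = ∧-cong (ev-mapP f A) (ev-mapP f B)
ev-mapP f (A ∨ B) = ∨-cong (ev-mapP f A) (ev-mapP f B)
ev-mapP f (∀' A) = Λ-cong λ t → ev-mapP f A
ev-mapP f (∃' A) = Σ-cong λ t → ev-mapP f A

ev-plug : (ψ : Fm P) (π : Sub) (A : Fm ⊤) → (∀ i → ρ (suc (i + k)) ≡ π i) →
          ev I ρ (plug k ψ A) ⟺ ev (λ _ t → ev I (t ∷ₛ π) ψ) ρ A
ev-plug ψ π (t ≐ u) e = ⟺-refl
ev-plug ψ π (t ≠ u) e = ⟺-refl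
ev-plug ψ π (pos _ t) e = ev-sub ψ λ { zero → refl ; (suc i) → e i }
ev-plug ψ π (neg _ t) e =
  ⟺-trans (ev-¬ (sub _ ψ)) (¬-cong (ev-sub ψ λ { zero → refl ; (suc i) → e i }))
ev-plug ψ π (A ∧ B) e = ∧-cong (ev-plug ψ π A e) (ev-plug ψ π B e)
ev-plug ψ π (A ∨ B) e = ∨-cong (ev-plug ψ π A e) (ev-plug ψ π B e)
ev-plug {ρ = ρ} {k = k} ψ π (∀' A) e = Λ-cong λ t → ev-plug ψ π A
  (λ i → trans (cong (t ∷ₛ ρ) (cong suc (+-suc i k))) (e i))
ev-plug {ρ = ρ} {k = k} ψ π (∃' A) e = Σ-cong λ t → ev-plug ψ π A
  (λ i → trans (cong (t ∷ₛ ρ) (cong suc (+-suc i k))) (e i))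

-- Truth lemma: derivability and evaluation agree

Iat : OpForm → Pred
Iat φ t = at (pos φ t)

⟦_⟧ : Fm OpForm → Sub → Ω
⟦ A ⟧ ρ = ev Iat ρ A

private
  ax0 : (A : Fm OpForm) → ID₁ ⊢ (A ∷ ¬' A ∷ Γ)
  ax0 A = idR A (here refl) (there (here refl))

-- One direction is a cut. For the other, the refutation of `A` is applied in the world extended by
-- `¬' A`, where `A` holds by an identity axiom.
at-¬ : (A : Fm OpForm) → at (¬' A) ⟺ ¬ᵒ (at A)
at-¬ A = equiv
  (λ d → ⇒I λ i a → forced (cut A (force a) (force (d ↑ i))))
  (λ n → forced (force ((n ↑ drop1) · forced (ax0 A))))

at-∧ : (A B : Fm OpForm) → at (A ∧ B) ⟺ at A ∧ᵒ at B
at-∧ A B = equiv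
  (λ d → forced (cut (A ∧ B) (force (d ↑ drop1)) (∨R (here refl)
      (idR A (there (there (there (here refl)))) (here refl)))) ,ᵒ
         forced (cut (A ∧ B) (force (d ↑ drop1)) (∨R (here refl)
             (idR B (there (there (there (here refl)))) (there (here refl))))))
  (λ p → forced (∧R (here refl) (force (π₁ p ↑ drop1)) (force (π₂ p ↑ drop1))))

at-∀ : (A : Fm OpForm) → at (∀' A) ⟺ Λ λ t → at (sub (t ∷ₛ var) A)
at-∀ A = equiv
  (λ d → ΛI λ t → forced (cut (∀' A) (force (d ↑ drop1))
     (∃R (here refl) t (idR (sub (t ∷ₛ var) A) (there (there (here refl))) (here (sym (¬'-sub _ A)))))))
  (λ p → forced (∀-fresh _ A λ t → force (ΛE p t)))

at-≡¬ : {A B : Fm OpForm} → ¬' A ≡ B → at B ⟺ ¬ᵒ (at A)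
at-≡¬ {A} refl = at-¬ A

at-∨ : (A B : Fm OpForm) → at (A ∨ B) ⟺ at A ∨ᵒ at B
at-∨ A B =
  ⟺-trans (at-≡¬ {¬' A ∧ ¬' B} (cong₂ _∨_ (¬'-invol A) (¬'-invol B)))
  (⟺-trans (¬-cong (at-∧ (¬' A) (¬' B)))
  (⟺-trans ¬∧ (∨-cong (⟺-sym (at-≡¬ (¬'-invol A))) (⟺-sym (at-≡¬ (¬'-invol B))))))

at-∃ : (A : Fm OpForm) → at (∃' A) ⟺ Σᵒ λ t → at (sub (t ∷ₛ var) A)
at-∃ A =
  ⟺-trans (at-≡¬ {∀' (¬' A)} (cong ∃' (¬'-invol A)))
  (⟺-trans (¬-cong (at-∀ (¬' A)))
  (⟺-trans ¬Λ (Σ-cong λ t → ⟺-sym (at-≡¬ (trans (sym (¬'-sub (t ∷ₛ var) (¬' A)))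
      (cong (sub (t ∷ₛ var)) (¬'-invol A)))))))

-- The bridge between syntax and model. It makes every axiom of ID₁ true in all worlds, and it turns
-- truth of `A` at the empty sequent into a derivation of `A`.
truth : (A : Fm OpForm) → at (sub ρ A) ⟺ ⟦ A ⟧ ρ

truth-inst : (A : Fm OpForm) → ∀ t → at (sub (t ∷ₛ var) (sub (liftN ρ) A)) ⟺ ⟦ A ⟧ (t ∷ₛ ρ)
truth-inst {ρ} A t = ⟺-trans (⟺-≡ (cong at (trans (sub-comp _ _ A) (sub-ext e A)))) (truth A)
  where e : ∀ i → substT (t ∷ₛ var) (liftN ρ i) ≡ (t ∷ₛ ρ) i
        e zero = refl
        e (suc i) = trans (substT-wk t (ρ i) var) (substT-var (ρ i))

truth (t ≐ u) = ⟺-refl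
truth (t ≠ u) = at-¬ (_ ≐ _)
truth (pos p t) = ⟺-refl
truth (neg p t) = at-¬ (pos p _)
truth (A ∧ B) = ⟺-trans (at-∧ _ _) (∧-cong (truth A) (truth B))
truth (A ∨ B) = ⟺-trans (at-∨ _ _) (∨-cong (truth A) (truth B))
truth (∀' A) = ⟺-trans (at-∀ _) (Λ-cong (truth-inst A))
truth (∃' A) = ⟺-trans (at-∃ _) (Σ-cong (truth-inst A))

ax : ∀ {A} → ID₁ A → ∀ ρ → Γ ⊩ ⟦ A ⟧ ρ
ax {A = A} a ρ = to (truth A) (forced (axR a ρ (here refl)))

private variable
  v w s a b c d e m n q t' u' v' w' s' c' : Tm

ev-⇒E : (A B : Fm P) → Γ ⊩ ev I ρ (A ⇒ B) → Γ ⊩ ev I ρ A → Γ ⊩ ev I ρ B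
ev-⇒E A B d a = ∨E d (λ i n → ⊥E (to (ev-¬ A) n · (a ↑ i))) (λ _ b → b)

ev-⇒I : (A B : Fm P) → (∀ {Δ} → Γ ≼ Δ → Δ ⊩ ev I ρ A → Δ ⊩ ev I ρ B) → Γ ⊩ ev I ρ (A ⇒ B)
ev-⇒I A B f = ∨E (em _) (λ i a → inr (f i a)) (λ _ n → inl (from (ev-¬ A) n))

infix 7 _≈_
_≈_ : Tm → Tm → Ω
t ≈ u = at (t ≐ u)

≈-refl : Γ ⊩ t ≈ t
≈-refl {t = t} = ax (pa eq-refl) (λ _ → t)

≈-euclid : Γ ⊩ t ≈ u → Γ ⊩ t ≈ v → Γ ⊩ u ≈ v
≈-euclid {t = t} {u} {v} p q = ∨⇒ (∨⇒ (ax (pa eq-tr) (t ∷ₛ (u ∷ₛ λ _ → v))) p) q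

≈-sym : Γ ⊩ t ≈ u → Γ ⊩ u ≈ t
≈-sym p = ≈-euclid p ≈-refl

≈-trans : Γ ⊩ t ≈ u → Γ ⊩ u ≈ v → Γ ⊩ t ≈ v
≈-trans p q = ≈-euclid (≈-sym p) q

S-cong : Γ ⊩ t ≈ u → Γ ⊩ S t ≈ S u
S-cong {t = t} {u} p = ∨⇒ (ax (pa eq-S) (t ∷ₛ λ _ → u)) p

⊕-cong : Γ ⊩ t ≈ t' → Γ ⊩ u ≈ u' → Γ ⊩ (t ⊕ u) ≈ (t' ⊕ u')
⊕-cong {t = t} {t'} {u} {u'} p q = ≈-trans
  (∨⇒ (ax (pa eq-+l) (t ∷ₛ (t' ∷ₛ λ _ → u))) p) (∨⇒ (ax (pa eq-+r) (u ∷ₛ (u' ∷ₛ λ _ → t'))) q)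

⊗-cong : Γ ⊩ t ≈ t' → Γ ⊩ u ≈ u' → Γ ⊩ (t ⊗ u) ≈ (t' ⊗ u')
⊗-cong {t = t} {t'} {u} {u'} p q = ≈-trans
  (∨⇒ (ax (pa eq-*l) (t ∷ₛ (t' ∷ₛ λ _ → u))) p) (∨⇒ (ax (pa eq-*r) (u ∷ₛ (u' ∷ₛ λ _ → t'))) q)

infix 3 _⊩_≋_
_⊩_≋_ : Ctx → Sub → Sub → Set
Γ ⊩ ρ ≋ ρ' = ∀ i → Γ ⊩ ρ i ≈ ρ' i

≋-refl : Γ ⊩ ρ ≋ ρ
≋-refl i = ≈-refl

infixr 5 _∷≋_
_∷≋_ : Γ ⊩ t ≈ u → Γ ⊩ ρ ≋ ρ' → Γ ⊩ t ∷ₛ ρ ≋ u ∷ₛ ρ'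
(p ∷≋ e) zero = p
(p ∷≋ e) (suc i) = e i

_↑≋_ : Γ ⊩ ρ ≋ ρ' → Γ ≼ Δ → Δ ⊩ ρ ≋ ρ'
(e ↑≋ i) n = e n ↑ i

substT-≋ : Γ ⊩ ρ ≋ ρ' → ∀ t → Γ ⊩ substT ρ t ≈ substT ρ' t
substT-≋ e (var i) = e i
substT-≋ e 𝟎 = ≈-refl
substT-≋ e (S t) = S-cong (substT-≋ e t)
substT-≋ e (t ⊕ u) = ⊕-cong (substT-≋ e t) (substT-≋ e u)
substT-≋ e (t ⊗ u) = ⊗-cong (substT-≋ e t) (substT-≋ e u)

Extensional : (P → Pred) → Set
Extensional I = ∀ {Γ} p {t u} → Γ ⊩ t ≈ u → Γ ⊩ I p t → Γ ⊩ I p u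

ev-leibniz : Extensional I → (A : Fm P) → Γ ⊩ ρ ≋ ρ' → Γ ⊩ ev I ρ A → Γ ⊩ ev I ρ' A
ev-leibniz x (t ≐ u) e p = ≈-trans (≈-sym (substT-≋ e t)) (≈-trans p (substT-≋ e u))
ev-leibniz x (t ≠ u) e p = ⇒I λ i q →
  (p ↑ i) · ≈-trans (substT-≋ e t ↑ i) (≈-trans q (≈-sym (substT-≋ e u ↑ i)))
ev-leibniz x (pos r t) e p = x r (substT-≋ e t) p
ev-leibniz x (neg r t) e p = ⇒I λ i q → (p ↑ i) · x r (≈-sym (substT-≋ e t ↑ i)) q
ev-leibniz x (A ∧ B) e p = ev-leibniz x A e (π₁ p) ,ᵒ ev-leibniz x B e (π₂ p)
ev-leibniz x (A ∨ B) e p =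
  ∨E p (λ i q → inl (ev-leibniz x A (e ↑≋ i) q)) (λ i q → inr (ev-leibniz x B (e ↑≋ i) q))
ev-leibniz x (∀' A) e p = ΛI λ t → ev-leibniz x A (≈-refl ∷≋ e) (ΛE p t)
ev-leibniz x (∃' A) e p = ΣE p λ i t q → ΣI t (ev-leibniz x A (≈-refl ∷≋ (e ↑≋ i)) q)

Iat-ext : Extensional Iat
Iat-ext φ {t} {u} p q = ∨⇒ (∨⇒ (ax (eq-I φ) (t ∷ₛ λ _ → u)) p) q

leibniz : (A : Fm OpForm) → Γ ⊩ ρ ≋ ρ' → Γ ⊩ ⟦ A ⟧ ρ → Γ ⊩ ⟦ A ⟧ ρ'
leibniz = ev-leibniz Iat-ext

∋-⟦⟧ : (θ : Fm OpForm) → (θ ∋ t) ⟺ ⟦ θ ⟧ (t ∷ₛ var)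
∋-⟦⟧ θ = truth θ

∋-ext : (θ : Fm OpForm) → Γ ⊩ t ≈ u → Γ ⊩ θ ∋ t → Γ ⊩ θ ∋ u
∋-ext θ p q = from (∋-⟦⟧ θ) (leibniz θ (p ∷≋ ≋-refl) (to (∋-⟦⟧ θ) q))

induct : (A : Fm OpForm) → Γ ⊩ ⟦ A ⟧ (𝟎 ∷ₛ ρ) →
         (∀ {Δ} → Γ ≼ Δ → ∀ t → Δ ⊩ ⟦ A ⟧ (t ∷ₛ ρ) → Δ ⊩ ⟦ A ⟧ (S t ∷ₛ ρ)) → ∀ t → Γ ⊩ ⟦ A ⟧ (t ∷ₛ ρ)
induct {ρ = ρ} A b s = ΛE (ev-⇒E (A₀ ∧ ∀' (A ⇒ Aₛ)) (∀' A) (ax (ind A) ρ)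
  (from (ev-sub A λ { zero → refl ; (suc i) → refl }) b ,ᵒ
   ΛI λ t → ev-⇒I A Aₛ λ i p → from (ev-sub A λ { zero → refl ; (suc i) → refl }) (s i t p)))
  where A₀ Aₛ : Fm OpForm
        A₀ = sub (𝟎 ∷ₛ var) A
        Aₛ = sub (S (var 0) ∷ₛ wk) A

I-closed : ∀ φ ρ → Γ ⊩ ev (λ _ → Iat φ) (t ∷ₛ ρ) (form φ) → Γ ⊩ Iat φ t
I-closed {t = t} φ ρ p =
  ev-⇒E (φ [I]) (pos φ (var 0)) (ΛE (ax (ax-F φ) ρ) t) (from (ev-mapP _ (form φ)) p)

I-least : ∀ φ ψ ρ →
  (∀ {Δ} → Γ ≼ Δ → ∀ t → Δ ⊩ ev (λ _ u → ⟦ ψ ⟧ (u ∷ₛ ρ)) (t ∷ₛ ρ) (form φ) → Δ ⊩ ⟦ ψ ⟧ (t ∷ₛ ρ)) →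
  Γ ⊩ Iat φ t → Γ ⊩ ⟦ ψ ⟧ (t ∷ₛ ρ)
I-least {t = t} φ ψ ρ c = ev-⇒E (pos φ (var 0)) ψ (ΛE
  (ev-⇒E (∀' (φ [ ψ ] ⇒ ψ)) (∀' (pos φ (var 0) ⇒ ψ)) (ax (ax-L φ ψ) ρ)
    (ΛI λ u → ev-⇒I (φ [ ψ ]) ψ λ i p → c i u (to (ev-plug ψ ρ (form φ)
        (λ i → cong ρ (+-identityʳ i))) p))) t)

-- Second-order evaluation

SEnv : Set
SEnv = ℕ → Fm OpForm

setF : SEnv → STm OpForm → Fm OpForm
setF η (sv i) = η i
setF η (sc φ) = pos φ (var 0)

_∷ᶠ_ : Fm OpForm → SEnv → SEnv
(θ ∷ᶠ η) zero = θ
(θ ∷ᶠ η) (suc i) = η i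

private variable
  η η' : SEnv

ev² : Sub → SEnv → Fm2 OpForm → Ω
ev² ρ η (eq² t u) = substT ρ t ≈ substT ρ u
ev² ρ η (ne² t u) = ¬ᵒ (substT ρ t ≈ substT ρ u)
ev² ρ η (∈² t s) = setF η s ∋ substT ρ t
ev² ρ η (∉² t s) = ¬ᵒ (setF η s ∋ substT ρ t)
ev² ρ η (∧² A B) = ev² ρ η A ∧ᵒ ev² ρ η B
ev² ρ η (∨² A B) = ev² ρ η A ∨ᵒ ev² ρ η B
ev² ρ η (∀ⁿ A) = Λ λ t → ev² (t ∷ₛ ρ) η A
ev² ρ η (∃ⁿ A) = Σᵒ λ t → ev² (t ∷ₛ ρ) η A
ev² ρ η (∀ˢ A) = Λˢ λ θ → ev² ρ (θ ∷ᶠ η) A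
ev² ρ η (∃ˢ A) = Σˢ λ θ → ev² ρ (θ ∷ᶠ η) A

ev²-¬ : ∀ A → ev² ρ η (¬² A) ⟺ ¬ᵒ (ev² ρ η A)
ev²-¬ (eq² t u) = ⟺-refl
ev²-¬ (ne² t u) = ⟺-sym ¬¬
ev²-¬ (∈² t s) = ⟺-refl
ev²-¬ (∉² t s) = ⟺-sym ¬¬
ev²-¬ (∧² A B) = ⟺-trans (∨-cong (ev²-¬ A) (ev²-¬ B)) (⟺-sym ¬∧)
ev²-¬ (∨² A B) = ⟺-trans (∧-cong (ev²-¬ A) (ev²-¬ B)) (⟺-sym ¬∨)
ev²-¬ (∀ⁿ A) = ⟺-trans (Σ-cong λ t → ev²-¬ A) (⟺-sym ¬Λ)
ev²-¬ (∃ⁿ A) = ⟺-trans (Λ-cong λ t → ev²-¬ A) (⟺-sym ¬Σ)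
ev²-¬ (∀ˢ A) = ⟺-trans (Σˢ-cong λ t → ev²-¬ A) (⟺-sym ¬Λˢ)
ev²-¬ (∃ˢ A) = ⟺-trans (Λˢ-cong λ t → ev²-¬ A) (⟺-sym ¬Σˢ)

ev²-⇒E : ∀ A B → Γ ⊩ ev² ρ η (A ⇒² B) → Γ ⊩ ev² ρ η A → Γ ⊩ ev² ρ η B
ev²-⇒E A B d a = ∨E d (λ i n → ⊥E (to (ev²-¬ A) n · (a ↑ i))) (λ _ b → b)

ev²-⇒I : ∀ A B → (∀ {Δ} → Γ ≼ Δ → Δ ⊩ ev² ρ η A → Δ ⊩ ev² ρ η B) → Γ ⊩ ev² ρ η (A ⇒² B)
ev²-⇒I A B f = ∨E (em _) (λ i a → inr (f i a)) (λ _ n → inl (from (ev²-¬ A) n))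

setF-lift : (τ : SSub OpForm) → (∀ i → setF η (τ i) ≡ η' i) →
            ∀ θ i → setF (θ ∷ᶠ η) (liftS τ i) ≡ (θ ∷ᶠ η') i
setF-lift τ e θ zero = refl
setF-lift τ e θ (suc i) with τ i | e i
... | sv j | e' = e'
... | sc φ | e' = e'

∋-cong : ∀ {θ θ'} → θ ≡ θ' → t ≡ u → (θ ∋ t) ⟺ (θ' ∋ u)
∋-cong refl refl = ⟺-refl

ev²-sub : (τ : SSub OpForm) (A : Fm2 OpForm) →
          (∀ i → substT ρ (σ i) ≡ ρ' i) → (∀ i → setF η (τ i) ≡ η' i) →
          ev² ρ η (sub2 σ τ A) ⟺ ev² ρ' η' A
ev²-sub τ (eq² t u) e f = ⟺-≡ (cong₂ _≈_ (substT-env e t) (substT-env e u))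
ev²-sub τ (ne² t u) e f = ⟺-≡ (cong₂ (λ t u → ¬ᵒ (t ≈ u)) (substT-env e t) (substT-env e u))
ev²-sub τ (∈² t (sv i)) e f = ∋-cong (f i) (substT-env e t)
ev²-sub τ (∈² t (sc φ)) e f = ∋-cong {θ = pos φ (var 0)} refl (substT-env e t)
ev²-sub τ (∉² t (sv i)) e f = ¬-cong (∋-cong (f i) (substT-env e t))
ev²-sub τ (∉² t (sc φ)) e f = ¬-cong (∋-cong {θ = pos φ (var 0)} refl (substT-env e t))
ev²-sub τ (∧² A B) e f = ∧-cong (ev²-sub τ A e f) (ev²-sub τ B e f)
ev²-sub τ (∨² A B) e f = ∨-cong (ev²-sub τ A e f) (ev²-sub τ B e f)
ev²-sub {σ = σ} τ (∀ⁿ A) e f = Λ-cong λ t → ev²-sub τ A (liftN-env {σ = σ} e t) f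
ev²-sub {σ = σ} τ (∃ⁿ A) e f = Σ-cong λ t → ev²-sub τ A (liftN-env {σ = σ} e t) f
ev²-sub τ (∀ˢ A) e f = Λˢ-cong λ θ → ev²-sub (liftS τ) A e (setF-lift τ f θ)
ev²-sub τ (∃ˢ A) e f = Σˢ-cong λ θ → ev²-sub (liftS τ) A e (setF-lift τ f θ)

ev²-emb : (f : P → STm OpForm) (A : Fm P) → ev² ρ η (emb f A) ⟺ ev (λ p t → setF η (f p) ∋ t) ρ A
ev²-emb f (t ≐ u) = ⟺-refl
ev²-emb f (t ≠ u) = ⟺-refl
ev²-emb f (pos p t) = ⟺-refl
ev²-emb f (neg p t) = ⟺-refl
ev²-emb f (A ∧ B) = ∧-cong (ev²-emb f A) (ev²-emb f B)
ev²-emb f (A ∨ B) = ∨-cong (ev²-emb f A) (ev²-emb f B)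
ev²-emb f (∀' A) = Λ-cong λ t → ev²-emb f A
ev²-emb f (∃' A) = Σ-cong λ t → ev²-emb f A

-- Soundness of the second-order calculus

module Soundness (Ax : Fm2 OpForm → Set) (valid : ∀ {A Γ} → Ax A → ∀ ρ η → Γ ⊩ ev² ρ η A) where

  refute-∷ : ∀ {A Δ} → Γ ⊩ ¬ᵒ (ev² ρ η A) → (i : Θ ≼ Γ) →
             All (λ B → Θ ⊩ ¬ᵒ (ev² ρ η B)) Δ → All (λ B → Γ ⊩ ¬ᵒ (ev² ρ η B)) (A ∷ Δ)
  refute-∷ n i ns = n ∷ All.map (_↑ i) ns

  -- A sequent is read as the absurdity of refuting all its members. This fits the one-sided
  -- classical rules without having to select a true member.
  sound : ∀ {Δ} → Ax ⊢² Δ → ∀ {Γ} ρ η → All (λ A → Γ ⊩ ¬ᵒ (ev² ρ η A)) Δ → Γ ⊩ ⊥ᵒ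
  sound (idR A p q) ρ η ns = to (¬-cong (ev²-¬ A)) (All.lookup ns q) · All.lookup ns p
  sound (∧R p d e) ρ η ns = All.lookup ns p ·
    (raa (λ i n → sound d ρ η (refute-∷ n i ns)) ,ᵒ raa (λ i n → sound e ρ η (refute-∷ n i ns)))
  sound (∨R p d) ρ η ns =
    let n = to ¬∨ (All.lookup ns p) in sound d ρ η (π₁ n ∷ π₂ n ∷ ns)
  sound (∀ⁿR p d) ρ η ns = All.lookup ns p · ΛI λ t → raa λ i n →
    sound d (t ∷ₛ ρ) η (n ∷ All.map⁺ (All.map (λ {A} m → from
        (¬-cong (ev²-sub sv A (λ _ → refl) (λ _ → refl))) (m ↑ i)) ns))
  sound (∃ⁿR {A = A} p t d) ρ η ns = All.lookup ns p · ΣI (substT ρ t) (raa λ i n →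
    sound d ρ η (refute-∷ (to (¬-cong (⟺-sym (ev²-sub sv A (λ { zero → refl ; (suc i) → refl })
        (λ _ → refl)))) n) i ns))
  sound (∀ˢR p d) ρ η ns = All.lookup ns p · ΛˢI λ θ → raa λ i n →
    sound d ρ (θ ∷ᶠ η) (n ∷ All.map⁺ (All.map (λ {A} m → from
        (¬-cong (ev²-sub (λ i → sv (suc i)) A (λ _ → refl) (λ _ → refl))) (m ↑ i)) ns))
  sound (∃ˢR {A = A} p s d) ρ η ns = All.lookup ns p · ΣˢI (setF η s) (raa λ i n →
    sound d ρ η (refute-∷ (to (¬-cong (⟺-sym (ev²-sub (s ∷ˢ sv) A (λ _ → refl)
        (λ { zero → refl ; (suc i) → refl })))) n) i ns))
  sound (cut A d e) ρ η ns = sound e ρ η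
    (from (¬-cong (ev²-¬ A)) (⇒I λ i n → sound d ρ η (refute-∷ n i ns)) ∷ ns)
  sound (axR {A = A} a σ τ p) ρ η ns =
    All.lookup ns p · from (ev²-sub τ A (λ _ → refl) (λ _ → refl)) (valid a _ _)
  sound (weak s d) ρ η ns = sound d ρ η (All.tabulate λ p → All.lookup ns (s p))

-- Comprehension, set induction and LF in the model

comprehend : (A : Fm2 OpForm) (W : Fm OpForm) → (∀ t → (W ∋ t) ⟺ ev² (t ∷ₛ ρ) η A) → Γ ⊩ ev² ρ η (Comp A)
comprehend {ρ} {η} A W e = ΣˢI W (ΛI λ t →
  ev²-⇒I (∈² (var 0) (sv 0)) (shiftS A) (λ _ p → from (shifted t) (to (e t) p)) ,ᵒ
  ev²-⇒I (shiftS A) (∈² (var 0) (sv 0)) (λ _ p → from (e t) (to (shifted t) p)))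
  where
    shifted : ∀ t → ev² (t ∷ₛ ρ) (W ∷ᶠ η) (shiftS A) ⟺ ev² (t ∷ₛ ρ) η A
    shifted t = ev²-sub (λ i → sv (suc i)) A (λ _ → refl) (λ _ → refl)

weaken : SEnv → SEnv
weaken η i = sub (liftN wk) (η i)

weaken-inst : (η : SEnv) → (∀ i → sub (liftN ρ) (η i) ≡ η' i) →
              ∀ t i → sub (liftN (t ∷ₛ ρ)) (weaken η i) ≡ η' i
weaken-inst {ρ} η e t i =
  trans (sub-comp _ _ (η i)) (trans (sub-ext (liftN-comp (t ∷ₛ ρ) wk) (η i)) (e i))

-- Replaces set variables by the formulas assigned to them. Under a number quantifier these formulas
-- must be weakened as well, keeping variable 0 as the slot for the element; `liftN wk` does this.
instantiate : Sub → SEnv → (A : Fm2 OpForm) → Arith A → Fm OpForm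
instantiate σ η (eq² t u) a = substT σ t ≐ substT σ u
instantiate σ η (ne² t u) a = substT σ t ≠ substT σ u
instantiate σ η (∈² t s) a = sub (substT σ t ∷ₛ var) (setF η s)
instantiate σ η (∉² t s) a = ¬' (sub (substT σ t ∷ₛ var) (setF η s))
instantiate σ η (∧² A B) (a , b) = instantiate σ η A a ∧ instantiate σ η B b
instantiate σ η (∨² A B) (a , b) = instantiate σ η A a ∨ instantiate σ η B b
instantiate σ η (∀ⁿ A) a = ∀' (instantiate (liftN σ) (weaken η) A a)
instantiate σ η (∃ⁿ A) a = ∃' (instantiate (liftN σ) (weaken η) A a)

setF-sub : (s : STm OpForm) → (∀ i → sub (liftN ρ) (η i) ≡ η' i) → sub (liftN ρ) (setF η s) ≡ setF η' s
setF-sub (sv i) f = f i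
setF-sub (sc φ) f = refl

⟦instantiate-∈⟧ : ∀ t s → (∀ i → substT ρ (σ i) ≡ ρ' i) → (∀ i → sub (liftN ρ) (η i) ≡ η' i) →
                  ⟦ sub (substT σ t ∷ₛ var) (setF η s) ⟧ ρ ⟺ (setF η' s ∋ substT ρ' t)
⟦instantiate-∈⟧ {ρ} {σ} {ρ'} {η} t s e f = ⟺-trans (⟺-sym (truth (sub (substT σ t ∷ₛ var) (setF η s))))
  (⟺-≡ (cong at (trans (sub-inst ρ (substT σ t) (setF η s))
                       (cong₂ (λ u → sub (u ∷ₛ var)) (substT-env e t) (setF-sub {ρ} s f)))))

⟦instantiate⟧ : (A : Fm2 OpForm) (a : Arith A) → (∀ i → substT ρ (σ i) ≡ ρ' i) →
                (∀ i → sub (liftN ρ) (η i) ≡ η' i) → ⟦ instantiate σ η A a ⟧ ρ ⟺ ev² ρ' η' A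
⟦instantiate⟧ (eq² t u) a e f = ⟺-≡ (cong₂ _≈_ (substT-env e t) (substT-env e u))
⟦instantiate⟧ (ne² t u) a e f = ⟺-≡ (cong₂ (λ t u → ¬ᵒ (t ≈ u)) (substT-env e t) (substT-env e u))
⟦instantiate⟧ (∈² t s) a e f = ⟦instantiate-∈⟧ t s e f
⟦instantiate⟧ (∉² t s) a e f = ⟺-trans (ev-¬ (sub _ (setF _ s))) (¬-cong (⟦instantiate-∈⟧ t s e f))
⟦instantiate⟧ (∧² A B) (a , b) e f = ∧-cong (⟦instantiate⟧ A a e f) (⟦instantiate⟧ B b e f)
⟦instantiate⟧ (∨² A B) (a , b) e f = ∨-cong (⟦instantiate⟧ A a e f) (⟦instantiate⟧ B b e f)
⟦instantiate⟧ {σ = σ} {η = η} (∀ⁿ A) a e f =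
  Λ-cong λ t → ⟦instantiate⟧ A a (liftN-env {σ = σ} e t) (weaken-inst η f t)
⟦instantiate⟧ {σ = σ} {η = η} (∃ⁿ A) a e f =
  Σ-cong λ t → ⟦instantiate⟧ A a (liftN-env {σ = σ} e t) (weaken-inst η f t)

valid-aca : (A : Fm2 OpForm) → Arith A → Γ ⊩ ev² ρ η (Comp A)
valid-aca {ρ = ρ} {η} A a = comprehend A W λ t → ⟺-trans (∋-⟦⟧ W)
  (⟦instantiate⟧ A a (liftN-env {σ = ρ} (λ i → substT-var (ρ i)) t)
    (weaken-inst η (λ i → trans (sub-ext liftN-var (η i)) (sub-var (η i))) t))
  where W = instantiate (liftN ρ) (weaken η) A a

valid-pa : ∀ {A} → PABasic A → Γ ⊩ ev² ρ η (emb ⊥-elim A)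
valid-pa {ρ = ρ} {A = A} a = from (ev²-emb ⊥-elim A) (to (ev-ext (λ ()) A (λ _ → refl))
  (to (ev-mapP ⊥-elim A) (ax (pa a) ρ)))

valid-set-ind : ∀ ρ η → Γ ⊩ ev² ρ η
  (∧² (∈² 𝟎 X₀) (∀ⁿ (∈² (var 0) X₀ ⇒² ∈² (S (var 0)) X₀)) ⇒² ∀ⁿ (∈² (var 0) X₀))
valid-set-ind ρ η = ev²-⇒I {ρ = ρ} {η = η} (∧² (∈² 𝟎 X₀) (∀ⁿ (∈² (var 0) X₀ ⇒² ∈² (S (var 0)) X₀)))
  (∀ⁿ (∈² (var 0) X₀))
  λ _ p → ΛI λ t → from (∋-⟦⟧ θ) (induct θ (to (∋-⟦⟧ θ) (π₁ p))
    (λ i u q → to (∋-⟦⟧ θ) (∨⇒ (ΛE (π₂ p ↑ i) u) (from (∋-⟦⟧ θ) q))) t)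
  where θ = η 0

-- Forwards, (L) is applied to the formula `θ` that interprets the quantified set. Backwards, the
-- set quantifier is instantiated by `I_φ` itself, which is closed by (F).
valid-lf : ∀ φ → Γ ⊩ ev² ρ η (LF φ)
valid-lf {ρ = ρ} {η} φ = ΛI λ t →
  ev²-⇒I A B (λ _ p → ΛˢI λ θ → ev²-⇒I (Cl φ) X0 λ i cl → from (∋-⟦⟧ θ)
    (I-least φ θ var (λ j u q → to (∋-⟦⟧ θ) (ev²-⇒E E X0 (ΛE (cl ↑ j) u) (from (closure t θ u) q)))
        (p ↑ i))) ,ᵒ
  ev²-⇒I B A (λ _ p → ev²-⇒E (Cl φ) X0 (ΛˢE p (pos φ (var 0)))
    (ΛI λ u → ev²-⇒I E X0 λ _ q → I-closed φ (t ∷ₛ ρ) (to (ev²-emb _ (form φ)) q)))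
  where
    A B X0 E : Fm2 OpForm
    A = ∈² (var 0) (sc φ)
    B = ∀ˢ (Cl φ ⇒² ∈² (var 0) X₀)
    X0 = ∈² (var 0) X₀
    E = emb (λ _ → X₀) (form φ)
    closure : ∀ t θ u → ev² (u ∷ₛ (t ∷ₛ ρ)) (θ ∷ᶠ η) E ⟺
                        ev (λ _ w → ⟦ θ ⟧ (w ∷ₛ var)) (u ∷ₛ var) (form φ)
    closure t θ u = ⟺-trans (ev²-emb (λ _ → X₀) (form φ))
      -- The operator form has no parameters, so its environment may be exchanged for `var`, the one
      -- in which the parameters of `θ` are read.
      (⟺-trans (ev-agree (form φ) (onlyX φ) λ { zero _ → refl ; (suc _) (s≤s ()) })
               (ev-ext (λ _ w → ∋-⟦⟧ θ) (form φ) λ _ → refl))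

-- Here parameter-freeness enters: set constants are excluded along with free set variables, so the
-- matrix is a formula of L_PA^X in the quantified set alone.
unembed : (A : Fm2 OpForm) → Arith A → NoFreeSet 1 A → ∃ λ B → emb (λ (_ : ⊤) → sv 0) B ≡ A
unembed (eq² t u) a n = (t ≐ u) , refl
unembed (ne² t u) a n = (t ≠ u) , refl
unembed (∈² t (sv zero)) a n = pos tt t , refl
unembed (∈² t (sv (suc i))) a (s≤s ())
unembed (∉² t (sv zero)) a n = neg tt t , refl
unembed (∉² t (sv (suc i))) a (s≤s ())
unembed (∧² A B) (a , b) (n , m) with unembed A a n | unembed B b m
... | C , refl | D , refl = C ∧ D , refl
unembed (∨² A B) (a , b) (n , m) with unembed A a n | unembed B b m
... | C , refl | D , refl = C ∨ D , refl
unembed (∀ⁿ A) a n with unembed A a n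
... | C , refl = ∀' C , refl
unembed (∃ⁿ A) a n with unembed A a n
... | C , refl = ∃' C , refl

-- The one property of ID₁ that the remainder of the proof has to supply: a quantifier over all
-- L_ID-formulas is expressed by a single L_ID-formula.
Π¹₁-Definable : Set
Π¹₁-Definable = (B : Fm ⊤) → ∃ λ χ → ∀ ρ → ⟦ χ ⟧ ρ ⟺ Λˢ λ θ → ev (λ _ → θ ∋_) ρ B

valid-π11ca : Π¹₁-Definable → ∀ A → Π¹₁ A → NoFreeSet 0 A → Γ ⊩ ev² ρ η (Comp A)
valid-π11ca {ρ = ρ} def (∀ˢ A) a n with unembed A a n
... | B , refl = let (χ , e) = def B in comprehend (∀ˢ A) (sub (liftN ρ) χ) λ t →
  ⟺-trans (truth-inst χ t) (⟺-trans (e _) (Λˢ-cong λ θ → ⟺-sym (ev²-emb _ B)))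

conservative : Π¹₁-Definable → (ψ : Fm OpForm) → Π¹₁-CA₀⁻+LF ⊢² (ψ ⋆ ∷ []) → ID₁ ⊢ (ψ ∷ [])
conservative def ψ d = subst (λ A → ID₁ ⊢ (A ∷ [])) (sub-var ψ)
  (_⊩_.force {Q = at (sub var ψ)} (from (truth ψ) (raa λ i n →
  -- An arbitrary default for the set variables: `ψ ⋆` contains set constants only.
  sound d var (λ _ → 𝟎 ≐ 𝟎) ((⇒I λ j p → (n ↑ j) · to ⋆-ev p) ∷ []))))
  where
    valid : ∀ {A Γ} → Π¹₁-CA₀⁻+LF A → ∀ ρ η → Γ ⊩ ev² ρ η A
    valid (pa a) ρ η = valid-pa a
    valid eq-∈ ρ η = ⇒∨ λ i p → ⇒∨ λ j q → ∋-ext (η 0) (p ↑ j) q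
    valid set-ind ρ η = valid-set-ind ρ η
    valid (aca A a) ρ η = valid-aca A a
    valid (π11ca A a n) ρ η = valid-π11ca def A a n
    valid (lf φ) ρ η = valid-lf φ
    open Soundness Π¹₁-CA₀⁻+LF valid
    ⋆-ev : ∀ {η} → ev² var η (ψ ⋆) ⟺ ⟦ ψ ⟧ var
    ⋆-ev = ev²-emb sc ψ

Tm-setoid : Ctx → Setoid 0ℓ 0ℓ
Tm-setoid Γ = record
  { Carrier = Tm ; _≈_ = λ t u → Γ ⊩ t ≈ u
  ; isEquivalence = record { refl = ≈-refl ; sym = ≈-sym ; trans = ≈-trans } }

-- Arithmetic in ID₁

⊕-0 : Γ ⊩ (t ⊕ 𝟎) ≈ t
⊕-0 {t = t} = ax (pa ax-+0) (λ _ → t)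

⊕-S : Γ ⊩ (t ⊕ S u) ≈ S (t ⊕ u)
⊕-S {t = t} {u} = ax (pa ax-+S) (t ∷ₛ λ _ → u)

⊗-0 : Γ ⊩ (t ⊗ 𝟎) ≈ 𝟎
⊗-0 {t = t} = ax (pa ax-*0) (λ _ → t)

⊗-S : Γ ⊩ (t ⊗ S u) ≈ ((t ⊗ u) ⊕ t)
⊗-S {t = t} {u} = ax (pa ax-*S) (t ∷ₛ λ _ → u)

S≉0 : Γ ⊩ S t ≈ 𝟎 → Γ ⊩ ⊥ᵒ
S≉0 {t = t} p = ax (pa ax-S0) (λ _ → t) · p

S-injective : Γ ⊩ S t ≈ S u → Γ ⊩ t ≈ u
S-injective {t = t} {u} p = ∨⇒ (ax (pa ax-SS) (t ∷ₛ λ _ → u)) p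

⊕-identityˡ : ∀ t → Γ ⊩ (𝟎 ⊕ t) ≈ t
⊕-identityˡ = induct {ρ = var} ((𝟎 ⊕ var 0) ≐ var 0) ⊕-0 λ i t p → ≈-trans ⊕-S (S-cong p)

⊕-Sˡ : ∀ m n → Γ ⊩ (S m ⊕ n) ≈ S (m ⊕ n)
⊕-Sˡ m = induct {ρ = m ∷ₛ var} ((S (var 1) ⊕ var 0) ≐ S (var 1 ⊕ var 0))
  (≈-trans ⊕-0 (S-cong (≈-sym ⊕-0)))
  λ i t p → ≈-trans ⊕-S (S-cong (≈-trans p (≈-sym ⊕-S)))

⊕-comm : ∀ m n → Γ ⊩ (m ⊕ n) ≈ (n ⊕ m)
⊕-comm m = induct {ρ = m ∷ₛ var} ((var 1 ⊕ var 0) ≐ (var 0 ⊕ var 1))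
  (≈-trans ⊕-0 (≈-sym (⊕-identityˡ m)))
  λ i t p → ≈-trans ⊕-S (≈-trans (S-cong p) (≈-sym (⊕-Sˡ t m)))

⊕-assoc : ∀ m n k → Γ ⊩ ((m ⊕ n) ⊕ k) ≈ (m ⊕ (n ⊕ k))
⊕-assoc m n = induct {ρ = m ∷ₛ (n ∷ₛ var)} (((var 1 ⊕ var 2) ⊕ var 0) ≐ (var 1 ⊕ (var 2 ⊕ var 0)))
  (≈-trans ⊕-0 (⊕-cong ≈-refl (≈-sym ⊕-0)))
  λ i t p → ≈-trans ⊕-S (≈-trans (S-cong p) (≈-trans (≈-sym ⊕-S) (⊕-cong ≈-refl (≈-sym ⊕-S))))

⊕-swapʳ : ∀ m n k → Γ ⊩ ((m ⊕ n) ⊕ k) ≈ ((m ⊕ k) ⊕ n)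
⊕-swapʳ m n k = ≈-trans (⊕-assoc m n k) (≈-trans (⊕-cong ≈-refl (⊕-comm n k)) (≈-sym (⊕-assoc m k n)))

⊗-zeroˡ : ∀ t → Γ ⊩ (𝟎 ⊗ t) ≈ 𝟎
⊗-zeroˡ = induct {ρ = var} ((𝟎 ⊗ var 0) ≐ 𝟎) ⊗-0 λ i t p → ≈-trans ⊗-S (≈-trans ⊕-0 p)

⊗-Sˡ : ∀ m n → Γ ⊩ (S m ⊗ n) ≈ ((m ⊗ n) ⊕ n)
⊗-Sˡ m = induct {ρ = m ∷ₛ var} ((S (var 1) ⊗ var 0) ≐ ((var 1 ⊗ var 0) ⊕ var 0))
  (≈-trans ⊗-0 (≈-sym (≈-trans ⊕-0 ⊗-0)))
  λ i t p → ≈-trans ⊗-S (≈-trans ⊕-S (≈-trans (S-cong (≈-trans (⊕-cong p ≈-refl) (⊕-swapʳ (m ⊗ t) t m)))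
    (≈-sym (≈-trans ⊕-S (S-cong (⊕-cong ⊗-S ≈-refl))))))

⊗-comm : ∀ m n → Γ ⊩ (m ⊗ n) ≈ (n ⊗ m)
⊗-comm m = induct {ρ = m ∷ₛ var} ((var 1 ⊗ var 0) ≐ (var 0 ⊗ var 1))
  (≈-trans ⊗-0 (≈-sym (⊗-zeroˡ m)))
  λ i t p → ≈-trans ⊗-S (≈-trans (⊕-cong p ≈-refl) (≈-sym (⊗-Sˡ t m)))

⊗-distribˡ : ∀ m n k → Γ ⊩ (m ⊗ (n ⊕ k)) ≈ ((m ⊗ n) ⊕ (m ⊗ k))
⊗-distribˡ m n = induct {ρ = m ∷ₛ (n ∷ₛ var)} ((var 1 ⊗ (var 2 ⊕ var 0)) ≐
  ((var 1 ⊗ var 2) ⊕ (var 1 ⊗ var 0)))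
  (≈-trans (⊗-cong ≈-refl ⊕-0) (≈-sym (≈-trans (⊕-cong ≈-refl ⊗-0) ⊕-0)))
  λ i t p → ≈-trans (⊗-cong ≈-refl ⊕-S) (≈-trans ⊗-S (≈-trans (⊕-cong p ≈-refl)
    (≈-trans (⊕-assoc _ _ _) (⊕-cong ≈-refl (≈-sym ⊗-S)))))

⊗-distribʳ : ∀ m n k → Γ ⊩ ((n ⊕ k) ⊗ m) ≈ ((n ⊗ m) ⊕ (k ⊗ m))
⊗-distribʳ m n k = ≈-trans (⊗-comm _ m) (≈-trans (⊗-distribˡ m n k) (⊕-cong (⊗-comm m n) (⊗-comm m k)))

⊗-assoc : ∀ m n k → Γ ⊩ ((m ⊗ n) ⊗ k) ≈ (m ⊗ (n ⊗ k))
⊗-assoc m n = induct {ρ = m ∷ₛ (n ∷ₛ var)} (((var 1 ⊗ var 2) ⊗ var 0) ≐ (var 1 ⊗ (var 2 ⊗ var 0)))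
  (≈-trans ⊗-0 (≈-sym (≈-trans (⊗-cong ≈-refl ⊗-0) ⊗-0)))
  λ i t p → ≈-trans ⊗-S (≈-trans (⊕-cong p ≈-refl) (≈-trans (≈-sym (⊗-distribˡ m (n ⊗ t) n))
      (⊗-cong ≈-refl (≈-sym ⊗-S))))

⊗-identityˡ : ∀ t → Γ ⊩ (S 𝟎 ⊗ t) ≈ t
⊗-identityˡ t = ≈-trans (⊗-Sˡ 𝟎 t) (≈-trans (⊕-cong (⊗-zeroˡ t) ≈-refl) (⊕-identityˡ t))

⊕-cancelˡ : ∀ m → Γ ⊩ (m ⊕ t) ≈ (m ⊕ u) → Γ ⊩ t ≈ u
⊕-cancelˡ {t = t} {u} m = ∨⇒ (induct {ρ = t ∷ₛ (u ∷ₛ var)}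
  ((var 0 ⊕ var 1) ≠ (var 0 ⊕ var 2) ∨ var 1 ≐ var 2)
  (⇒∨ λ _ p → ≈-trans (≈-sym (⊕-identityˡ t)) (≈-trans p (⊕-identityˡ u)))
  (λ i n p → ⇒∨ λ j q → ∨⇒ (p ↑ j) (S-injective (≈-trans (≈-sym (⊕-Sˡ n t)) (≈-trans q (⊕-Sˡ n u)))))
  m)

-- Opens the ring solver to provable equality in a fixed world.
Tm-commutativeSemiring : Ctx → CommutativeSemiring 0ℓ 0ℓ
Tm-commutativeSemiring Γ = record
  { Carrier = Tm ; _≈_ = λ t u → Γ ⊩ t ≈ u ; _+_ = _⊕_ ; _*_ = _⊗_ ; 0# = 𝟎 ; 1# = S 𝟎
  ; isCommutativeSemiring = isCommutativeSemiringˡ record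
    { +-isCommutativeMonoid = record
      { isMonoid = record
        { isSemigroup = record
          { isMagma = record { isEquivalence = Setoid.isEquivalence (Tm-setoid Γ) ; ∙-cong = ⊕-cong }
          ; assoc = ⊕-assoc }
        ; identity = ⊕-identityˡ , λ t → ⊕-0 }
      ; comm = ⊕-comm }
    ; *-isCommutativeMonoid = record
      { isMonoid = record
        { isSemigroup = record
          { isMagma = record { isEquivalence = Setoid.isEquivalence (Tm-setoid Γ) ; ∙-cong = ⊗-cong }
          ; assoc = ⊗-assoc }
        ; identity = ⊗-identityˡ , λ t → ≈-trans (⊗-comm t _) (⊗-identityˡ t) }
      ; comm = ⊗-comm }
    ; distribʳ = ⊗-distribʳ
    ; zeroˡ = ⊗-zeroˡ } }
  where open import Algebra.Structures.Biased (λ t u → Γ ⊩ t ≈ u) using (isCommutativeSemiringˡ)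

zero-or-suc : ∀ t → Γ ⊩ t ≈ 𝟎 ∨ᵒ Σᵒ λ u → t ≈ S u
zero-or-suc = induct {ρ = var} (var 0 ≐ 𝟎 ∨ ∃' (var 1 ≐ S (var 0))) (inl ≈-refl) λ i t _ → inr
  (ΣI t ≈-refl)

infix 7 _≤ᵒ_
_≤ᵒ_ : Tm → Tm → Ω
t ≤ᵒ u = Σᵒ λ k → (t ⊕ k) ≈ u

≤-or-> : ∀ m n → Γ ⊩ m ≤ᵒ n ∨ᵒ S n ≤ᵒ m
≤-or-> m n = induct {ρ = n ∷ₛ var} (∃' ((var 1 ⊕ var 0) ≐ var 2) ∨ ∃' ((S (var 2) ⊕ var 0) ≐ var 1))
  (inl (ΣI n (⊕-identityˡ n)))
  (λ _ m p → ∨E p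
    (λ _ l → ΣE l λ _ k e → ∨E (zero-or-suc k)
      (λ j z → inr (ΣI 𝟎 (≈-trans ⊕-0 (S-cong (≈-trans (≈-sym (e ↑ j))
          (≈-trans (⊕-cong ≈-refl z) ⊕-0))))))
      (λ j s → inl (ΣE s λ i k' z → ΣI k' (≈-trans (⊕-Sˡ m k')
        (≈-trans (≈-sym ⊕-S) (≈-trans (⊕-cong ≈-refl (≈-sym z)) (e ↑ j ↑ i)))))))
    (λ _ g → ΣE g λ _ k e → inr (ΣI (S k) (≈-trans ⊕-S (S-cong e)))))
  m

≤-antisym : Γ ⊩ t ≤ᵒ u → Γ ⊩ u ≤ᵒ t → Γ ⊩ t ≈ u
≤-antisym {t = t} {u} p q = ΣE p λ i k e → ΣE (q ↑ i) λ j l f → ∨E (zero-or-suc k)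
  (λ h z → ≈-trans (≈-sym (≈-trans (⊕-cong ≈-refl z) ⊕-0)) (e ↑ j ↑ h))
  (λ h s → ΣE s λ g k' z → ⊥E (S≉0 (⊕-cancelˡ {u = 𝟎} t
    (≈-trans (⊕-cong ≈-refl (≈-sym (≈-trans (⊕-cong z ≈-refl) (⊕-Sˡ k' l))))
    (≈-trans (≈-sym (⊕-assoc t k l)) (≈-trans (⊕-cong (e ↑ j ↑ h ↑ g) ≈-refl)
        (≈-trans (f ↑ h ↑ g) (≈-sym ⊕-0))))))))

-- Pairing

pair : Tm → Tm → Tm
pair a b = ((a ⊕ b) ⊗ (a ⊕ b)) ⊕ a

pair-cong : Γ ⊩ a ≈ c → Γ ⊩ b ≈ d → Γ ⊩ pair a b ≈ pair c d
pair-cong p q = ⊕-cong (⊗-cong (⊕-cong p q) (⊕-cong p q)) p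

-- (1 + n + k)² + c exceeds n² + a for n = a + b.
pair-sum-≮ : Γ ⊩ pair a b ≈ pair c d → Γ ⊩ S (a ⊕ b) ≤ᵒ (c ⊕ d) → Γ ⊩ ⊥ᵒ
pair-sum-≮ {a = a} {b} {c} {d} p l = ΣE l λ i k e → S≉0 (⊕-cancelˡ {u = 𝟎} (pair a b)
  (≈-trans (⊕-cong ≈-refl (S≈1+ _)) (≈-trans (gap k) (≈-trans
    (⊕-cong (⊗-cong (⊕-cong (≈-sym (S≈1+ _)) ≈-refl) (⊕-cong (≈-sym (S≈1+ _)) ≈-refl)) ≈-refl)
    (≈-trans (⊕-cong (⊗-cong e e) ≈-refl) (≈-trans (≈-sym (p ↑ i)) (≈-sym ⊕-0)))))))
  where
    S≈1+ : ∀ {Γ} t → Γ ⊩ S t ≈ (S 𝟎 ⊕ t)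
    S≈1+ t = ≈-sym (≈-trans (⊕-Sˡ 𝟎 t) (S-cong (⊕-identityˡ t)))
    gap : ∀ {Γ} k →
      Γ ⊩ (pair a b ⊕ (S 𝟎 ⊕ ((((a ⊕ b) ⊕ b) ⊕ (k ⊕ k)) ⊕ (((k ⊗ k) ⊕ ((a ⊕ b) ⊗ (k ⊕ k))) ⊕ c)))) ≈
          ((((S 𝟎 ⊕ (a ⊕ b)) ⊕ k) ⊗ ((S 𝟎 ⊕ (a ⊕ b)) ⊕ k)) ⊕ c)
    gap {Γ} k = solve 4 (λ a b c k →
      ((((a :+ b) :* (a :+ b)) :+ a) :+ (con 1 :+ ((((a :+ b) :+ b) :+ (k :+ k)) :+
          (((k :* k) :+ ((a :+ b) :* (k :+ k))) :+ c))))
      := ((((con 1 :+ (a :+ b)) :+ k) :* ((con 1 :+ (a :+ b)) :+ k)) :+ c)) ≈-refl a b c k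
      where open Solver (Tm-commutativeSemiring Γ)

pair-sum : Γ ⊩ pair a b ≈ pair c d → Γ ⊩ (a ⊕ b) ≈ (c ⊕ d)
pair-sum {a = a} {b} {c} {d} p = ∨E (≤-or-> (a ⊕ b) (c ⊕ d))
  (λ i l → ∨E (≤-or-> (c ⊕ d) (a ⊕ b))
    (λ j m → ≤-antisym (l ↑ j) m)
    (λ j g → ⊥E (pair-sum-≮ (p ↑ i ↑ j) g)))
  (λ i g → ⊥E (pair-sum-≮ (≈-sym (p ↑ i)) g))

pair-inj₁ : Γ ⊩ pair a b ≈ pair c d → Γ ⊩ a ≈ c
pair-inj₁ {a = a} {b} {c} {d} p = ⊕-cancelˡ ((c ⊕ d) ⊗ (c ⊕ d))
  (≈-trans (⊕-cong (⊗-cong (≈-sym (pair-sum p)) (≈-sym (pair-sum p))) ≈-refl) p)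

pair-inj₂ : Γ ⊩ pair a b ≈ pair c d → Γ ⊩ b ≈ d
pair-inj₂ {a = a} {b} {c} {d} p = ⊕-cancelˡ a (≈-trans (pair-sum p)
  (⊕-cong (≈-sym (pair-inj₁ p)) ≈-refl))

-- Least number principle

Least : Fm OpForm → Fm OpForm
Least A = A ∧ ∀' (sub (var 0 ∷ₛ λ i → var (2 + i)) A ⇒ ∃' ((var 2 ⊕ var 0) ≐ var 1))

Least-≤ : (A : Fm OpForm) → Γ ⊩ ⟦ Least A ⟧ (v ∷ₛ ρ) → Γ ⊩ ⟦ A ⟧ (u ∷ₛ ρ) → Γ ⊩ v ≤ᵒ u
Least-≤ {u = u} A l p = ev-⇒E (sub (var 0 ∷ₛ λ i → var (2 + i)) A) (∃' ((var 2 ⊕ var 0) ≐ var 1))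
  (ΛE (π₂ l) u) (from (ev-sub A λ { zero → refl ; (suc i) → refl }) p)

Least-unique : (A : Fm OpForm) → Γ ⊩ ⟦ Least A ⟧ (u ∷ₛ ρ) → Γ ⊩ ⟦ Least A ⟧ (v ∷ₛ ρ) → Γ ⊩ u ≈ v
Least-unique A p q = ≤-antisym (Least-≤ A p (π₁ q)) (Least-≤ A q (π₁ p))

Least-intro : (A : Fm OpForm) → Γ ⊩ ⟦ A ⟧ (v ∷ₛ ρ) →
  (∀ {Δ} → Γ ≼ Δ → ∀ u → Δ ⊩ ⟦ A ⟧ (u ∷ₛ ρ) → Δ ⊩ v ≤ᵒ u) → Γ ⊩ ⟦ Least A ⟧ (v ∷ₛ ρ)
Least-intro A p l = p ,ᵒ ΛI λ u → ev-⇒I (sub (var 0 ∷ₛ λ i → var (2 + i)) A)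
  (∃' ((var 2 ⊕ var 0) ≐ var 1))
  λ i q → l i u (to (ev-sub A λ { zero → refl ; (suc i) → refl }) q)

-- If no least witness exists, induction on `n` refutes `A` at every `u ≤ n`: a witness above `n`
-- but at most `S n` would be least.
least : (A : Fm OpForm) (ρ : Sub) → Γ ⊩ ⟦ A ⟧ (t ∷ₛ ρ) → Γ ⊩ Σᵒ λ v → ⟦ Least A ⟧ (v ∷ₛ ρ)
least {t = t} A ρ p = raa λ i none →
  let below = induct {ρ = ρ} B
        (ΛI λ u → toB λ j l → ⇒I λ k q → (none ↑ j ↑ k) · ΣI u (Least-intro A q λ h w _ →
          ΣI w (≈-trans (⊕-cong (≤0 (l ↑ k ↑ h)) ≈-refl) (⊕-identityˡ w))))
        (λ j n ih → ΛI λ u → toB λ k l → ⇒I λ h q → ∨E (≤-or-> u n)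
          (λ g u≤n → fromB (ΛE (ih ↑ k ↑ h ↑ g) u) u≤n · (q ↑ g))
          (λ g n<u → (none ↑ j ↑ k ↑ h ↑ g) · ΣI u (Least-intro A (q ↑ g) λ f w r →
            ∨E (≤-or-> w n)
              (λ e w≤n → ⊥E (fromB (ΛE (ih ↑ k ↑ h ↑ g ↑ f ↑ e) w) w≤n · (r ↑ e)))
              (λ e n<w → ΣE n<w λ d z eq → ΣI z (≈-trans
                  (⊕-cong (≤-antisym (l ↑ h ↑ g ↑ f ↑ e ↑ d) (n<u ↑ f ↑ e ↑ d)) ≈-refl) eq)))))
        t
  in fromB (ΛE below t) (ΣI 𝟎 ⊕-0) · (p ↑ i)
  where
    U : Fm OpForm
    U = sub (var 0 ∷ₛ λ i → var (2 + i)) A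
    B : Fm OpForm
    B = ∀' (∃' ((var 1 ⊕ var 0) ≐ var 2) ⇒ ¬' U)
    ⟦U⟧ : ∀ {u n} → ⟦ ¬' U ⟧ (u ∷ₛ (n ∷ₛ ρ)) ⟺ ¬ᵒ (⟦ A ⟧ (u ∷ₛ ρ))
    ⟦U⟧ = ⟺-trans (ev-¬ U) (¬-cong (ev-sub A λ { zero → refl ; (suc i) → refl }))
    toB : ∀ {Γ u n} → (∀ {Δ} → Γ ≼ Δ → Δ ⊩ u ≤ᵒ n → Δ ⊩ ¬ᵒ (⟦ A ⟧ (u ∷ₛ ρ))) →
          Γ ⊩ ⟦ ∃' ((var 1 ⊕ var 0) ≐ var 2) ⇒ ¬' U ⟧ (u ∷ₛ (n ∷ₛ ρ))
    toB f = ev-⇒I (∃' ((var 1 ⊕ var 0) ≐ var 2)) (¬' U) λ i l → from ⟦U⟧ (f i l)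
    fromB : ∀ {Γ u n} → Γ ⊩ ⟦ ∃' ((var 1 ⊕ var 0) ≐ var 2) ⇒ ¬' U ⟧ (u ∷ₛ (n ∷ₛ ρ)) →
            Γ ⊩ u ≤ᵒ n → Γ ⊩ ¬ᵒ (⟦ A ⟧ (u ∷ₛ ρ))
    fromB p l = to ⟦U⟧ (ev-⇒E (∃' ((var 1 ⊕ var 0) ≐ var 2)) (¬' U) p l)
    ≤0 : ∀ {Γ u} → Γ ⊩ u ≤ᵒ 𝟎 → Γ ⊩ u ≈ 𝟎
    ≤0 {u = u} l = ≤-antisym l (ΣI u (⊕-identityˡ u))

-- Closed operator forms and coded lists

infixr 5 _◂_
_◂_ : Tm → Sub → Sub
_◂_ = _∷ₛ_

𝟘 : Sub
𝟘 _ = 𝟎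

BoundT-subst : (∀ i → BoundT k (σ i)) → ∀ t → BoundT k (substT σ t)
BoundT-subst b (var i) = b i
BoundT-subst b 𝟎 = tt
BoundT-subst b (S t) = BoundT-subst b t
BoundT-subst b (t ⊕ u) = BoundT-subst b t , BoundT-subst b u
BoundT-subst b (t ⊗ u) = BoundT-subst b t , BoundT-subst b u

BoundT-liftN : (∀ i → BoundT k (σ i)) → ∀ i → BoundT (suc k) (liftN σ i)
BoundT-liftN b zero = s≤s z≤n
BoundT-liftN {k} {σ} b (suc i) = shiftB (σ i) (b i)
  where
    shiftB : ∀ t → BoundT k t → BoundT (suc k) (substT wk t)
    shiftB (var j) j<k = s≤s j<k
    shiftB 𝟎 _ = tt
    shiftB (S t) p = shiftB t p
    shiftB (t ⊕ u) (p , q) = shiftB t p , shiftB u q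
    shiftB (t ⊗ u) (p , q) = shiftB t p , shiftB u q

BoundF-sub : (∀ i → BoundT k (σ i)) → (A : Fm P) → BoundF k (sub σ A)
BoundF-sub b (t ≐ u) = BoundT-subst b t , BoundT-subst b u
BoundF-sub b (t ≠ u) = BoundT-subst b t , BoundT-subst b u
BoundF-sub b (pos p t) = BoundT-subst b t
BoundF-sub b (neg p t) = BoundT-subst b t
BoundF-sub b (A ∧ B) = BoundF-sub b A , BoundF-sub b B
BoundF-sub b (A ∨ B) = BoundF-sub b A , BoundF-sub b B
BoundF-sub {σ = σ} b (∀' A) = BoundF-sub (BoundT-liftN {σ = σ} b) A
BoundF-sub {σ = σ} b (∃' A) = BoundF-sub (BoundT-liftN {σ = σ} b) A

NoNeg-sub : ∀ A → NoNeg A → NoNeg (sub σ A)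
NoNeg-sub (t ≐ u) n = tt
NoNeg-sub (t ≠ u) n = tt
NoNeg-sub (pos p t) n = tt
NoNeg-sub (A ∧ B) (n , m) = NoNeg-sub A n , NoNeg-sub B m
NoNeg-sub (A ∨ B) (n , m) = NoNeg-sub A n , NoNeg-sub B m
NoNeg-sub (∀' A) n = NoNeg-sub A n
NoNeg-sub (∃' A) n = NoNeg-sub A n

NoNeg-PA : ∀ A → NoNeg (mapP ⊥-elim A)
NoNeg-PA (t ≐ u) = tt
NoNeg-PA (t ≠ u) = tt
NoNeg-PA (A ∧ B) = NoNeg-PA A , NoNeg-PA B
NoNeg-PA (A ∨ B) = NoNeg-PA A , NoNeg-PA B
NoNeg-PA (∀' A) = NoNeg-PA A
NoNeg-PA (∃' A) = NoNeg-PA A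

-- Instantiating all parameters by 0 gives the bound on free variables for free.
only-x : Sub
only-x = var 0 ∷ₛ 𝟘

closeForm : (A : Fm ⊤) → NoNeg A → OpForm
closeForm A n = opform (sub only-x A) (NoNeg-sub A n) (BoundF-sub
  (λ { zero → s≤s z≤n ; (suc i) → tt }) A)

ev-closeForm : (A : Fm ⊤) (n : NoNeg A) → ev I (t ∷ₛ ρ) (form (closeForm A n)) ⟺ ev I (t ∷ₛ 𝟘) A
ev-closeForm A n = ev-sub A λ { zero → refl ; (suc i) → refl }

∅ : ⊥ → Pred
∅ ()

ev-PA : {P : Set} {I : P → Pred} (A : Fm ⊥) → ev I ρ (mapP ⊥-elim A) ⟺ ev ∅ ρ A
ev-PA A = ⟺-trans (ev-mapP ⊥-elim A) (ev-ext (λ ()) A (λ _ → refl))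

PA-leibniz : (A : Fm ⊥) → Γ ⊩ ρ ≋ ρ' → Γ ⊩ ev ∅ ρ A → Γ ⊩ ev ∅ ρ' A
PA-leibniz = ev-leibniz (λ ())

-- Lists are coded by nil = 0 and cons a s = 1 + ⟨a , s⟩.
cons : Tm → Tm → Tm
cons a s = S (pair a s)

cons-cong : Γ ⊩ a ≈ b → Γ ⊩ s ≈ t → Γ ⊩ cons a s ≈ cons b t
cons-cong p q = S-cong (pair-cong p q)

cons-inj₁ : Γ ⊩ cons a s ≈ cons b t → Γ ⊩ a ≈ b
cons-inj₁ p = pair-inj₁ (S-injective p)

cons-inj₂ : Γ ⊩ cons a s ≈ cons b t → Γ ⊩ s ≈ t
cons-inj₂ p = pair-inj₂ (S-injective p)

-- Operator forms are unary and cannot be nested, so two predicates are merged into one, told apart by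
-- the first component: sufT u s says that the list u is a suffix of s, and derT e c s that along every
-- infinite extension of the list s of length c, some three entries eventually violate the matrix at e.
sufT : Tm → Tm → Tm
sufT u s = pair 𝟎 (pair u s)

derT : Tm → Tm → Tm → Tm
derT e c s = pair (S e) (pair c s)

sufT-cong : Γ ⊩ u ≈ u' → Γ ⊩ s ≈ s' → Γ ⊩ sufT u s ≈ sufT u' s'
sufT-cong p q = pair-cong ≈-refl (pair-cong p q)

sufT≉derT : Γ ⊩ t ≈ sufT u s → Γ ⊩ t ≈ derT e c a → Γ ⊩ ⊥ᵒ
sufT≉derT p q = S≉0 (≈-sym (pair-inj₁ (≈-euclid p q)))

-- The tree of finite attempts and its well-founded part

module Tree (M : Fm ⊥) where

  X : Tm → Fm ⊤
  X = pos tt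

  recordX : Tm → Tm → Fm ⊤
  recordX a s = ∃' (X (sufT (cons (substT wk a) (var 0)) (substT wk s)))

  bad raw-refl raw-step raw-bad raw-all raw : Fm ⊤
  raw-refl = ∃' (var 1 ≐ sufT (var 0) (var 0))
  raw-step = ∃' (∃' (∃' (var 3 ≐ sufT (var 2) (cons (var 1) (var 0)) ∧ X (sufT (var 2) (var 0)))))
  -- Variables 0 to 9 are v₃, c', v₂, c, v₁, q, the list, its length, e and the number under test.
  bad = recordX (pair (var 5) (var 4)) (var 6) ∧ recordX (pair (var 3) (var 2)) (var 6) ∧
        recordX (pair (var 1) (var 0)) (var 6) ∧
        mapP ⊥-elim (¬' (sub (var 5 ◂ var 4 ◂ var 3 ◂ var 2 ◂ var 1 ◂ var 0 ◂ var 8 ◂ 𝟘) M))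
  raw-bad = ∃' (∃' (∃' (var 3 ≐ derT (var 2) (var 1) (var 0) ∧ ∃' (∃' (∃' (∃' (∃' (∃' bad))))))))
  raw-all = ∃' (∃' (∃' (var 3 ≐ derT (var 2) (var 1) (var 0) ∧
    ∀' (X (derT (var 3) (S (var 2)) (cons (pair (var 2) (var 0)) (var 1)))))))
  raw = raw-refl ∨ raw-step ∨ raw-bad ∨ raw-all

  raw-positive : NoNeg raw
  raw-positive = tt , (tt , tt) , (tt , tt , tt , tt , NoNeg-PA (¬' (sub _ M))) , tt , tt

  Φ : OpForm
  Φ = closeForm raw raw-positive

  Matrix : Tm → Tm → Tm → Tm → Tm → Tm → Tm → Ω
  Matrix e q v₁ c v₂ c' v₃ = ev ∅ (q ◂ v₁ ◂ c ◂ v₂ ◂ c' ◂ v₃ ◂ e ◂ 𝟘) M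

  Suf : Tm → Tm → Ω
  Suf u s = Iat Φ (sufT u s)

  Der : Tm → Tm → Tm → Ω
  Der e c s = Iat Φ (derT e c s)

  -- Membership of an entry in a list, expressed by a suffix that starts with it. A list of pairs ⟨c
  -- , v⟩ is thus a finite partial graph.
  Rec : Tm → Tm → Ω
  Rec a s = Σᵒ λ r → Suf (cons a r) s

  ⟦matrix⟧ : ∀ {P : Set} {I : P → Pred} {x e c₀ s q v₁ c v₂ c' v₃} →
    ev I (v₃ ◂ c' ◂ v₂ ◂ c ◂ v₁ ◂ q ◂ s ◂ c₀ ◂ e ◂ x ◂ 𝟘)
      (mapP ⊥-elim (¬' (sub (var 5 ◂ var 4 ◂ var 3 ◂ var 2 ◂ var 1 ◂ var 0 ◂ var 8 ◂ 𝟘) M))) ⟺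
    ¬ᵒ (Matrix e q v₁ c v₂ c' v₃)
  ⟦matrix⟧ = ⟺-trans (ev-PA (¬' N)) (⟺-trans (ev-¬ N) (¬-cong
      (ev-sub M (refl ∷ᵉ refl ∷ᵉ refl ∷ᵉ refl ∷ᵉ refl ∷ᵉ refl ∷ᵉ refl ∷ᵉ λ _ → refl))))
    where N = sub (var 5 ◂ var 4 ◂ var 3 ◂ var 2 ◂ var 1 ◂ var 0 ◂ var 8 ◂ 𝟘) M

  fold : Γ ⊩ ev (λ _ → Iat Φ) (t ∷ₛ 𝟘) raw → Γ ⊩ Iat Φ t
  fold p = I-closed Φ 𝟘 (from (ev-closeForm raw raw-positive) p)

  Iat-≈ : Γ ⊩ t ≈ u → Γ ⊩ Iat Φ t → Γ ⊩ Iat Φ u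
  Iat-≈ = Iat-ext Φ

  Suf-ext : Γ ⊩ u ≈ u' → Γ ⊩ s ≈ s' → Γ ⊩ Suf u s → Γ ⊩ Suf u' s'
  Suf-ext p q = Iat-≈ (sufT-cong p q)

  Suf-refl : Γ ⊩ Suf s s
  Suf-refl {s = s} = fold (inl (ΣI s ≈-refl))

  Suf-step : Γ ⊩ Suf u s → Γ ⊩ Suf u (cons a s)
  Suf-step {u = u} {s} {a} p = fold (inr (inl (ΣI u (ΣI a (ΣI s (≈-refl ,ᵒ p))))))

  Der-bad : ∀ {q v₁ c v₂ c' v₃} →
            Γ ⊩ Rec (pair q v₁) s → Γ ⊩ Rec (pair c v₂) s → Γ ⊩ Rec (pair c' v₃) s →
            Γ ⊩ ¬ᵒ (Matrix e q v₁ c v₂ c' v₃) → Γ ⊩ Der e n s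
  Der-bad {s = s} {e} {n} {q} {v₁} {c} {v₂} {c'} {v₃} r₁ r₂ r₃ m =
    fold (inr (inr (inl (ΣI e (ΣI n (ΣI s (≈-refl ,ᵒ ΣI q (ΣI v₁ (ΣI c (ΣI v₂ (ΣI c' (ΣI v₃
      (r₁ ,ᵒ r₂ ,ᵒ r₃ ,ᵒ from ⟦matrix⟧ m)))))))))))))

  Der-all : Γ ⊩ Λ (λ v → Der e (S c) (cons (pair c v) s)) → Γ ⊩ Der e c s
  Der-all {e = e} {c} {s} p = fold (inr (inr (inr (ΣI e (ΣI c (ΣI s (≈-refl ,ᵒ p)))))))

  -- In its induction step (L) provides only `ψ` for the smaller instances. Hence `ψ` repeats
  -- membership in the fixed point next to the case distinction, and it is vacuous at codes of the
  -- other kind.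
  Suf-inv : Γ ⊩ Suf u s → Γ ⊩ u ≈ s ∨ᵒ Σᵒ λ a → Σᵒ λ s' → s ≈ cons a s' ∧ᵒ Suf u s'
  Suf-inv {u = u} {s} p = π₂ (∨⇒ (ΛE (ΛE (I-least Φ ψ 𝟘 closed p) u) s) ≈-refl)
    where
      ψ : Fm OpForm
      ψ = ∀' (∀' (var 2 ≠ sufT (var 1) (var 0) ∨ pos Φ (sufT (var 1) (var 0)) ∧
            (var 1 ≐ var 0 ∨ ∃' (∃' (var 2 ≐ cons (var 1) (var 0) ∧ pos Φ (sufT (var 3) (var 0)))))))
      closed : ∀ {Δ} → Γ ≼ Δ → ∀ t → Δ ⊩ ev (λ _ u → ⟦ ψ ⟧ (u ∷ₛ 𝟘)) (t ∷ₛ 𝟘) (form Φ) →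
               Δ ⊩ ⟦ ψ ⟧ (t ∷ₛ 𝟘)
      closed _ t p = ΛI λ u → ΛI λ s → ⇒∨ λ i eq → ∨E (to (ev-closeForm raw raw-positive) p ↑ i)
        (λ j r → ΣE r λ h w eq' → let eq'' = ≈-euclid (eq ↑ j ↑ h) eq' in
          let u≈s = ≈-trans (pair-inj₁ (pair-inj₂ eq'')) (≈-sym (pair-inj₂ (pair-inj₂ eq''))) in
          Suf-ext (≈-sym u≈s) ≈-refl Suf-refl ,ᵒ inl u≈s)
        (λ j r → ∨E r
          (λ h r → ΣE r λ g u' r → ΣE r λ f a r → ΣE r λ l s' r →
            let eq'' = ≈-euclid (π₁ r) (eq ↑ j ↑ h ↑ g ↑ f ↑ l)
                u'≈u = pair-inj₁ (pair-inj₂ eq'')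
                s≈ = ≈-sym (pair-inj₂ (pair-inj₂ eq''))
                suf = Suf-ext u'≈u ≈-refl (π₁ (∨⇒ (ΛE (ΛE (π₂ r) u') s') ≈-refl))
            in Suf-ext ≈-refl (≈-sym s≈) (Suf-step suf) ,ᵒ inr (ΣI a (ΣI s' (s≈ ,ᵒ suf))))
          (λ h r → ∨E r
            (λ g r → ΣE r λ f e r → ΣE r λ l c r → ΣE r λ o w r → ⊥E
                (sufT≉derT (eq ↑ j ↑ h ↑ g ↑ f ↑ l ↑ o) (π₁ r)))
            (λ g r → ΣE r λ f e r → ΣE r λ l c r → ΣE r λ o w r → ⊥E
                (sufT≉derT (eq ↑ j ↑ h ↑ g ↑ f ↑ l ↑ o) (π₁ r)))))

  Suf-nil : Γ ⊩ Suf (cons a u) 𝟎 → Γ ⊩ ⊥ᵒ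
  Suf-nil p = ∨E (Suf-inv p) (λ _ q → S≉0 q)
    (λ _ q → ΣE q λ _ b q → ΣE q λ _ s q → S≉0 (≈-sym (π₁ q)))

  Suf-cons : Γ ⊩ Suf u (cons a s) → Γ ⊩ u ≈ cons a s ∨ᵒ Suf u s
  Suf-cons p = ∨E (Suf-inv p) (λ _ q → inl q)
    (λ _ q → ΣE q λ _ b q → ΣE q λ _ s' q → inr (Suf-ext ≈-refl (≈-sym (cons-inj₂ (π₁ q))) (π₂ q)))

  Rec-cons : Γ ⊩ Rec b (cons a s) → Γ ⊩ b ≈ a ∨ᵒ Rec b s
  Rec-cons p = ΣE p λ _ r q → ∨E (Suf-cons q) (λ _ e → inl (cons-inj₁ e)) (λ _ w → inr (ΣI r w))

  -- The list s leaves every total relation F that satisfies the matrix. The formula used for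
  -- minimality keeps the suffix part of the fixed point unchanged.

  module _ (F : Fm OpForm) (π : Sub) where

    F[_,_] : Tm → Tm → Ω
    F[ c , v ] = ⟦ F ⟧ (c ◂ v ◂ π)

    Total : Ω
    Total = Λ λ c → Σᵒ λ v → F[ c , v ]

    Good : Tm → Ω
    Good e = Λ λ q → Λ λ v₁ → Λ λ c → Λ λ v₂ → Λ λ c' → Λ λ v₃ →
      F[ q , v₁ ] ⇒ᵒ F[ c , v₂ ] ⇒ᵒ F[ c' , v₃ ] ⇒ᵒ Matrix e q v₁ c v₂ c' v₃

    Escape : Tm → Ω
    Escape s = Σᵒ λ c → Σᵒ λ v → Rec (pair c v) s ∧ᵒ ¬ᵒ F[ c , v ]

    private
      F' : Fm OpForm
      F' = sub (var 1 ◂ var 0 ◂ λ i → var (6 + i)) F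

      ψ : Fm OpForm
      ψ = ∀' (∀' (var 2 ≠ sufT (var 1) (var 0) ∨ pos Φ (sufT (var 1) (var 0)))) ∧
          ∀' (∀' (var 2 ≠ derT (var 3) (var 1) (var 0) ∨
            ∃' (∃' (∃' (pos Φ (sufT (cons (pair (var 2) (var 1)) (var 0)) (var 3))) ∧ ¬' F'))))

      ⟦F'⟧ : ∀ {v c s n x e} → ⟦ ¬' F' ⟧ (v ◂ c ◂ s ◂ n ◂ x ◂ e ◂ π) ⟺ ¬ᵒ F[ c , v ]
      ⟦F'⟧ = ⟺-trans (ev-¬ F') (¬-cong (ev-sub F (refl ∷ᵉ refl ∷ᵉ λ _ → refl)))

      escape : ∀ {s n x e} →
        Σᵒ (λ c → Σᵒ λ v → Rec (pair c v) s ∧ᵒ ⟦ ¬' F' ⟧ (v ◂ c ◂ s ◂ n ◂ x ◂ e ◂ π)) ⟺ Escape s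
      escape = Σ-cong λ c → Σ-cong λ v → ∧-cong ⟺-refl ⟦F'⟧

      F-of : Γ ⊩ ¬ᵒ (Escape s) → Γ ⊩ Rec (pair c v) s → Γ ⊩ F[ c , v ]
      F-of {c = c} {v} n r = raa λ i m → (n ↑ i) · ΣI c (ΣI v ((r ↑ i) ,ᵒ m))

    -- Induction by (L). If a list contains a violating triple, one of its entries must lie outside
    -- `F`, by `Good`. If all extensions escape, totality gives an extension by an entry in `F`; its
    -- escape cannot use that new entry and so already happens in the list.
    Der-sound : ∀ e {n s} → Γ ⊩ Total → Γ ⊩ Good e → Γ ⊩ Der e n s → Γ ⊩ Escape s
    Der-sound {Γ} e {n} {s} total good p = to escape (∨⇒
        (ΛE (ΛE (π₂ (I-least Φ ψ (e ∷ₛ π) closed p)) n) s) ≈-refl)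
      where
        closed : ∀ {Δ} → Γ ≼ Δ → ∀ t → Δ ⊩ ev (λ _ u → ⟦ ψ ⟧ (u ∷ₛ (e ∷ₛ π))) (t ∷ₛ (e ∷ₛ π)) (form Φ) →
                 Δ ⊩ ⟦ ψ ⟧ (t ∷ₛ (e ∷ₛ π))
        closed i₀ t p = ∨E (to (ev-closeForm raw raw-positive) p)
          (λ _ r → ΣE r λ _ w eq →
            (ΛI λ u → ΛI λ s → ⇒∨ λ j eq' → let eq'' = ≈-euclid (eq ↑ j) eq' in
              Suf-ext (pair-inj₁ (pair-inj₂ eq'')) (pair-inj₂ (pair-inj₂ eq'')) Suf-refl) ,ᵒ
            (ΛI λ c → ΛI λ s → ⇒∨ λ j eq' → ⊥E (sufT≉derT (eq ↑ j) eq')))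
          (λ i₁ r → ∨E r
            (λ _ r → ΣE r λ _ u' r → ΣE r λ _ a r → ΣE r λ _ s' r →
              (ΛI λ u → ΛI λ s → ⇒∨ λ j eq' → let eq'' = ≈-euclid (π₁ r ↑ j) eq' in
                Suf-ext (pair-inj₁ (pair-inj₂ eq'')) (pair-inj₂ (pair-inj₂ eq''))
                  (Suf-step (∨⇒ (ΛE (ΛE (π₁ (π₂ r) ↑ j) u') s') ≈-refl))) ,ᵒ
              (ΛI λ c → ΛI λ s → ⇒∨ λ j eq' → ⊥E (sufT≉derT (π₁ r ↑ j) eq')))
            (λ i₂ r → ∨E r
              (λ i₃ r → ΣE r λ i₄ e' r → ΣE r λ i₅ c₀ r → ΣE r λ i₆ s' r →
                (ΛI λ u → ΛI λ s → ⇒∨ λ j eq' → ⊥E (sufT≉derT eq' (π₁ r ↑ j))) ,ᵒ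
                (ΛI λ n → ΛI λ s → ⇒∨ λ j eq' → from escape (bad-case
                  (good ↑ i₀ ↑ i₁ ↑ i₂ ↑ i₃ ↑ i₄ ↑ i₅ ↑ i₆ ↑ j) (≈-euclid (π₁ r ↑ j) eq') (π₂ r ↑ j))))
              (λ i₃ r → ΣE r λ i₄ e' r → ΣE r λ i₅ c₀ r → ΣE r λ i₆ s' r →
                (ΛI λ u → ΛI λ s → ⇒∨ λ j eq' → ⊥E (sufT≉derT eq' (π₁ r ↑ j))) ,ᵒ
                (ΛI λ n → ΛI λ s → ⇒∨ λ j eq' → from escape (all-case
                  (total ↑ i₀ ↑ i₁ ↑ i₂ ↑ i₃ ↑ i₄ ↑ i₅ ↑ i₆ ↑ j) (≈-euclid (π₁ r ↑ j) eq')
                      (π₂ r ↑ j))))))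
          where
            IH : ∀ {Δ} {a s s' : Tm} → Δ ⊩ s' ≈ s →
                 Δ ⊩ (Σᵒ λ r → ⟦ ψ ⟧ (sufT (cons a r) s' ∷ₛ (e ∷ₛ π))) → Δ ⊩ Rec a s
            IH {a = a} {s' = s'} eq r = ΣE r λ i w r →
              ΣI w (Suf-ext ≈-refl (eq ↑ i) (∨⇒ (ΛE (ΛE (π₁ r) (cons a w)) s') ≈-refl))
            ψ' : Pred
            ψ' u = ⟦ ψ ⟧ (u ∷ₛ (e ∷ₛ π))
            bad-case : ∀ {Δ e' c₀ s' n s} → Δ ⊩ Good e → Δ ⊩ derT e' c₀ s' ≈ derT e n s →
              Δ ⊩ ev (λ _ → ψ') (s' ◂ c₀ ◂ e' ◂ t ◂ 𝟘) (∃' (∃' (∃' (∃' (∃' (∃' bad)))))) → Δ ⊩ Escape s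
            bad-case good eq r = ΣE r λ i₁ q r → ΣE r λ i₂ v₁ r → ΣE r λ i₃ c r → ΣE r λ i₄ v₂ r →
              ΣE r λ i₅ c' r → ΣE r λ i₆ v₃ r → raa λ j ¬esc →
              let up : ∀ {Q} → _ ⊩ Q → _ ⊩ Q
                  up = λ p → p ↑ i₁ ↑ i₂ ↑ i₃ ↑ i₄ ↑ i₅ ↑ i₆ ↑ j
                  e'≈e = S-injective (pair-inj₁ (up eq))
                  s'≈s = pair-inj₂ (pair-inj₂ (up eq))
                  f₁ = F-of ¬esc (IH s'≈s (π₁ (r ↑ j)))
                  f₂ = F-of ¬esc (IH s'≈s (π₁ (π₂ (r ↑ j))))
                  f₃ = F-of ¬esc (IH s'≈s (π₁ (π₂ (π₂ (r ↑ j)))))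
              in to ⟦matrix⟧ (π₂ (π₂ (π₂ (r ↑ j)))) ·
                 PA-leibniz M (≈-refl ∷≋ ≈-refl ∷≋ ≈-refl ∷≋ ≈-refl ∷≋ ≈-refl ∷≋ ≈-refl ∷≋ ≈-sym
                     e'≈e ∷≋ ≋-refl)
                   (ΛE (ΛE (ΛE (ΛE (ΛE (ΛE (up good) q) v₁) c) v₂) c') v₃ · f₁ · f₂ · f₃)
            all-case : ∀ {Δ e' c₀ s' n s} → Δ ⊩ Total → Δ ⊩ derT e' c₀ s' ≈ derT e n s →
              Δ ⊩ Λ (λ v → ψ' (derT e' (S c₀) (cons (pair c₀ v) s'))) → Δ ⊩ Escape s
            all-case {e' = e'} {c₀} {s'} total eq r = ΣE (ΛE total c₀) λ i v f →
              let e'≈e = S-injective (pair-inj₁ (eq ↑ i))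
                  s'≈s = pair-inj₂ (pair-inj₂ (eq ↑ i))
              in ΣE (to escape (∨⇒ (ΛE (ΛE (π₂ (ΛE (r ↑ i) v)) (S c₀)) (cons (pair c₀ v) s'))
                  (pair-cong (S-cong e'≈e) ≈-refl)))
                λ j c q → ΣE q λ k w q → ∨E (Rec-cons (π₁ q))
                  (λ h eq' → ⊥E (π₂ (q ↑ h) · leibniz F
                    (≈-sym (pair-inj₁ eq') ∷≋ ≈-sym (pair-inj₂ eq') ∷≋ ≋-refl) (f ↑ j ↑ k ↑ h)))
                  (λ h rec → ΣI c (ΣI w (ΣE rec (λ g r p → ΣI r
                      (Suf-ext ≈-refl (s'≈s ↑ j ↑ k ↑ h ↑ g) p)) ,ᵒ π₂ (q ↑ h))))

    Der-sound-root : ∀ e → Γ ⊩ Total → Γ ⊩ Good e → Γ ⊩ ¬ᵒ (Der e 𝟎 𝟎)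
    Der-sound-root e total good = ⇒I λ i p → ΣE (Der-sound e (total ↑ i) (good ↑ i) p) λ _ c q →
      ΣE q λ _ v q → ΣE (π₁ q) λ _ r w → Suf-nil w

-- Outside the well-founded part the leftmost branch is definable, although not by a positive operator:
-- its finite initial segments are the lists all of whose suffixes make the least possible choice.

module Branch (M : Fm ⊥) where
  open Tree M public

  -- Abstract formulas keep unification from unfolding the pairing polynomial.
  abstract
    stageF choiceF branchF graphF : Fm OpForm
    stageF = var 0 ≐ 𝟎 ∧ var 1 ≐ 𝟎 ∨
      ∃' (∃' (∃' (var 3 ≐ S (var 2) ∧ var 4 ≐ cons (pair (var 2) (var 1)) (var 0))))
    choiceF = Least (neg Φ (derT (var 3) (S (var 1)) (cons (pair (var 1) (var 0)) (var 2))))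
    branchF = sub (var 0 ◂ var 1 ◂ 𝟘) stageF ∧
      ∀' (∀' (∀' (neg Φ (sufT (cons (pair (var 2) (var 1)) (var 0)) (var 4)) ∨
        sub (var 2 ◂ var 0 ◂ 𝟘) stageF ∧ sub (var 1 ◂ var 2 ◂ var 0 ◂ var 5 ◂ 𝟘) choiceF)))
    graphF = ∃' (∃' (sub (var 1 ◂ var 0 ◂ var 4 ◂ 𝟘) branchF ∧
      ∃' (pos Φ (sufT (cons (pair (var 3) (var 4)) (var 0)) (var 1)))))

  Stage : Tm → Tm → Ω
  Stage c s = ⟦ stageF ⟧ (c ◂ s ◂ 𝟘)

  Choice : Tm → Tm → Tm → Tm → Ω
  Choice e v c s = ⟦ choiceF ⟧ (v ◂ c ◂ s ◂ e ◂ 𝟘)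

  Branch : Tm → Tm → Tm → Ω
  Branch e c s = ⟦ branchF ⟧ (c ◂ s ◂ e ◂ 𝟘)

  Graph : Tm → Tm → Tm → Ω
  Graph e c v = ⟦ graphF ⟧ (c ◂ v ◂ e ◂ 𝟘)

  ⟦stage-sub⟧ : (σ : Sub) → (∀ i → substT ρ (σ i) ≡ (c ◂ s ◂ 𝟘) i) → ⟦ sub σ stageF ⟧ ρ ⟺ Stage c s
  ⟦stage-sub⟧ σ = ev-sub stageF

  ⟦choice-sub⟧ : (σ : Sub) → (∀ i → substT ρ (σ i) ≡ (v ◂ c ◂ s ◂ e ◂ 𝟘) i) →
    ⟦ sub σ choiceF ⟧ ρ ⟺ Choice e v c s
  ⟦choice-sub⟧ σ = ev-sub choiceF

  ⟦branch-sub⟧ : (σ : Sub) → (∀ i → substT ρ (σ i) ≡ (c ◂ s ◂ e ◂ 𝟘) i) →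
    ⟦ sub σ branchF ⟧ ρ ⟺ Branch e c s
  ⟦branch-sub⟧ σ = ev-sub branchF

  Descends : Tm → Tm → Ω
  Descends e s = Λ λ i → Λ λ v → Λ λ r → ¬ᵒ (Suf (cons (pair i v) r) s) ∨ᵒ Stage i r ∧ᵒ Choice e v i r

  NotDer : Tm → Tm → Tm → Tm → Ω
  NotDer e v c s = ¬ᵒ (Der e (S c) (cons (pair c v) s))

  abstract
    ⟦stage⟧ : ∀ c s → Stage c s ⟺
      (c ≈ 𝟎 ∧ᵒ s ≈ 𝟎 ∨ᵒ Σᵒ λ i → Σᵒ λ v → Σᵒ λ r → c ≈ S i ∧ᵒ s ≈ cons (pair i v) r)
    ⟦stage⟧ c s = ⟺-refl

    ⟦branch⟧ : ∀ e c s → Branch e c s ⟺ Stage c s ∧ᵒ Descends e s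
    ⟦branch⟧ e c s = ∧-cong (⟦stage-sub⟧ {ρ = c ◂ s ◂ e ◂ 𝟘} (var 0 ◂ var 1 ◂ 𝟘)
        (refl ∷ᵉ refl ∷ᵉ λ _ → refl))
      (Λ-cong λ i → Λ-cong λ v → Λ-cong λ r → ∨-cong ⟺-refl (∧-cong
        (⟦stage-sub⟧ {ρ = r ◂ v ◂ i ◂ c ◂ s ◂ e ◂ 𝟘} (var 2 ◂ var 0 ◂ 𝟘) (refl ∷ᵉ refl ∷ᵉ λ _ → refl))
        (⟦choice-sub⟧ {ρ = r ◂ v ◂ i ◂ c ◂ s ◂ e ◂ 𝟘} (var 1 ◂ var 2 ◂ var 0 ◂ var 5 ◂ 𝟘)
            (refl ∷ᵉ refl ∷ᵉ refl ∷ᵉ refl ∷ᵉ λ _ → refl))))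

    ⟦graph⟧ : ∀ e c v → Graph e c v ⟺ Σᵒ λ n → Σᵒ λ s → Branch e n s ∧ᵒ Rec (pair c v) s
    ⟦graph⟧ e c v = Σ-cong λ n → Σ-cong λ s → ∧-cong
      (⟦branch-sub⟧ {ρ = s ◂ n ◂ c ◂ v ◂ e ◂ 𝟘} (var 1 ◂ var 0 ◂ var 4 ◂ 𝟘)
          (refl ∷ᵉ refl ∷ᵉ refl ∷ᵉ λ _ → refl))
      ⟺-refl

    Choice-exists : ∀ e v c s → Γ ⊩ NotDer e v c s → Γ ⊩ Σᵒ λ w → Choice e w c s
    Choice-exists e v c s p = least {t = v} (neg Φ (derT (var 3) (S (var 1))
        (cons (pair (var 1) (var 0)) (var 2)))) (c ◂ s ◂ e ◂ 𝟘) p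

    Choice-NotDer : ∀ e v c s → Γ ⊩ Choice e v c s → Γ ⊩ NotDer e v c s
    Choice-NotDer e v c s p = π₁ p

    Choice-unique : ∀ e v w c s → Γ ⊩ Choice e v c s → Γ ⊩ Choice e w c s → Γ ⊩ v ≈ w
    Choice-unique e v w c s = Least-unique {u = v} {ρ = c ◂ s ◂ e ◂ 𝟘} {v = w}
      (neg Φ (derT (var 3) (S (var 1)) (cons (pair (var 1) (var 0)) (var 2))))

  Stage-ext : Γ ⊩ c ≈ c' → Γ ⊩ s ≈ s' → Γ ⊩ Stage c s → Γ ⊩ Stage c' s'
  Stage-ext p q = leibniz stageF (p ∷≋ q ∷≋ ≋-refl)

  Choice-ext : Γ ⊩ v ≈ w → Γ ⊩ c ≈ c' → Γ ⊩ s ≈ s' → Γ ⊩ Choice e v c s → Γ ⊩ Choice e w c' s'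
  Choice-ext p q r = leibniz choiceF (p ∷≋ q ∷≋ r ∷≋ ≋-refl)

  Branch-ext : Γ ⊩ c ≈ c' → Γ ⊩ s ≈ s' → Γ ⊩ Branch e c s → Γ ⊩ Branch e c' s'
  Branch-ext p q = leibniz branchF (p ∷≋ q ∷≋ ≋-refl)

  Branch-intro : ∀ {e c s} → Γ ⊩ Stage c s →
    (∀ {Δ} → Γ ≼ Δ → ∀ i v r → Δ ⊩ Suf (cons (pair i v) r) s → Δ ⊩ Stage i r ∧ᵒ Choice e v i r) →
    Γ ⊩ Branch e c s
  Branch-intro {e = e} {c} {s} st f = from (⟦branch⟧ e c s)
      (st ,ᵒ ΛI λ i → ΛI λ v → ΛI λ r → ⇒∨ λ j p → f j i v r p)

  Branch-stage : Γ ⊩ Branch e c s → Γ ⊩ Stage c s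
  Branch-stage p = π₁ (to (⟦branch⟧ _ _ _) p)

  Branch-elim : Γ ⊩ Branch e c s → ∀ {i v u} →
    Γ ⊩ Suf (cons (pair i v) u) s → Γ ⊩ Stage i u ∧ᵒ Choice e v i u
  Branch-elim p {i} {v} {u} q = ∨⇒ (ΛE (ΛE (ΛE (π₂ (to (⟦branch⟧ _ _ _) p)) i) v) u) q

  Branch-nil : Γ ⊩ Branch e 𝟎 𝟎
  Branch-nil = Branch-intro (from (⟦stage⟧ 𝟎 𝟎) (inl (≈-refl ,ᵒ ≈-refl))) λ _ i v r p → ⊥E (Suf-nil p)

  Branch-cons : Γ ⊩ Branch e c s → Γ ⊩ Choice e v c s → Γ ⊩ Branch e (S c) (cons (pair c v) s)
  Branch-cons {c = c} {s} {v} b ch = Branch-intro (from (⟦stage⟧ _ _)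
      (inr (ΣI c (ΣI v (ΣI s (≈-refl ,ᵒ ≈-refl)))))) λ j i w r p →
    ∨E (Suf-cons p)
      (λ h eq → let c≈i = ≈-sym (pair-inj₁ (cons-inj₁ eq)) ; s≈r = ≈-sym (cons-inj₂ eq) in
        Stage-ext c≈i s≈r (Branch-stage (b ↑ j ↑ h)) ,ᵒ
        Choice-ext (≈-sym (pair-inj₂ (cons-inj₁ eq))) c≈i s≈r (ch ↑ j ↑ h))
      (λ h q → Branch-elim (b ↑ j ↑ h) q)

  Branch-tail : Γ ⊩ Branch e c s → Γ ⊩ s ≈ cons (pair n v) u → Γ ⊩ Branch e n u ∧ᵒ Choice e v n u
  Branch-tail b eq = let p = Branch-elim b (Suf-ext eq ≈-refl Suf-refl) in
    Branch-intro (π₁ p)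
      (λ j i v r q → Branch-elim (b ↑ j) (Suf-ext ≈-refl (≈-sym (eq ↑ j)) (Suf-step q))) ,ᵒ π₂ p

  Branch-zero : Γ ⊩ Branch e 𝟎 s → Γ ⊩ s ≈ 𝟎
  Branch-zero b = ∨E (to (⟦stage⟧ _ _) (Branch-stage b)) (λ _ p → π₂ p)
    (λ _ p → ΣE p λ _ i p → ΣE p λ _ v p → ΣE p λ _ r p → ⊥E (S≉0 (≈-sym (π₁ p))))

  Branch-suc : Γ ⊩ Branch e (S c) s →
    Γ ⊩ Σᵒ λ v → Σᵒ λ r → s ≈ cons (pair c v) r ∧ᵒ Branch e c r ∧ᵒ Choice e v c r
  Branch-suc b = ∨E (to (⟦stage⟧ _ _) (Branch-stage b)) (λ _ p → ⊥E (S≉0 (π₁ p)))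
    (λ i p → ΣE p λ j c' p → ΣE p λ h v p → ΣE p λ g r p → ΣI v (ΣI r
      (let c'≈c = ≈-sym (S-injective (π₁ p)) ; eq = π₂ p ; q = Branch-tail (b ↑ i ↑ j ↑ h ↑ g) eq in
       ≈-trans eq (cons-cong (pair-cong c'≈c ≈-refl) ≈-refl) ,ᵒ
       Branch-ext c'≈c ≈-refl (π₁ q) ,ᵒ Choice-ext ≈-refl c'≈c ≈-refl (π₂ q))))

  -- Induction on the length, for both lists at once: equal tails force equal least choices at the
  -- head.
  Branch-unique : Γ ⊩ Branch e c s → Γ ⊩ Branch e c s' → Γ ⊩ s ≈ s'
  Branch-unique {e = e} {c} {s} {s'} b b' = use (ΛE (ΛE (induct {ρ = e ◂ 𝟘} U
      (ΛI λ s → ΛI λ s' → mk λ _ b b' → ≈-trans (Branch-zero b) (≈-sym (Branch-zero b')))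
      (λ _ c ih → ΛI λ s → ΛI λ s' → mk λ i₁ b b' →
        ΣE (Branch-suc b) λ i₂ v p → ΣE p λ i₃ r p → ΣE (Branch-suc (b' ↑ i₂ ↑ i₃)) λ i₄ v' q → ΣE q
            λ i₅ r' q →
        let p' = p ↑ i₄ ↑ i₅
            r≈r' = use (ΛE (ΛE (ih ↑ i₁ ↑ i₂ ↑ i₃ ↑ i₄ ↑ i₅) r) r') (π₁ (π₂ p')) (π₁ (π₂ q))
            v≈v' = Choice-unique e v v' c r (π₂ (π₂ p'))
                (Choice-ext ≈-refl ≈-refl (≈-sym r≈r') (π₂ (π₂ q)))
        in ≈-trans (π₁ p') (≈-trans (cons-cong (pair-cong ≈-refl v≈v') r≈r') (≈-sym (π₁ q))))
      c) s) s') b b'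
    where
      B B' U : Fm OpForm
      B = sub (var 2 ◂ var 1 ◂ var 3 ◂ 𝟘) branchF
      B' = sub (var 2 ◂ var 0 ◂ var 3 ◂ 𝟘) branchF
      U = ∀' (∀' (B ⇒ B' ⇒ var 1 ≐ var 0))
      mk : ∀ {Γ s s' c} → (∀ {Δ} → Γ ≼ Δ → Δ ⊩ Branch e c s → Δ ⊩ Branch e c s' → Δ ⊩ s ≈ s') →
           Γ ⊩ ⟦ B ⇒ B' ⇒ var 1 ≐ var 0 ⟧ (s' ◂ s ◂ c ◂ e ◂ 𝟘)
      mk f = ev-⇒I B (B' ⇒ var 1 ≐ var 0) λ i b → ev-⇒I B' (var 1 ≐ var 0) λ j b' → f (i ⊙ j)
        (to (⟦branch-sub⟧ _ (refl ∷ᵉ refl ∷ᵉ refl ∷ᵉ λ _ → refl)) (b ↑ j))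
        (to (⟦branch-sub⟧ _ (refl ∷ᵉ refl ∷ᵉ refl ∷ᵉ λ _ → refl)) b')
      use : ∀ {Γ s s' c} → Γ ⊩ ⟦ B ⇒ B' ⇒ var 1 ≐ var 0 ⟧ (s' ◂ s ◂ c ◂ e ◂ 𝟘) →
            Γ ⊩ Branch e c s → Γ ⊩ Branch e c s' → Γ ⊩ s ≈ s'
      use p b b' = ev-⇒E B' (var 1 ≐ var 0) (ev-⇒E B (B' ⇒ var 1 ≐ var 0) p
        (from (⟦branch-sub⟧ _ (refl ∷ᵉ refl ∷ᵉ refl ∷ᵉ λ _ → refl)) b))
        (from (⟦branch-sub⟧ _ (refl ∷ᵉ refl ∷ᵉ refl ∷ᵉ λ _ → refl)) b')

  -- Branch lists are nested. Induction on `k`: at 0 the two lists coincide by `Branch-unique`, and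
  -- a longer list is reduced to its tail.
  Branch-mono : Γ ⊩ Branch e c s → ∀ k → Γ ⊩ Branch e (c ⊕ k) s' → Γ ⊩ Suf u s → Γ ⊩ Suf u s'
  Branch-mono {e = e} {c} {s} {s'} {u} b k b' p = use (ΛE (induct {ρ = c ◂ u ◂ e ◂ 𝟘} U
      (ΛI λ s' → mk λ i b' → Suf-ext ≈-refl (Branch-unique (b ↑ i) (Branch-ext ⊕-0 ≈-refl b')) (p ↑ i))
      (λ i k ih → ΛI λ s' → mk λ j b' → ΣE (Branch-suc (Branch-ext ⊕-S ≈-refl b')) λ h v q → ΣE q
          λ g r q →
        Suf-ext ≈-refl (≈-sym (π₁ q)) (Suf-step (use (ΛE (ih ↑ j ↑ h ↑ g) r) (π₁ (π₂ q)))))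
      k) s') b'
    where
      B U : Fm OpForm
      B = sub ((var 2 ⊕ var 1) ◂ var 0 ◂ var 4 ◂ 𝟘) branchF
      U = ∀' (B ⇒ pos Φ (sufT (var 3) (var 0)))
      mk : ∀ {Γ s' k} → (∀ {Δ} → Γ ≼ Δ → Δ ⊩ Branch e (c ⊕ k) s' → Δ ⊩ Suf u s') →
           Γ ⊩ ⟦ B ⇒ pos Φ (sufT (var 3) (var 0)) ⟧ (s' ◂ k ◂ c ◂ u ◂ e ◂ 𝟘)
      mk f = ev-⇒I B (pos Φ (sufT (var 3) (var 0))) λ i b → f i
        (to (⟦branch-sub⟧ _ (refl ∷ᵉ refl ∷ᵉ refl ∷ᵉ λ _ → refl)) b)
      use : ∀ {Γ s' k} → Γ ⊩ ⟦ B ⇒ pos Φ (sufT (var 3) (var 0)) ⟧ (s' ◂ k ◂ c ◂ u ◂ e ◂ 𝟘) →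
            Γ ⊩ Branch e (c ⊕ k) s' → Γ ⊩ Suf u s'
      use p b = ev-⇒E B (pos Φ (sufT (var 3) (var 0))) p
        (from (⟦branch-sub⟧ _ (refl ∷ᵉ refl ∷ᵉ refl ∷ᵉ λ _ → refl)) b)

  -- Being outside `Der` is the invariant. If every extension were in `Der`, the list would be too
  -- by `Der-all`; the least extension outside `Der` continues the branch.
  Branch-exists : Γ ⊩ ¬ᵒ (Der e 𝟎 𝟎) → ∀ c → Γ ⊩ Σᵒ λ s → Branch e c s ∧ᵒ ¬ᵒ (Der e c s)
  Branch-exists {e = e} n c = to (⟦E⟧ c) (induct {ρ = e ◂ 𝟘} E
      (from (⟦E⟧ 𝟎) (ΣI 𝟎 (Branch-nil ,ᵒ n)))
      (λ _ c ih → from (⟦E⟧ (S c)) (ΣE (to (⟦E⟧ c) ih) λ _ s p →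
        ΣE (to ¬Λ (⇒I λ i q → (π₂ p ↑ i) · Der-all q)) λ i v q →
        ΣE (Choice-exists e v c s q) λ j w ch →
        ΣI (cons (pair c w) s) (Branch-cons (π₁ p ↑ i ↑ j) ch ,ᵒ Choice-NotDer e w c s ch)))
      c)
    where
      E : Fm OpForm
      E = ∃' (sub (var 1 ◂ var 0 ◂ var 2 ◂ 𝟘) branchF ∧ neg Φ (derT (var 2) (var 1) (var 0)))
      ⟦E⟧ : ∀ c → ⟦ E ⟧ (c ◂ e ◂ 𝟘) ⟺ Σᵒ λ s → Branch e c s ∧ᵒ ¬ᵒ (Der e c s)
      ⟦E⟧ c = Σ-cong λ s → ∧-cong
        (⟦branch-sub⟧ _ (refl ∷ᵉ refl ∷ᵉ refl ∷ᵉ λ _ → refl)) ⟺-refl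

  -- The entry at `c` is the head of the branch list of length `S c`.
  Graph-total : Γ ⊩ ¬ᵒ (Der e 𝟎 𝟎) → ∀ c → Γ ⊩ Σᵒ λ v → Graph e c v
  Graph-total n c = ΣE (Branch-exists n (S c)) λ _ s p → ΣE (Branch-suc (π₁ p)) λ i v q → ΣE q λ j r q →
    ΣI v (from (⟦graph⟧ _ _ _) (ΣI (S c) (ΣI s ((π₁ p ↑ i ↑ j) ,ᵒ ΣI r
        (Suf-ext (π₁ q) ≈-refl Suf-refl)))))

  Rec-mono : Γ ⊩ Branch e n s → ∀ k → Γ ⊩ Branch e m s' → Γ ⊩ m ≈ (n ⊕ k) → Γ ⊩ Rec a s → Γ ⊩ Rec a s'
  Rec-mono b k b' eq r = ΣE r λ i w p → ΣI w (Branch-mono (b ↑ i) k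
      (Branch-ext (eq ↑ i) ≈-refl (b' ↑ i)) p)

  -- The branch list whose length is the sum of the three given lengths contains all three entries.
  -- It is not in `Der`, so by `Der-bad` they cannot violate the matrix.
  Graph-good : Γ ⊩ ¬ᵒ (Der e 𝟎 𝟎) → ∀ {q v₁ c v₂ c' v₃} →
    Γ ⊩ Graph e q v₁ → Γ ⊩ Graph e c v₂ → Γ ⊩ Graph e c' v₃ → Γ ⊩ Matrix e q v₁ c v₂ c' v₃
  Graph-good ¬d g₁ g₂ g₃ =
    ΣE (to (⟦graph⟧ _ _ _) g₁) λ i₁ n₁ p₁ → ΣE p₁ λ i₂ s₁ p₁ →
    ΣE (to (⟦graph⟧ _ _ _) g₂ ↑ i₁ ↑ i₂) λ i₃ n₂ p₂ → ΣE p₂ λ i₄ s₂ p₂ →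
    ΣE (to (⟦graph⟧ _ _ _) g₃ ↑ i₁ ↑ i₂ ↑ i₃ ↑ i₄) λ i₅ n₃ p₃ → ΣE p₃ λ i₆ s₃ p₃ →
    ΣE (Branch-exists (¬d ↑ i₁ ↑ i₂ ↑ i₃ ↑ i₄ ↑ i₅ ↑ i₆) (n₁ ⊕ (n₂ ⊕ n₃))) λ i₇ s p →
    let p₁' = p₁ ↑ i₃ ↑ i₄ ↑ i₅ ↑ i₆ ↑ i₇
        p₂' = p₂ ↑ i₅ ↑ i₆ ↑ i₇
        p₃' = p₃ ↑ i₇
        br = π₁ p
    in raa λ j m → (π₂ p ↑ j) · Der-bad
      (Rec-mono (π₁ p₁') (n₂ ⊕ n₃) br ≈-refl (π₂ p₁') ↑ j)
      (Rec-mono (π₁ p₂') (n₁ ⊕ n₃) br (≈-trans (≈-sym (⊕-assoc n₁ n₂ n₃))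
        (≈-trans (⊕-cong (⊕-comm n₁ n₂) ≈-refl) (⊕-assoc n₂ n₁ n₃))) (π₂ p₂') ↑ j)
      (Rec-mono (π₁ p₃') (n₁ ⊕ n₂) br (≈-trans (≈-sym (⊕-assoc n₁ n₂ n₃)) (⊕-comm (n₁ ⊕ n₂) n₃))
          (π₂ p₃') ↑ j)
      m

-- Skolem normal form

-- ∃X A holds iff there are bits b(q) of X, with 0 for membership, and a function v(c) such that
-- q, b(q), c, v(c), c', v(c') (variables 0 to 5) satisfy skolem A for all q, c, c'. The choices for ∨
-- and ∃ are first components of v that the pair c, c' forces to be constant; for ∀ x the value at
-- ⟨x , d⟩ is that of the solution for x at d.
skolem : Fm ⊤ → Fm ⊥
skolem (t ≐ u) = substT (λ i → var (6 + i)) t ≐ substT (λ i → var (6 + i)) u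
skolem (t ≠ u) = substT (λ i → var (6 + i)) t ≠ substT (λ i → var (6 + i)) u
skolem (pos _ t) = var 0 ≠ substT (λ i → var (6 + i)) t ∨ var 1 ≐ 𝟎
skolem (neg _ t) = var 0 ≠ substT (λ i → var (6 + i)) t ∨ var 1 ≠ 𝟎
skolem (A ∧ B) = ∃' (∃' (∃' (∃' (var 7 ≐ pair (var 3) (var 2) ∧ var 9 ≐ pair (var 1) (var 0) ∧
  sub (var 4 ◂ var 5 ◂ var 6 ◂ var 3 ◂ var 8 ◂ var 1 ◂ λ i → var (10 + i)) (skolem A) ∧
  sub (var 4 ◂ var 5 ◂ var 6 ◂ var 2 ◂ var 8 ◂ var 0 ◂ λ i → var (10 + i)) (skolem B)))))
skolem (A ∨ B) = ∃' (∃' (∃' (var 6 ≐ pair (var 2) (var 1) ∧ var 8 ≐ pair (var 2) (var 0) ∧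
  (var 2 ≐ 𝟎 ∧ sub (var 3 ◂ var 4 ◂ var 5 ◂ var 1 ◂ var 7 ◂ var 0 ◂ λ i → var (9 + i)) (skolem A) ∨
   var 2 ≠ 𝟎 ∧ sub (var 3 ◂ var 4 ◂ var 5 ◂ var 1 ◂ var 7 ◂ var 0 ◂ λ i → var (9 + i)) (skolem B)))))
skolem (∀' A) = ∀' (∀' (∀' (var 5 ≠ pair (var 2) (var 1) ∨ var 7 ≠ pair (var 2) (var 0) ∨
  sub (var 3 ◂ var 4 ◂ var 1 ◂ var 6 ◂ var 0 ◂ var 8 ◂ var 2 ◂ λ i → var (9 + i)) (skolem A))))
skolem (∃' A) = ∃' (∃' (∃' (var 6 ≐ pair (var 2) (var 1) ∧ var 8 ≐ pair (var 2) (var 0) ∧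
  sub (var 3 ◂ var 4 ◂ var 5 ◂ var 1 ◂ var 7 ◂ var 0 ◂ var 2 ◂ λ i → var (9 + i)) (skolem A))))

Sk : Fm ⊤ → Sub → (q b c v c' v' : Tm) → Ω
Sk A ρ q b c v c' v' = ev ∅ (q ◂ b ◂ c ◂ v ◂ c' ◂ v' ◂ ρ) (skolem A)

Sk-ext : ∀ A → Γ ⊩ ρ ≋ ρ' → Γ ⊩ v ≈ w → Γ ⊩ v' ≈ w' →
         Γ ⊩ Sk A ρ q b c v c' v' → Γ ⊩ Sk A ρ' q b c w c' w'
Sk-ext A e p p' = PA-leibniz (skolem A) (≈-refl ∷≋ ≈-refl ∷≋ ≈-refl ∷≋ p ∷≋ ≈-refl ∷≋ p' ∷≋ e)

Sk-sub : ∀ A {τ} (σ : Sub) → (∀ i → substT τ (σ i) ≡ (q ◂ b ◂ c ◂ v ◂ c' ◂ v' ◂ ρ) i) →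
         ev ∅ τ (sub σ (skolem A)) ⟺ Sk A ρ q b c v c' v'
Sk-sub A σ = ev-sub (skolem A)

Split : (Tm → Tm → Tm → Ω) → Tm → Tm → Ω
Split R v v' = Σᵒ λ d → Σᵒ λ w → Σᵒ λ w' → v ≈ pair d w ∧ᵒ v' ≈ pair d w' ∧ᵒ R d w w'

⟦Sk-≐⟧ : ∀ t u → Sk (t ≐ u) ρ q b c v c' v' ⟺ substT ρ t ≈ substT ρ u
⟦Sk-≐⟧ t u = ⟺-≡ (cong₂ _≈_ (substT-comp _ _ t) (substT-comp _ _ u))

⟦Sk-pos⟧ : ∀ t → Sk (pos tt t) ρ q b c v c' v' ⟺ ¬ᵒ (q ≈ substT ρ t) ∨ᵒ b ≈ 𝟎
⟦Sk-pos⟧ {q = q} t = ∨-cong (¬-cong (⟺-≡ (cong (q ≈_) (substT-comp _ _ t)))) ⟺-refl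

⟦Sk-neg⟧ : ∀ t → Sk (neg tt t) ρ q b c v c' v' ⟺ ¬ᵒ (q ≈ substT ρ t) ∨ᵒ ¬ᵒ (b ≈ 𝟎)
⟦Sk-neg⟧ {q = q} t = ∨-cong (¬-cong (⟺-≡ (cong (q ≈_) (substT-comp _ _ t)))) ⟺-refl

⟦Sk-∧⟧ : ∀ A B ρ q b c v c' v' → Sk (A ∧ B) ρ q b c v c' v' ⟺
  Σᵒ λ v₁ → Σᵒ λ v₂ → Σᵒ λ v₁' → Σᵒ λ v₂' → v ≈ pair v₁ v₂ ∧ᵒ v' ≈ pair v₁' v₂' ∧ᵒ
    Sk A ρ q b c v₁ c' v₁' ∧ᵒ Sk B ρ q b c v₂ c' v₂'
⟦Sk-∧⟧ A B ρ q b c v c' v' = Σ-cong λ v₁ → Σ-cong λ v₂ → Σ-cong λ v₁' → Σ-cong λ v₂' →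
  ∧-cong ⟺-refl (∧-cong ⟺-refl (∧-cong
    (Sk-sub A {v₂' ◂ v₁' ◂ v₂ ◂ v₁ ◂ q ◂ b ◂ c ◂ v ◂ c' ◂ v' ◂ ρ} _
        (refl ∷ᵉ refl ∷ᵉ refl ∷ᵉ refl ∷ᵉ refl ∷ᵉ refl ∷ᵉ λ _ → refl))
    (Sk-sub B {v₂' ◂ v₁' ◂ v₂ ◂ v₁ ◂ q ◂ b ◂ c ◂ v ◂ c' ◂ v' ◂ ρ} _
        (refl ∷ᵉ refl ∷ᵉ refl ∷ᵉ refl ∷ᵉ refl ∷ᵉ refl ∷ᵉ λ _ → refl))))

⟦Sk-∨⟧ : ∀ A B ρ q b c v c' v' → Sk (A ∨ B) ρ q b c v c' v' ⟺
  Split (λ d w w' → d ≈ 𝟎 ∧ᵒ Sk A ρ q b c w c' w' ∨ᵒ ¬ᵒ (d ≈ 𝟎) ∧ᵒ Sk B ρ q b c w c' w') v v'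
⟦Sk-∨⟧ A B ρ q b c v c' v' = Σ-cong λ d → Σ-cong λ w → Σ-cong λ w' →
  ∧-cong ⟺-refl (∧-cong ⟺-refl (∨-cong
    (∧-cong ⟺-refl (Sk-sub A {w' ◂ w ◂ d ◂ q ◂ b ◂ c ◂ v ◂ c' ◂ v' ◂ ρ} _
        (refl ∷ᵉ refl ∷ᵉ refl ∷ᵉ refl ∷ᵉ refl ∷ᵉ refl ∷ᵉ λ _ → refl)))
    (∧-cong ⟺-refl (Sk-sub B {w' ◂ w ◂ d ◂ q ◂ b ◂ c ◂ v ◂ c' ◂ v' ◂ ρ} _
        (refl ∷ᵉ refl ∷ᵉ refl ∷ᵉ refl ∷ᵉ refl ∷ᵉ refl ∷ᵉ λ _ → refl)))))

⟦Sk-∃⟧ : ∀ A ρ q b c v c' v' → Sk (∃' A) ρ q b c v c' v' ⟺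
  Split (λ d w w' → Sk A (d ∷ₛ ρ) q b c w c' w') v v'
⟦Sk-∃⟧ A ρ q b c v c' v' = Σ-cong λ d → Σ-cong λ w → Σ-cong λ w' →
  ∧-cong ⟺-refl (∧-cong ⟺-refl (Sk-sub A {w' ◂ w ◂ d ◂ q ◂ b ◂ c ◂ v ◂ c' ◂ v' ◂ ρ} _
      (refl ∷ᵉ refl ∷ᵉ refl ∷ᵉ refl ∷ᵉ refl ∷ᵉ refl ∷ᵉ refl ∷ᵉ λ _ → refl)))

-- Both arguments are split with the same `x`: solutions for different `x` are never compared, so
-- the choices inside may depend on `x`.
⟦Sk-∀⟧ : ∀ A ρ q b c v c' v' → Sk (∀' A) ρ q b c v c' v' ⟺
  Λ λ x → Λ λ d → Λ λ d' → ¬ᵒ (c ≈ pair x d) ∨ᵒ ¬ᵒ (c' ≈ pair x d') ∨ᵒ Sk A (x ∷ₛ ρ) q b d v d' v'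
⟦Sk-∀⟧ A ρ q b c v c' v' = Λ-cong λ x → Λ-cong λ d → Λ-cong λ d' →
  ∨-cong ⟺-refl (∨-cong ⟺-refl (Sk-sub A {d' ◂ d ◂ x ◂ q ◂ b ◂ c ◂ v ◂ c' ◂ v' ◂ ρ} _
      (refl ∷ᵉ refl ∷ᵉ refl ∷ᵉ refl ∷ᵉ refl ∷ᵉ refl ∷ᵉ refl ∷ᵉ λ _ → refl)))

-- From a Skolem solution to truth of the formula

module Model (Bit : Tm → Tm → Ω) where

  In : Pred
  In q = Σᵒ λ b → Bit q b ∧ᵒ b ≈ 𝟎

  TotalR : Ctx → (Tm → Tm → Ω) → Set
  TotalR Γ G = ∀ c → Γ ⊩ Σᵒ λ v → G c v

  -- The condition ranges over all values of the relation `G` at the arguments, which takes the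
  -- place of function application.
  Solves : Ctx → (Tm → Tm → Ω) → (Tm → Tm → Tm → Tm → Tm → Tm → Ω) → Set
  Solves Γ G R = ∀ {Δ} → Γ ≼ Δ → ∀ {q b c v c' v'} →
    Δ ⊩ Bit q b → Δ ⊩ G c v → Δ ⊩ G c' v' → Δ ⊩ R q b c v c' v'

  up-Total : ∀ {G} → TotalR Γ G → Γ ≼ Δ → TotalR Δ G
  up-Total f i c = f c ↑ i

  At : (Tm → Tm → Ω) → Tm → Tm → Tm → Ω
  At G d c w = Σᵒ λ v → G c v ∧ᵒ v ≈ pair d w

  module _ (G : Tm → Tm → Ω) (R : Tm → Tm → Tm → Tm → Tm → Tm → Tm → Ω)
           (R-ext : ∀ {Γ q b c c' d d' v w v' w'} → Γ ⊩ d ≈ d' → Γ ⊩ v ≈ w → Γ ⊩ v' ≈ w' →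
                    Γ ⊩ R d q b c v c' v' → Γ ⊩ R d' q b c w c' w') where

    SplitR : Tm → Tm → Tm → Tm → Tm → Tm → Ω
    SplitR q b c v c' v' = Split (λ d w w' → R d q b c w c' w') v v'

    split-solves : Solves Γ G SplitR → ∀ d → Solves Γ (At G d) (R d)
    split-solves sol d i bit g g' = ΣE g λ j₁ v p → ΣE (g' ↑ j₁) λ j₂ v' p' →
      ΣE (sol (i ⊙ (j₁ ⊙ j₂)) (bit ↑ j₁ ↑ j₂) (π₁ p ↑ j₂) (π₁ p')) λ j₃ d' r → ΣE r λ j₄ w r → ΣE r
          λ j₅ w' r →
      let eq = ≈-euclid (π₁ r) (π₂ p ↑ j₂ ↑ j₃ ↑ j₄ ↑ j₅) ; eq' = ≈-euclid (π₁ (π₂ r))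
              (π₂ p' ↑ j₃ ↑ j₄ ↑ j₅) in
      R-ext (pair-inj₁ eq) (pair-inj₂ eq) (pair-inj₂ eq') (π₂ (π₂ r))

    -- The constant choice `d` is read off at the argument 0. Comparing that argument with each `c`
    -- shows that every value has first component `d`, by injectivity of pairing.
    split-total : ∀ {Q} → TotalR Γ Bit → TotalR Γ G → Solves Γ G SplitR →
      (∀ {Δ} → Γ ≼ Δ → ∀ d → TotalR Δ (At G d) → Δ ⊩ Q) → Γ ⊩ Q
    split-total bits total sol f = ΣE (bits 𝟎) λ i₁ b bit → ΣE (total 𝟎 ↑ i₁) λ i₂ v₀ g₀ →
      ΣE (sol (i₁ ⊙ i₂) (bit ↑ i₂) g₀ g₀) λ i₃ d r → ΣE r λ i₄ w₀ r → ΣE r λ i₅ _ r →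
      f (i₁ ⊙ (i₂ ⊙ (i₃ ⊙ (i₄ ⊙ i₅)))) d λ c → ΣE (total c ↑ i₁ ↑ i₂ ↑ i₃ ↑ i₄ ↑ i₅) λ i₆ v g →
        ΣE (sol (i₁ ⊙ (i₂ ⊙ (i₃ ⊙ (i₄ ⊙ (i₅ ⊙ i₆))))) (bit ↑ i₂ ↑ i₃ ↑ i₄ ↑ i₅ ↑ i₆)
            (g₀ ↑ i₃ ↑ i₄ ↑ i₅ ↑ i₆) g)
        λ i₇ d' s → ΣE s λ i₈ _ s → ΣE s λ i₉ w s →
        ΣI w (ΣI v ((g ↑ i₇ ↑ i₈ ↑ i₉) ,ᵒ ≈-trans (π₁ (π₂ s))
          (pair-cong (pair-inj₁ (≈-euclid (π₁ s) (π₁ r ↑ i₆ ↑ i₇ ↑ i₈ ↑ i₉))) ≈-refl)))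

  -- The solution is transformed along the recursion on `A`: projected for ∧, stripped of its
  -- constant component for ∨ and ∃, and restricted to arguments ⟨x , d⟩ for ∀ x.
  model : (A : Fm ⊤) (ρ : Sub) (G : Tm → Tm → Ω) → TotalR Γ Bit → TotalR Γ G → Solves Γ G (Sk A ρ) →
          Γ ⊩ ev (λ _ → In) ρ A
  model (t ≐ u) ρ G bits total sol = ΣE (bits 𝟎) λ i b bit → ΣE (total 𝟎 ↑ i) λ j v g →
    to (⟦Sk-≐⟧ t u) (sol (i ⊙ j) (bit ↑ j) g g)
  model (t ≠ u) ρ G bits total sol = ΣE (bits 𝟎) λ i b bit → ΣE (total 𝟎 ↑ i) λ j v g →
    to (¬-cong (⟦Sk-≐⟧ {v = v} {v' = v} t u)) (sol (i ⊙ j) (bit ↑ j) g g)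
  model (pos tt t) ρ G bits total sol = ΣE (bits (substT ρ t)) λ i b bit → ΣE (total 𝟎 ↑ i) λ j v g →
    ΣI b ((bit ↑ j) ,ᵒ ∨⇒ (to (⟦Sk-pos⟧ t) (sol (i ⊙ j) (bit ↑ j) g g)) ≈-refl)
  model (neg tt t) ρ G bits total sol = ⇒I λ h p → ΣE p λ i b p → ΣE (total 𝟎 ↑ h ↑ i) λ j v g →
    ∨⇒ (to (⟦Sk-neg⟧ t) (sol (h ⊙ (i ⊙ j)) (π₁ p ↑ j) g g)) ≈-refl · (π₂ p ↑ j)
  model (A ∧ B) ρ G bits total sol =
    model A ρ (λ c w → Σᵒ λ w' → Σᵒ λ v → G c v ∧ᵒ v ≈ pair w w') bits
      (λ c → shape c λ v v₁ v₂ p → ΣI v₁ (ΣI v₂ (ΣI v p)))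
      (λ i bit g g' → ΣE g λ j₁ x g → ΣE g λ j₂ v g → ΣE (g' ↑ j₁ ↑ j₂) λ j₃ x' g' → ΣE g' λ j₄ v' g' →
        ΣE (to (⟦Sk-∧⟧ A B ρ _ _ _ _ _ _) (sol (i ⊙ (j₁ ⊙ (j₂ ⊙ (j₃ ⊙ j₄))))
            (bit ↑ j₁ ↑ j₂ ↑ j₃ ↑ j₄) (π₁ g ↑ j₃ ↑ j₄) (π₁ g')))
        λ h₁ _ p → ΣE p λ h₂ _ p → ΣE p λ h₃ _ p → ΣE p λ h₄ _ p →
        Sk-ext A ≋-refl (pair-inj₁ (≈-euclid (π₁ p) (π₂ g ↑ j₃ ↑ j₄ ↑ h₁ ↑ h₂ ↑ h₃ ↑ h₄)))
          (pair-inj₁ (≈-euclid (π₁ (π₂ p)) (π₂ g' ↑ h₁ ↑ h₂ ↑ h₃ ↑ h₄))) (π₁ (π₂ (π₂ p)))) ,ᵒ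
    model B ρ (λ c w → Σᵒ λ w' → Σᵒ λ v → G c v ∧ᵒ v ≈ pair w' w) bits
      (λ c → shape c λ v v₁ v₂ p → ΣI v₂ (ΣI v₁ (ΣI v p)))
      (λ i bit g g' → ΣE g λ j₁ x g → ΣE g λ j₂ v g → ΣE (g' ↑ j₁ ↑ j₂) λ j₃ x' g' → ΣE g' λ j₄ v' g' →
        ΣE (to (⟦Sk-∧⟧ A B ρ _ _ _ _ _ _) (sol (i ⊙ (j₁ ⊙ (j₂ ⊙ (j₃ ⊙ j₄))))
            (bit ↑ j₁ ↑ j₂ ↑ j₃ ↑ j₄) (π₁ g ↑ j₃ ↑ j₄) (π₁ g')))
        λ h₁ _ p → ΣE p λ h₂ _ p → ΣE p λ h₃ _ p → ΣE p λ h₄ _ p →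
        Sk-ext B ≋-refl (pair-inj₂ (≈-euclid (π₁ p) (π₂ g ↑ j₃ ↑ j₄ ↑ h₁ ↑ h₂ ↑ h₃ ↑ h₄)))
          (pair-inj₂ (≈-euclid (π₁ (π₂ p)) (π₂ g' ↑ h₁ ↑ h₂ ↑ h₃ ↑ h₄))) (π₂ (π₂ (π₂ p))))
    where
      shape : ∀ c {Q} → (∀ {Δ} v v₁ v₂ → Δ ⊩ G c v ∧ᵒ v ≈ pair v₁ v₂ → Δ ⊩ Q) → _ ⊩ Q
      shape c f = ΣE (bits 𝟎) λ i₁ b bit → ΣE (total c ↑ i₁) λ i₂ v g →
        ΣE (to (⟦Sk-∧⟧ A B ρ _ _ _ _ _ _) (sol (i₁ ⊙ i₂) (bit ↑ i₂) g g))
        λ h₁ v₁ p → ΣE p λ h₂ v₂ p → ΣE p λ h₃ _ p → ΣE p λ h₄ _ p → f v v₁ v₂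
            ((g ↑ h₁ ↑ h₂ ↑ h₃ ↑ h₄) ,ᵒ π₁ p)
  model {Γ} (A ∨ B) ρ G bits total sol = split-total G R R-ext bits total sol' λ i d tot →
    ∨E (em (d ≈ 𝟎))
      (λ j z → inl (model A ρ (At G d) (up-Total bits (i ⊙ j)) (up-Total tot j)
        λ h bit g g' → ∨E (split-solves G R R-ext sol' d (i ⊙ (j ⊙ h)) bit g g')
          (λ _ p → π₂ p) (λ k p → ⊥E (π₁ p · (z ↑ h ↑ k)))))
      (λ j z → inr (model B ρ (At G d) (up-Total bits (i ⊙ j)) (up-Total tot j)
        λ h bit g g' → ∨E (split-solves G R R-ext sol' d (i ⊙ (j ⊙ h)) bit g g')
          (λ k p → ⊥E ((z ↑ h ↑ k) · π₁ p)) (λ _ p → π₂ p)))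
    where
      R : Tm → Tm → Tm → Tm → Tm → Tm → Tm → Ω
      R d q b c w c' w' = d ≈ 𝟎 ∧ᵒ Sk A ρ q b c w c' w' ∨ᵒ ¬ᵒ (d ≈ 𝟎) ∧ᵒ Sk B ρ q b c w c' w'
      R-ext : ∀ {Γ q b c c' d d' v w v' w'} → Γ ⊩ d ≈ d' → Γ ⊩ v ≈ w → Γ ⊩ v' ≈ w' →
              Γ ⊩ R d q b c v c' v' → Γ ⊩ R d' q b c w c' w'
      R-ext p q r s = ∨E s
        (λ i s → inl (≈-euclid (p ↑ i) (π₁ s) ,ᵒ Sk-ext A ≋-refl (q ↑ i) (r ↑ i) (π₂ s)))
        (λ i s → inr ((⇒I λ j z → (π₁ s ↑ j) · ≈-trans (p ↑ i ↑ j) z) ,ᵒ Sk-ext B ≋-refl (q ↑ i)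
            (r ↑ i) (π₂ s)))
      sol' : Solves Γ G (SplitR G R R-ext)
      sol' i bit g g' = to (⟦Sk-∨⟧ A B ρ _ _ _ _ _ _) (sol i bit g g')
  model (∀' A) ρ G bits total sol = ΛI λ x → model A (x ∷ₛ ρ) (λ d v → G (pair x d) v) bits
      (λ d → total (pair x d))
    λ i {c = d} {c' = d'} bit g g' →
      ∨⇒ (∨⇒ (ΛE (ΛE (ΛE (to (⟦Sk-∀⟧ A ρ _ _ _ _ _ _) (sol i bit g g')) x) d) d') ≈-refl) ≈-refl
  model {Γ} (∃' A) ρ G bits total sol = split-total G R R-ext bits total sol' λ i d tot →
    ΣI d (model A (d ∷ₛ ρ) (At G d) (up-Total bits i) tot λ h bit g g' → split-solves G R R-ext sol'
        d (i ⊙ h) bit g g')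
    where
      R : Tm → Tm → Tm → Tm → Tm → Tm → Tm → Ω
      R d = Sk A (d ∷ₛ ρ)
      R-ext : ∀ {Γ q b c c' d d' v w v' w'} → Γ ⊩ d ≈ d' → Γ ⊩ v ≈ w → Γ ⊩ v' ≈ w' →
              Γ ⊩ R d q b c v c' v' → Γ ⊩ R d' q b c w c' w'
      R-ext p = Sk-ext A (p ∷≋ ≋-refl)
      sol' : Solves Γ G (SplitR G R R-ext)
      sol' i bit g g' = to (⟦Sk-∃⟧ A ρ _ _ _ _ _ _) (sol i bit g g')

-- The set X is given by ψ with parameters π; uniform choices are made by least witnesses.
module Solution (ψ : Fm OpForm) (π : Sub) where

  -- Variables 0 and 1 are the argument and the value; the rest is the context of `plug k ψ A`. The
  -- choices at ∨ and ∃ come from the truth of subformulas and never consult the argument. Literals,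
  -- and arguments at ∀ that are no pairs, admit every value.
  solution : ℕ → Fm ⊤ → Fm OpForm
  solution k (t ≐ u) = 𝟎 ≐ 𝟎
  solution k (t ≠ u) = 𝟎 ≐ 𝟎
  solution k (pos _ t) = 𝟎 ≐ 𝟎
  solution k (neg _ t) = 𝟎 ≐ 𝟎
  solution k (A ∧ B) = ∃' (∃' (var 3 ≐ pair (var 1) (var 0) ∧
    sub (var 2 ◂ var 1 ◂ λ i → var (4 + i)) (solution k A) ∧ sub (var 2 ◂ var 0 ◂ λ i → var (4 + i))
        (solution k B)))
  solution k (A ∨ B) = ∃' (∃' (var 3 ≐ pair (var 1) (var 0) ∧
    (var 1 ≐ 𝟎 ∧ sub (λ i → var (4 + i)) (plug k ψ A) ∧ sub (var 2 ◂ var 0 ◂ λ i → var (4 + i))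
        (solution k A) ∨
     var 1 ≐ S 𝟎 ∧ ¬' (sub (λ i → var (4 + i)) (plug k ψ A)) ∧ sub
         (var 2 ◂ var 0 ◂ λ i → var (4 + i)) (solution k B))))
  solution k (∀' A) = ∀' (∀' (var 2 ≠ pair (var 1) (var 0) ∨
    sub (var 0 ◂ var 3 ◂ var 1 ◂ λ i → var (4 + i)) (solution (suc k) A)))
  solution k (∃' A) = ∃' (∃' (var 3 ≐ pair (var 1) (var 0) ∧
    sub (var 1 ◂ λ i → var (4 + i)) (Least (plug (suc k) ψ A)) ∧
    sub (var 2 ◂ var 0 ◂ var 1 ◂ λ i → var (4 + i)) (solution (suc k) A)))

  Sol : ℕ → Fm ⊤ → Sub → Tm → Tm → Ω
  Sol k A ρ c v = ⟦ solution k A ⟧ (c ◂ v ◂ ρ)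

  True : ℕ → Fm ⊤ → Sub → Ω
  True k A ρ = ⟦ plug k ψ A ⟧ ρ

  Sol-ext : ∀ k A → Γ ⊩ ρ ≋ ρ' → Γ ⊩ c ≈ c' → Γ ⊩ Sol k A ρ c v → Γ ⊩ Sol k A ρ' c' v
  Sol-ext k A e p = leibniz (solution k A) (p ∷≋ ≈-refl ∷≋ e)

  Sol-sub : ∀ k A {τ} (σ : Sub) → (∀ i → substT τ (σ i) ≡ (c ◂ v ◂ ρ) i) →
            ⟦ sub σ (solution k A) ⟧ τ ⟺ Sol k A ρ c v
  Sol-sub k A σ = ev-sub (solution k A)

  ⟦Sol-∧⟧ : ∀ k A B ρ c v → Sol k (A ∧ B) ρ c v ⟺
    Σᵒ λ v₁ → Σᵒ λ v₂ → v ≈ pair v₁ v₂ ∧ᵒ Sol k A ρ c v₁ ∧ᵒ Sol k B ρ c v₂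
  ⟦Sol-∧⟧ k A B ρ c v = Σ-cong λ v₁ → Σ-cong λ v₂ → ∧-cong ⟺-refl (∧-cong
    (Sol-sub k A {v₂ ◂ v₁ ◂ c ◂ v ◂ ρ} _ (refl ∷ᵉ refl ∷ᵉ λ _ → refl))
    (Sol-sub k B {v₂ ◂ v₁ ◂ c ◂ v ◂ ρ} _ (refl ∷ᵉ refl ∷ᵉ λ _ → refl)))

  ⟦Sol-∨⟧ : ∀ k A B ρ c v → Sol k (A ∨ B) ρ c v ⟺
    Σᵒ λ d → Σᵒ λ w → v ≈ pair d w ∧ᵒ
      (d ≈ 𝟎 ∧ᵒ True k A ρ ∧ᵒ Sol k A ρ c w ∨ᵒ d ≈ S 𝟎 ∧ᵒ ¬ᵒ (True k A ρ) ∧ᵒ Sol k B ρ c w)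
  ⟦Sol-∨⟧ k A B ρ c v = Σ-cong λ d → Σ-cong λ w → ∧-cong ⟺-refl (∨-cong
    (∧-cong ⟺-refl (∧-cong (ev-sub (plug k ψ A) λ _ → refl)
      (Sol-sub k A {w ◂ d ◂ c ◂ v ◂ ρ} _ (refl ∷ᵉ refl ∷ᵉ λ _ → refl))))
    (∧-cong ⟺-refl (∧-cong (⟺-trans (ev-¬ (sub _ (plug k ψ A)))
        (¬-cong (ev-sub (plug k ψ A) λ _ → refl)))
      (Sol-sub k B {w ◂ d ◂ c ◂ v ◂ ρ} _ (refl ∷ᵉ refl ∷ᵉ λ _ → refl)))))

  ⟦Sol-∃⟧ : ∀ k A ρ c v → Sol k (∃' A) ρ c v ⟺
    Σᵒ λ d → Σᵒ λ w → v ≈ pair d w ∧ᵒ ⟦ Least (plug (suc k) ψ A) ⟧ (d ∷ₛ ρ) ∧ᵒ Sol (suc k) A (d ∷ₛ ρ) c w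
  ⟦Sol-∃⟧ k A ρ c v = Σ-cong λ d → Σ-cong λ w → ∧-cong ⟺-refl (∧-cong
    (ev-sub {ρ = w ◂ d ◂ c ◂ v ◂ ρ} {σ = var 1 ◂ λ i → var (4 + i)} (Least (plug (suc k) ψ A))
        (refl ∷ᵉ λ _ → refl))
    (Sol-sub (suc k) A {w ◂ d ◂ c ◂ v ◂ ρ} _ (refl ∷ᵉ refl ∷ᵉ refl ∷ᵉ λ _ → refl)))

  ⟦Sol-∀⟧ : ∀ k A ρ c v → Sol k (∀' A) ρ c v ⟺
    Λ λ x → Λ λ d → ¬ᵒ (c ≈ pair x d) ∨ᵒ Sol (suc k) A (x ∷ₛ ρ) d v
  ⟦Sol-∀⟧ k A ρ c v = Λ-cong λ x → Λ-cong λ d → ∨-cong ⟺-refl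
    (Sol-sub (suc k) A {d ◂ x ◂ c ◂ v ◂ ρ} _ (refl ∷ᵉ refl ∷ᵉ refl ∷ᵉ λ _ → refl))

  Sol-total : ∀ k A ρ → Γ ⊩ True k A ρ → ∀ c → Γ ⊩ Σᵒ λ v → Sol k A ρ c v
  Sol-total k (t ≐ u) ρ p c = ΣI 𝟎 ≈-refl
  Sol-total k (t ≠ u) ρ p c = ΣI 𝟎 ≈-refl
  Sol-total k (pos _ t) ρ p c = ΣI 𝟎 ≈-refl
  Sol-total k (neg _ t) ρ p c = ΣI 𝟎 ≈-refl
  Sol-total k (A ∧ B) ρ p c = ΣE (Sol-total k A ρ (π₁ p) c) λ i v₁ s₁ → ΣE
      (Sol-total k B ρ (π₂ p) c ↑ i) λ j v₂ s₂ →
    ΣI (pair v₁ v₂) (from (⟦Sol-∧⟧ k A B ρ c _) (ΣI v₁ (ΣI v₂ (≈-refl ,ᵒ (s₁ ↑ j) ,ᵒ s₂))))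
  Sol-total k (A ∨ B) ρ p c = ∨E (em (True k A ρ))
    (λ _ a → ΣE (Sol-total k A ρ a c) λ i w s →
      ΣI (pair 𝟎 w) (from (⟦Sol-∨⟧ k A B ρ c _) (ΣI 𝟎 (ΣI w (≈-refl ,ᵒ inl (≈-refl ,ᵒ (a ↑ i) ,ᵒ s))))))
    (λ h n → ΣE (Sol-total k B ρ (∨E (p ↑ h) (λ i a → ⊥E ((n ↑ i) · a)) (λ _ b → b)) c) λ i w s →
      ΣI (pair (S 𝟎) w) (from (⟦Sol-∨⟧ k A B ρ c _) (ΣI (S 𝟎)
          (ΣI w (≈-refl ,ᵒ inr (≈-refl ,ᵒ (n ↑ i) ,ᵒ s))))))
  -- The pairing polynomial is not onto; an argument that is no pair receives the value 0.
  Sol-total k (∀' A) ρ p c = ∨E (em (Σᵒ λ x → Σᵒ λ d → c ≈ pair x d))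
    (λ h q → ΣE q λ i x q → ΣE q λ j d eq → ΣE (Sol-total (suc k) A (x ∷ₛ ρ) (ΛE (p ↑ h ↑ i ↑ j) x)
        d) λ g v s →
      ΣI v (from (⟦Sol-∀⟧ k A ρ c v) (ΛI λ x' → ΛI λ d' → ⇒∨ λ f eq' →
        let eq'' = ≈-euclid (eq ↑ g ↑ f) eq' in
        Sol-ext (suc k) A (pair-inj₁ eq'' ∷≋ ≋-refl) (pair-inj₂ eq'') (s ↑ f))))
    (λ h n → ΣI 𝟎 (from (⟦Sol-∀⟧ k A ρ c 𝟎) (ΛI λ x → ΛI λ d → ⇒∨ λ f eq → ⊥E
        ((n ↑ f) · ΣI x (ΣI d eq)))))
  Sol-total k (∃' A) ρ p c = ΣE p λ _ x p → ΣE (least (plug (suc k) ψ A) ρ p) λ _ d l →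
    ΣE (Sol-total (suc k) A (d ∷ₛ ρ) (π₁ l) c) λ i w s →
    ΣI (pair d w) (from (⟦Sol-∃⟧ k A ρ c _) (ΣI d (ΣI w (≈-refl ,ᵒ (l ↑ i) ,ᵒ s))))

  Bit : Tm → Tm → Ω
  Bit q b = (b ≈ 𝟎 ⇒ᵒ ⟦ ψ ⟧ (q ∷ₛ π)) ∧ᵒ (⟦ ψ ⟧ (q ∷ₛ π) ⇒ᵒ b ≈ 𝟎)

  private
    ≈-≡ : t ≡ u → Γ ⊩ t ≈ u
    ≈-≡ refl = ≈-refl

    tail-suc : (∀ i → ρ (suc (i + k)) ≡ π i) → ∀ t i → (t ∷ₛ ρ) (suc (i + suc k)) ≡ π i
    tail-suc {ρ} {k} e t i = trans (cong ρ (+-suc i k)) (e i)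

  -- The matrix is evaluated in an environment ρ' without the parameters π.
  Sol-good : ∀ k A ρ ρ' → BoundF (suc k) A → (∀ i → i < suc k → ρ i ≡ ρ' i) →
      (∀ i → ρ (suc (i + k)) ≡ π i) →
    Γ ⊩ True k A ρ → Γ ⊩ Bit q b → Γ ⊩ Sol k A ρ c v → Γ ⊩ Sol k A ρ c' v' → Γ ⊩ Sk A ρ' q b c v c' v'
  Sol-good k (t ≐ u) ρ ρ' (bt , bu) ag tl p bit s s' = from (⟦Sk-≐⟧ t u)
    (≈-trans (≈-≡ (sym (substT-agree t bt ag))) (≈-trans p (≈-≡ (substT-agree u bu ag))))
  Sol-good {v = v} {v' = v'} k (t ≠ u) ρ ρ' (bt , bu) ag tl p bit s s' = from
      (¬-cong (⟦Sk-≐⟧ {v = v} {v' = v'} t u)) (⇒I λ i eq →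
    (p ↑ i) · ≈-trans (≈-≡ (substT-agree t bt ag)) (≈-trans eq (≈-≡ (sym (substT-agree u bu ag)))))
  Sol-good k (pos tt t) ρ ρ' bt ag tl p bit s s' = from (⟦Sk-pos⟧ t) (⇒∨ λ i eq → (π₂ bit ↑ i) ·
    leibniz ψ (≈-trans (≈-≡ (substT-agree t bt ag)) (≈-sym eq) ∷≋ ≋-refl)
        (to (ev-plug ψ π (pos tt t) tl) p ↑ i))
  Sol-good k (neg tt t) ρ ρ' bt ag tl p bit s s' = from (⟦Sk-neg⟧ t) (⇒∨ λ i eq → ⇒I λ j z →
    (to (ev-plug ψ π (neg tt t) tl) p ↑ i ↑ j) ·
    leibniz ψ (≈-trans (eq ↑ j) (≈-≡ (sym (substT-agree t bt ag))) ∷≋ ≋-refl) ((π₁ bit ↑ i ↑ j) · z))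
  Sol-good k (A ∧ B) ρ ρ' (ba , bb) ag tl p bit s s' = from (⟦Sk-∧⟧ A B ρ' _ _ _ _ _ _)
    (ΣE (to (⟦Sol-∧⟧ k A B ρ _ _) s) λ i₁ v₁ s → ΣE s λ i₂ v₂ s →
     ΣE (to (⟦Sol-∧⟧ k A B ρ _ _) s' ↑ i₁ ↑ i₂) λ i₃ v₁' s' → ΣE s' λ i₄ v₂' s' →
     let s″ = s ↑ i₃ ↑ i₄ ; p' = p ↑ i₁ ↑ i₂ ↑ i₃ ↑ i₄ ; bit' = bit ↑ i₁ ↑ i₂ ↑ i₃ ↑ i₄ in
     ΣI v₁ (ΣI v₂ (ΣI v₁' (ΣI v₂' (π₁ s″ ,ᵒ π₁ s' ,ᵒ
       Sol-good k A ρ ρ' ba ag tl (π₁ p') bit' (π₁ (π₂ s″)) (π₁ (π₂ s')) ,ᵒ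
       Sol-good k B ρ ρ' bb ag tl (π₂ p') bit' (π₂ (π₂ s″)) (π₂ (π₂ s')))))))
  Sol-good k (A ∨ B) ρ ρ' (ba , bb) ag tl p bit s s' = from (⟦Sk-∨⟧ A B ρ' _ _ _ _ _ _)
    (ΣE (to (⟦Sol-∨⟧ k A B ρ _ _) s) λ i₁ d s → ΣE s λ i₂ w s →
     ΣE (to (⟦Sol-∨⟧ k A B ρ _ _) s' ↑ i₁ ↑ i₂) λ i₃ d' s' → ΣE s' λ i₄ w' s' →
     ∨E (π₂ (s ↑ i₃ ↑ i₄))
       (λ j r → ∨E (π₂ s' ↑ j)
         (λ h r' → ΣI d (ΣI w (ΣI w' ((π₁ s ↑ i₃ ↑ i₄ ↑ j ↑ h) ,ᵒ
           ≈-trans (π₁ s' ↑ j ↑ h) (pair-cong (≈-trans (π₁ r') (≈-sym (π₁ r ↑ h))) ≈-refl) ,ᵒ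
           inl ((π₁ r ↑ h) ,ᵒ Sol-good k A ρ ρ' ba ag tl (π₁ (π₂ r'))
               (bit ↑ i₁ ↑ i₂ ↑ i₃ ↑ i₄ ↑ j ↑ h) (π₂ (π₂ r ↑ h)) (π₂ (π₂ r')))))))
         (λ h r' → ⊥E (π₁ (π₂ r') · π₁ (π₂ r ↑ h))))
       (λ j r → ∨E (π₂ s' ↑ j)
         (λ h r' → ⊥E (π₁ (π₂ r ↑ h) · π₁ (π₂ r')))
         (λ h r' → ΣI d (ΣI w (ΣI w' ((π₁ s ↑ i₃ ↑ i₄ ↑ j ↑ h) ,ᵒ
           ≈-trans (π₁ s' ↑ j ↑ h) (pair-cong (≈-trans (π₁ r') (≈-sym (π₁ r ↑ h))) ≈-refl) ,ᵒ
           inr ((⇒I λ g z → S≉0 (≈-euclid (π₁ r ↑ h ↑ g) z)) ,ᵒ Sol-good k B ρ ρ' bb ag tl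
             (∨E (p ↑ i₁ ↑ i₂ ↑ i₃ ↑ i₄ ↑ j ↑ h) (λ g a → ⊥E ((π₁ (π₂ r') ↑ g) · a)) (λ _ x → x))
             (bit ↑ i₁ ↑ i₂ ↑ i₃ ↑ i₄ ↑ j ↑ h) (π₂ (π₂ r ↑ h)) (π₂ (π₂ r')))))))))
  Sol-good k (∀' A) ρ ρ' ba ag tl p bit s s' = from (⟦Sk-∀⟧ A ρ' _ _ _ _ _ _)
    (ΛI λ x → ΛI λ d → ΛI λ d' → ⇒∨ λ i eq → ⇒∨ λ j eq' →
      Sol-good (suc k) A (x ∷ₛ ρ) (x ∷ₛ ρ') ba (∷ₛ-agree ag x) (tail-suc {ρ} tl x)
          (ΛE (p ↑ i ↑ j) x) (bit ↑ i ↑ j)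
        (∨⇒ (ΛE (ΛE (to (⟦Sol-∀⟧ k A ρ _ _) s ↑ i ↑ j) x) d) (eq ↑ j))
        (∨⇒ (ΛE (ΛE (to (⟦Sol-∀⟧ k A ρ _ _) s' ↑ i ↑ j) x) d') eq'))
  Sol-good k (∃' A) ρ ρ' ba ag tl p bit s s' = from (⟦Sk-∃⟧ A ρ' _ _ _ _ _ _)
    (ΣE (to (⟦Sol-∃⟧ k A ρ _ _) s) λ i₁ d s → ΣE s λ i₂ w s →
     ΣE (to (⟦Sol-∃⟧ k A ρ _ _) s' ↑ i₁ ↑ i₂) λ i₃ d' s' → ΣE s' λ i₄ w' s' →
     let s″ = s ↑ i₃ ↑ i₄
         -- The least witnesses found at the two arguments agree, which is the constancy that the
         -- Skolem form demands.
         d'≈d = Least-unique (plug (suc k) ψ A) (π₁ (π₂ s')) (π₁ (π₂ s″))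
     in ΣI d (ΣI w (ΣI w' (π₁ s″ ,ᵒ ≈-trans (π₁ s') (pair-cong d'≈d ≈-refl) ,ᵒ
       Sol-good (suc k) A (d ∷ₛ ρ) (d ∷ₛ ρ') ba (∷ₛ-agree ag d) (tail-suc {ρ} tl d) (π₁ (π₁ (π₂ s″)))
         (bit ↑ i₁ ↑ i₂ ↑ i₃ ↑ i₄) (π₂ (π₂ s″)) (Sol-ext (suc k) A (d'≈d ∷≋ ≋-refl) ≈-refl
             (π₂ (π₂ s')))))))

-- The equivalence for a single number parameter

module OneVariable (C : Fm ⊤) (C-bound : BoundF 1 C) where

  -- A single function codes bits and Skolem values together: its value at an argument is the pair
  -- of both. The first of the three values contributes its bit, the other two their Skolem
  -- components.
  matrix : Fm ⊥
  matrix = ∃' (∃' (∃' (∃' (∃' (∃' (var 7 ≐ pair (var 5) (var 4) ∧ var 9 ≐ pair (var 3) (var 2) ∧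
    var 11 ≐ pair (var 1) (var 0) ∧
    sub (var 6 ◂ var 5 ◂ var 8 ◂ var 2 ◂ var 10 ◂ var 0 ◂ λ i → var (12 + i)) (skolem C)))))))

  open Branch matrix

  ⟦matrix'⟧ : ∀ e q v₁ c v₂ c' v₃ → Matrix e q v₁ c v₂ c' v₃ ⟺
    Σᵒ λ b → Σᵒ λ w₁ → Σᵒ λ b₂ → Σᵒ λ v → Σᵒ λ b₃ → Σᵒ λ v' →
      v₁ ≈ pair b w₁ ∧ᵒ v₂ ≈ pair b₂ v ∧ᵒ v₃ ≈ pair b₃ v' ∧ᵒ Sk C (e ∷ₛ 𝟘) q b c v c' v'
  ⟦matrix'⟧ e q v₁ c v₂ c' v₃ = Σ-cong λ b → Σ-cong λ w₁ → Σ-cong λ b₂ → Σ-cong λ v → Σ-cong λ b₃ →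
      Σ-cong λ v' →
    ∧-cong ⟺-refl (∧-cong ⟺-refl (∧-cong ⟺-refl
      (Sk-sub C {v' ◂ b₃ ◂ v ◂ b₂ ◂ w₁ ◂ b ◂ q ◂ v₁ ◂ c ◂ v₂ ◂ c' ◂ v₃ ◂ e ◂ 𝟘} _
          (refl ∷ᵉ refl ∷ᵉ refl ∷ᵉ refl ∷ᵉ refl ∷ᵉ refl ∷ᵉ λ _ → refl))))

  Holds : Fm OpForm → Tm → Ω
  Holds θ e = ev (λ _ → θ ∋_) (e ∷ₛ 𝟘) C

  module _ (θ : Fm OpForm) where
    open Solution θ var

    -- The definable `f` attached to the set `θ`, with bit 0 for membership and 1 for
    -- non-membership, paired with the Skolem solution for `θ`.
    relF : Fm OpForm
    relF = ∃' (∃' (var 3 ≐ pair (var 1) (var 0) ∧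
      (var 1 ≐ 𝟎 ∧ sub (var 2 ◂ λ i → var (5 + i)) θ ∨ var 1 ≐ S 𝟎 ∧ ¬'
          (sub (var 2 ◂ λ i → var (5 + i)) θ)) ∧
      sub (var 2 ◂ var 0 ◂ λ i → var (4 + i)) (solution 0 C)))

    ⟦rel⟧ : ∀ e c v → ⟦ relF ⟧ (c ◂ v ◂ e ◂ var) ⟺ Σᵒ λ b → Σᵒ λ w → v ≈ pair b w ∧ᵒ
      (b ≈ 𝟎 ∧ᵒ ⟦ θ ⟧ (c ∷ₛ var) ∨ᵒ b ≈ S 𝟎 ∧ᵒ ¬ᵒ (⟦ θ ⟧ (c ∷ₛ var))) ∧ᵒ Sol 0 C (e ∷ₛ var) c w
    ⟦rel⟧ e c v = Σ-cong λ b → Σ-cong λ w → ∧-cong ⟺-refl (∧-cong (∨-cong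
      (∧-cong ⟺-refl (ev-sub θ (refl ∷ᵉ λ _ → refl)))
      (∧-cong ⟺-refl (⟺-trans (ev-¬ (sub _ θ)) (¬-cong (ev-sub θ (refl ∷ᵉ λ _ → refl))))))
      (Sol-sub 0 C {w ◂ b ◂ c ◂ v ◂ e ◂ var} _ (refl ∷ᵉ refl ∷ᵉ λ _ → refl)))

    toBit : ∀ b q → Γ ⊩ b ≈ 𝟎 ∧ᵒ ⟦ θ ⟧ (q ∷ₛ var) ∨ᵒ b ≈ S 𝟎 ∧ᵒ ¬ᵒ (⟦ θ ⟧ (q ∷ₛ var)) → Γ ⊩ Bit q b
    toBit b q p = ∨E p
      (λ _ p → (⇒I λ i _ → π₂ p ↑ i) ,ᵒ (⇒I λ i _ → π₁ p ↑ i))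
      (λ _ p → (⇒I λ i z → ⊥E (S≉0 (≈-euclid (π₁ p ↑ i) z))) ,ᵒ (⇒I λ i x → ⊥E ((π₂ p ↑ i) · x)))

    ⟦True⟧ : ∀ e → True 0 C (e ∷ₛ var) ⟺ Holds θ e
    ⟦True⟧ e = ⟺-trans (ev-plug θ var C (λ i → cong var (+-identityʳ i)))
      (⟺-trans (ev-ext (λ _ t → ⟺-sym (∋-⟦⟧ θ)) C (λ _ → refl))
               (ev-agree C C-bound λ { zero _ → refl ; (suc i) (s≤s ()) }))

    Holds⇒¬Der : ∀ e → Γ ⊩ Holds θ e → Γ ⊩ ¬ᵒ (Der e 𝟎 𝟎)
    Holds⇒¬Der e p = Der-sound-root relF (e ∷ₛ var) e
      (ΛI λ c → ΣE (Sol-total 0 C (e ∷ₛ var) tr c) λ i w s → ∨E (em (⟦ θ ⟧ (c ∷ₛ var)))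
        (λ j x → ΣI (pair 𝟎 w) (from (⟦rel⟧ e c _) (ΣI 𝟎
            (ΣI w (≈-refl ,ᵒ inl (≈-refl ,ᵒ x) ,ᵒ (s ↑ j))))))
        (λ j x → ΣI (pair (S 𝟎) w) (from (⟦rel⟧ e c _) (ΣI (S 𝟎)
            (ΣI w (≈-refl ,ᵒ inr (≈-refl ,ᵒ x) ,ᵒ (s ↑ j)))))))
      (ΛI λ q → ΛI λ v₁ → ΛI λ c → ΛI λ v₂ → ΛI λ c' → ΛI λ v₃ → ⇒I λ i₁ f₁ → ⇒I λ i₂ f₂ → ⇒I λ i₃ f₃ →
        from (⟦matrix'⟧ e q v₁ c v₂ c' v₃)
        (ΣE (to (⟦rel⟧ e q v₁) f₁ ↑ i₂ ↑ i₃) λ j₁ b r₁ → ΣE r₁ λ j₂ w₁ r₁ →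
         ΣE (to (⟦rel⟧ e c v₂) f₂ ↑ i₃ ↑ j₁ ↑ j₂) λ j₃ b₂ r₂ → ΣE r₂ λ j₄ v r₂ →
         ΣE (to (⟦rel⟧ e c' v₃) f₃ ↑ j₁ ↑ j₂ ↑ j₃ ↑ j₄) λ j₅ b₃ r₃ → ΣE r₃ λ j₆ v' r₃ →
         let r₁' = r₁ ↑ j₃ ↑ j₄ ↑ j₅ ↑ j₆ ; r₂' = r₂ ↑ j₅ ↑ j₆ in
         ΣI b (ΣI w₁ (ΣI b₂ (ΣI v (ΣI b₃ (ΣI v' (π₁ r₁' ,ᵒ π₁ r₂' ,ᵒ π₁ r₃ ,ᵒ
           Sol-good 0 C (e ∷ₛ var) (e ∷ₛ 𝟘) C-bound (λ { zero _ → refl ; (suc i) (s≤s ()) })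
             (λ i → cong var (+-identityʳ i)) (tr ↑ i₁ ↑ i₂ ↑ i₃ ↑ j₁ ↑ j₂ ↑ j₃ ↑ j₄ ↑ j₅ ↑ j₆)
             (toBit b q (π₁ (π₂ r₁'))) (π₂ (π₂ r₂')) (π₂ (π₂ r₃))))))))))
      where tr = from (⟦True⟧ e) p

  module _ (e : Tm) where
    bit rest : Tm → Tm → Ω
    bit q b = Σᵒ λ v → Σᵒ λ w → Graph e q v ∧ᵒ v ≈ pair b w
    rest c w = Σᵒ λ v → Σᵒ λ b → Graph e c v ∧ᵒ v ≈ pair b w

    open Model bit

    memberF : Fm OpForm
    memberF = ∃' (∃' (∃' (sub (var 3 ◂ var 1 ◂ var 4 ◂ 𝟘) graphF ∧ var 1 ≐ pair (var 2) (var 0))) ∧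
        var 0 ≐ 𝟎)

    ⟦member⟧ : ∀ q → ⟦ memberF ⟧ (q ◂ e ◂ 𝟘) ⟺ In q
    ⟦member⟧ q = Σ-cong λ b → ∧-cong (Σ-cong λ v → Σ-cong λ w → ∧-cong
      (ev-sub graphF (refl ∷ᵉ refl ∷ᵉ refl ∷ᵉ λ _ → refl)) ⟺-refl) ⟺-refl

    witness : Fm OpForm
    witness = sub (liftN (e ∷ₛ 𝟘)) memberF

    ¬Der⇒Holds : Γ ⊩ ¬ᵒ (Der e 𝟎 𝟎) → Γ ⊩ Holds witness e
    ¬Der⇒Holds {Γ} n = to (ev-ext (λ _ q → ⟺-sym (⟺-trans (truth-inst memberF q) (⟦member⟧ q))) C
        (λ _ → refl))
      (model C (e ∷ₛ 𝟘) rest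
        (λ q → shape q λ v b w p → ΣI b (ΣI v (ΣI w p)))
        (λ c → shape c λ v b w p → ΣI w (ΣI v (ΣI b p)))
        λ i g₁ g₂ g₃ → ΣE g₁ λ j₁ v₁ g₁ → ΣE g₁ λ j₂ w₁ g₁ → ΣE (g₂ ↑ j₁ ↑ j₂) λ j₃ v₂ g₂ → ΣE g₂
            λ j₄ b₂ g₂ →
          ΣE (g₃ ↑ j₁ ↑ j₂ ↑ j₃ ↑ j₄) λ j₅ v₃ g₃ → ΣE g₃ λ j₆ b₃ g₃ →
          ΣE (to (⟦matrix'⟧ e _ v₁ _ v₂ _ v₃) (Graph-good (n ↑ i ↑ j₁ ↑ j₂ ↑ j₃ ↑ j₄ ↑ j₅ ↑ j₆)
            (π₁ g₁ ↑ j₃ ↑ j₄ ↑ j₅ ↑ j₆) (π₁ g₂ ↑ j₅ ↑ j₆) (π₁ g₃)))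
          λ h₁ b' p → ΣE p λ h₂ _ p → ΣE p λ h₃ _ p → ΣE p λ h₄ w₂ p → ΣE p λ h₅ _ p → ΣE p λ h₆ w₃ p →
          let up : ∀ {Q} → _ ⊩ Q → _ ⊩ Q
              up = λ p → p ↑ h₁ ↑ h₂ ↑ h₃ ↑ h₄ ↑ h₅ ↑ h₆
          in PA-leibniz (skolem C)
            (≈-refl ∷≋ pair-inj₁ (≈-euclid (π₁ p) (up (π₂ g₁ ↑ j₃ ↑ j₄ ↑ j₅ ↑ j₆))) ∷≋
             ≈-refl ∷≋ pair-inj₂ (≈-euclid (π₁ (π₂ p)) (up (π₂ g₂ ↑ j₅ ↑ j₆))) ∷≋
             ≈-refl ∷≋ pair-inj₂ (≈-euclid (π₁ (π₂ (π₂ p))) (up (π₂ g₃))) ∷≋ ≋-refl)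
            (π₂ (π₂ (π₂ p))))
      where
        shape : ∀ c {Q} → (∀ {Δ} v b w → Δ ⊩ Graph e c v ∧ᵒ v ≈ pair b w → Δ ⊩ Q) → Γ ⊩ Q
        shape c f = ΣE (Graph-total n c) λ i v g →
          ΣE (to (⟦matrix'⟧ e c v c v c v) (Graph-good (n ↑ i) g g g))
          λ h₁ b p → ΣE p λ h₂ w p → ΣE p λ h₃ _ p → ΣE p λ h₄ _ p → ΣE p λ h₅ _ p → ΣE p λ h₆ _ p →
          f v b w ((g ↑ h₁ ↑ h₂ ↑ h₃ ↑ h₄ ↑ h₅ ↑ h₆) ,ᵒ π₁ p)

  -- The backward direction is classical: outside the well-founded part, the set read off the
  -- leftmost branch satisfies `C` and contradicts the right-hand side.
  Der⟺ : ∀ e → Der e 𝟎 𝟎 ⟺ Λˢ λ θ → ¬ᵒ (Holds θ e)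
  Der⟺ e = equiv
    (λ d → ΛˢI λ θ → ⇒I λ i p → Holds⇒¬Der θ e p · (d ↑ i))
    (λ p → raa λ i n → ΛˢE (p ↑ i) (witness e) · ¬Der⇒Holds e n)

-- Contraction of the free number variables to one

merge : Fm ⊤ → Fm ⊤
merge A = ∃' (∃' (var 2 ≐ pair (var 1) (var 0) ∧ sub (var 1 ◂ var 0 ◂ λ i → var (3 + i)) A))

mergeEnv : Sub → Sub
mergeEnv ρ = pair (ρ 0) (ρ 1) ∷ₛ λ i → ρ (2 + i)

⟦merge⟧ : ∀ A ρ → ev I ρ (merge A) ⟺
  Σᵒ λ a → Σᵒ λ b → ρ 0 ≈ pair a b ∧ᵒ ev I (a ◂ b ◂ λ i → ρ (suc i)) A
⟦merge⟧ A ρ = Σ-cong λ a → Σ-cong λ b → ∧-cong ⟺-refl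
  (ev-sub A (refl ∷ᵉ refl ∷ᵉ λ _ → refl))

ev-merge : Extensional I → ∀ A ρ → ev I (mergeEnv ρ) (merge A) ⟺ ev I ρ A
ev-merge x A ρ = equiv
  (λ p → ΣE (to (⟦merge⟧ A (mergeEnv ρ)) p) λ _ a p → ΣE p λ _ b p →
    to (≡-env A env) (ev-leibniz x A (≈-sym (pair-inj₁ (π₁ p)) ∷≋ ≈-sym (pair-inj₂ (π₁ p)) ∷≋
        ≋-refl) (π₂ p)))
  (λ p → from (⟦merge⟧ A (mergeEnv ρ)) (ΣI (ρ 0) (ΣI (ρ 1) (≈-refl ,ᵒ from (≡-env A env) p))))
  where env : ∀ i → (ρ 0 ◂ ρ 1 ◂ λ i → ρ (2 + i)) i ≡ ρ i
        env 0 = refl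
        env 1 = refl
        env (suc (suc i)) = refl

-- A semantic bound on the free variables; each `merge` lowers it by one without any counting of
-- indices inside the formula.
Local : ℕ → Fm ⊤ → Set
Local n A = ∀ {I ρ ρ'} → (∀ i → i < n → ρ i ≡ ρ' i) → ev I ρ A ⟺ ev I ρ' A

merge-Local : ∀ {n} A → Local (2 + n) A → Local (1 + n) (merge A)
merge-Local A l {ρ = ρ} {ρ'} e = ⟺-trans (⟦merge⟧ A ρ) (⟺-trans
  (Σ-cong λ a → Σ-cong λ b → ∧-cong (⟺-≡ (cong (_≈ pair a b) (e 0 (s≤s z≤n))))
    (l (∷ₛ-agree (∷ₛ-agree (λ i i<n → e (suc i) (s≤s i<n)) b) a)))
  (⟺-sym (⟦merge⟧ A ρ')))

mergeAll : ℕ → Fm ⊤ → Fm ⊤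
mergeAll zero A = A
mergeAll (suc n) A = mergeAll n (merge A)

tuple : ℕ → Sub → Tm
tuple zero ρ = ρ 0
tuple (suc n) ρ = tuple n (mergeEnv ρ)

tuple-ext : ∀ n → (∀ i → ρ i ≡ ρ' i) → tuple n ρ ≡ tuple n ρ'
tuple-ext zero e = e 0
tuple-ext (suc n) e = tuple-ext n λ { zero → cong₂ pair (e 0) (e 1) ; (suc i) → e (2 + i) }

tuple-subst : ∀ n σ → substT ρ (tuple n σ) ≡ tuple n (λ i → substT ρ (σ i))
tuple-subst zero σ = refl
tuple-subst (suc n) σ = trans (tuple-subst n (mergeEnv σ))
  (tuple-ext n λ { zero → refl ; (suc i) → refl })

ev-mergeAll : Extensional I → ∀ n A ρ → Local (suc n) A → ∀ π →
              ev I (tuple n ρ ∷ₛ π) (mergeAll n A) ⟺ ev I ρ A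
ev-mergeAll x zero A ρ l π = l λ { zero _ → refl ; (suc i) (s≤s ()) }
ev-mergeAll x (suc n) A ρ l π =
  ⟺-trans (ev-mergeAll x n (merge A) (mergeEnv ρ) (merge-Local A l) π) (ev-merge x A ρ)

-- `Der` at the empty list says that no set satisfies the matrix, so the construction is applied to
-- `¬' B`. The free number variables of `B` enter as the tuple in the first component of `derT`.
Π¹₁-definable : Π¹₁-Definable
Π¹₁-definable B = pos Φ (derT (tuple bd var) 𝟎 𝟎) , λ ρ →
  ⟺-trans (⟺-≡ (cong (λ e → Iat Φ (derT e 𝟎 𝟎)) (tuple-subst bd var)))
  (⟺-trans (Der⟺ (tuple bd ρ)) (Λˢ-cong λ θ →
    ⟺-trans (¬-cong (⟺-trans (ev-sub (mergeAll bd (¬' B)) λ { zero → refl ; (suc i) → refl })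
      (⟺-trans (ev-mergeAll (λ _ → ∋-ext θ) bd (¬' B) ρ local 𝟘) (ev-¬ B)))) ¬¬))
  where
    bd : ℕ
    bd = proj₁ (boundF (¬' B))
    local : Local (suc bd) (¬' B)
    local = ev-agree (¬' B) (BoundF-mono (¬' B) (n≤1+n bd) (proj₂ (boundF (¬' B))))
    C : Fm ⊤
    -- After `bd` merges only variable 0 matters, so setting the others to 0 turns the semantic
    -- bound into the syntactic one.
    C = sub only-x (mergeAll bd (¬' B))
    C-bound : BoundF 1 C
    C-bound = BoundF-sub (λ { zero → s≤s z≤n ; (suc i) → tt }) (mergeAll bd (¬' B))
    open OneVariable C C-bound
    open Branch matrix using (Φ)

theorem4p5 : (ψ : Fm OpForm) → Π¹₁-CA₀⁻+LF ⊢² (ψ ⋆ ∷ []) → ID₁ ⊢ (ψ ∷ [])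
theorem4p5 = conservative Π¹₁-definable
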